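{- Let $P(X)=\sum_{i=0}^n a_iX^i\in K[X]$ be a polynomial of degree $n$. Assume that $(d,\mathrm{val}(a_d))$ is an extremal point of $\mathrm{NP}(P)$, for some integer $0\le d\le n$. Define sequences $(A_i)_{i\ge0}$, $(B_i)_{i\ge1}$, $(V_i)_{i\ge0}$ in $K[X]$ by $$A_0=\sum_{i=0}^d a_iX^i,\qquad V_0=1,$$ $$A_{i+1}=A_i+(V_iP\bmod A_i),\qquad B_{i+1}=P\,\mathrm{div}\,A_{i+1},\qquad V_{i+1}=(2V_i-V_i^2B_{i+1})\bmod A_{i+1}.$$ Then the following hold. 1. Each $A_i$ has degree $d$ and leading coefficient $a_d$, so the recursion is well defined. 2. The sequence $(A_i)$ converges coefficientwise to a polynomial $A_\infty$ which divides $P$, has degree $d$ and leading coefficient $a_d$, and satisfies $\mathrm{NF}(A_\infty)=\mathrm{NF}(P)|_{[0,d]}$. 3. Set $$\kappa=\mathrm{NF}(P)(d+1)+\mathrm{NF}(P)(d-1)-2\,\mathrm{NF}(P)(d),$$ with the conventions $\mathrm{NF}(P)(-1)=\mathrm{NF}(P)(n+1)=+\infty$. Then $\kappa>0$, and for all $i\ge0$, $$\mathrm{NF}(A_\infty-A_i)\ \ge\ \mathrm{NF}(P)|_{[0,d-1]}+2^i\kappa.$$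
   Context: $K$ is a complete discrete valuation field with valuation $\mathrm{val}:K\to\mathbb Z\cup\{+\infty\}$, normalized to be surjective, with $\mathrm{val}(0)=+\infty$. For $Q=\sum q_iX^i\in K[X]$ nonzero of degree $m$, its Newton function $\mathrm{NF}(Q):[0,m]\to\mathbb R\cup\{+\infty\}$ is the greatest convex function with $\mathrm{NF}(Q)(i)\le\mathrm{val}(q_i)$ for all integers $0\le i\le m$. Its epigraph (the convex hull of the sets $\{(i,y):y\ge\mathrm{val}(q_i)\}$) is the Newton polygon $\mathrm{NP}(Q)$; an extremal point of $\mathrm{NP}(Q)$ is a vertex of this epigraph. For a convex function $g$ on $[0,M]$ and a polynomial $Q$ of degree $\le M$, "$\mathrm{NF}(Q)\ge g$" means $\mathrm{val}(q_i)\ge g(i)$ for all integers $0\le i\le M$ (for $Q=0$ this always holds). $A\,\mathrm{div}\,B$ and $A\bmod B$ denote quotient and remainder in Euclidean division: $A=(A\,\mathrm{div}\,B)B+(A\bmod B)$ with $\deg(A\bmod B)<\deg B$.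
   Formalization: Newton functions and the Newton polygon are taken over the rationals: NF is defined at rational points of [0,m] with values in the rationals or +∞, and convexity and extremal points use rational points and weights. -}

module Defs where

open import Algebra.Bundles using (CommutativeRing)
open import Data.Bool.Base using (if_then_else_)
open import Data.Integer.Base as ℤ using (ℤ; +_)
open import Data.List.Base using (List; []; _∷_; map; applyUpTo)
open import Data.Maybe.Base as Maybe using (zipWith)
open import Data.Nat.Base as ℕ using (ℕ; zero; suc; s≤s)
open import Data.Nat.Properties using (m≤n⇒m<n∨m≡n)
open import Data.Product using (∃; ∃₂; _×_; _,_)
open import Data.Rational.Base as ℚ using (ℚ; 0ℚ; 1ℚ)
open import Data.Rational.Properties using (_≤?_)
open import Data.Sum.Base using (_⊎_; inj₁; inj₂)
open import Function.Bundles using (_⇔_; Equivalence)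
open import Level using (_⊔_) renaming (suc to lsuc)
open import Relation.Binary.PropositionalEquality.Core as ≡ using (_≡_)
import Relation.Binary.Construct.Add.Supremum.NonStrict as NonStrict
import Relation.Binary.Construct.Add.Supremum.Strict as Strict
import Relation.Binary.Reasoning.Setoid as SetoidReasoning
open import Relation.Nullary using (Dec; yes; no; ¬_; does; contradiction)
open import Relation.Nullary.Construct.Add.Supremum using (_⁺; ⊤⁺; [_])
open import Relation.Nullary.Decidable using (_×-dec_)
import Algebra.Properties.AbelianGroup as GroupProperties
import Algebra.Properties.Ring as RingProperties

------------------------------------------------------------------------
-- ℤ ∪ {+∞} and ℚ ∪ {+∞}; the point ⊤⁺ is +∞.

open NonStrict ℤ._≤_ public using () renaming (_≤⁺_ to _≤ℤ_)
open NonStrict ℚ._≤_ public using () renaming (_≤⁺_ to _≤ℚ_)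
open Strict    ℚ._<_ public using () renaming (_<⁺_ to _<ℚ_)

infixl 6 _+ℤ_ _+ℚ_ _-ℚ_
infixl 7 _⊓ℤ_ _·ℚ_

_+ℤ_ : ℤ ⁺ → ℤ ⁺ → ℤ ⁺
_+ℤ_ = zipWith ℤ._+_

_⊓ℤ_ : ℤ ⁺ → ℤ ⁺ → ℤ ⁺
⊤⁺    ⊓ℤ v     = v
[ k ] ⊓ℤ ⊤⁺    = [ k ]
[ k ] ⊓ℤ [ l ] = [ k ℤ.⊓ l ]

_+ℚ_ : ℚ ⁺ → ℚ ⁺ → ℚ ⁺
_+ℚ_ = zipWith ℚ._+_

-- Only meaningful when the second argument is finite.
_-ℚ_ : ℚ ⁺ → ℚ ⁺ → ℚ ⁺
_-ℚ_ = zipWith ℚ._-_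

-- Only used with a positive scalar, so that r · (+∞) = +∞.
_·ℚ_ : ℚ → ℚ ⁺ → ℚ ⁺
r ·ℚ v = Maybe.map (r ℚ.*_) v

ℤ→ℚ : ℤ → ℚ
ℤ→ℚ k = k ℚ./ 1

ℕ→ℚ : ℕ → ℚ
ℕ→ℚ i = ℤ→ℚ (+ i)

------------------------------------------------------------------------
-- Convexity.  A function on [0,m] is represented by a function on all of ℚ
-- whose values outside [0,m] are ignored.

_∈[0,_] : ℚ → ℕ → Set
x ∈[0, m ] = 0ℚ ℚ.≤ x × x ℚ.≤ ℕ→ℚ m

mix : ℚ → ℚ → ℚ → ℚ
mix t x y = t ℚ.* x ℚ.+ (1ℚ ℚ.- t) ℚ.* y

ConvexOn : ℕ → (ℚ → ℚ ⁺) → Set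
ConvexOn m f = ∀ x y t → x ∈[0, m ] → y ∈[0, m ] → 0ℚ ℚ.< t → t ℚ.< 1ℚ →
  f (mix t x y) ≤ℚ t ·ℚ f x +ℚ (1ℚ ℚ.- t) ·ℚ f y

Epigraph : ℕ → (ℚ → ℚ ⁺) → ℚ × ℚ → Set
Epigraph m f (x , y) = x ∈[0, m ] × f x ≤ℚ [ y ]

IsExtremalPoint : (ℚ × ℚ → Set) → ℚ × ℚ → Set
IsExtremalPoint S (x , y) = S (x , y) ×
  (∀ x₁ y₁ x₂ y₂ t → S (x₁ , y₁) → S (x₂ , y₂) → 0ℚ ℚ.< t → t ℚ.< 1ℚ →
    mix t x₁ x₂ ≡ x → mix t y₁ y₂ ≡ y →
    (x₁ , y₁) ≡ (x , y) × (x₂ , y₂) ≡ (x , y))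

extendBy∞ : ℕ → (ℚ → ℚ ⁺) → ℚ → ℚ ⁺
extendBy∞ m f x = if does ((0ℚ ≤? x) ×-dec (x ≤? ℕ→ℚ m)) then f x else ⊤⁺

-- The number κ attached to a function f on [0,n] and an abscissa d.
slopeGap : ℕ → (ℚ → ℚ ⁺) → ℕ → ℚ ⁺
slopeGap n f d =
  (g (ℕ→ℚ d ℚ.+ 1ℚ) +ℚ g (ℕ→ℚ d ℚ.- 1ℚ)) -ℚ ℕ→ℚ 2 ·ℚ g (ℕ→ℚ d)
  where g = extendBy∞ n f

------------------------------------------------------------------------

-- The existentials in `complete` are Σ-types, so completeness concerns
-- Cauchy sequences given with a modulus.  That val is a function into ℤ ∪ {+∞}
-- makes _≈ 0#_ decidable.
record CompleteDiscreteValuationField c ℓ : Set (lsuc (c ⊔ ℓ)) where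
  field
    commutativeRing : CommutativeRing c ℓ

  open CommutativeRing commutativeRing public hiding (zero)

  field
    1≉0     : ¬ 1# ≈ 0#
    inverse : ∀ x → ¬ x ≈ 0# → ∃ λ y → x * y ≈ 1#

    val            : Carrier → ℤ ⁺
    val-cong       : ∀ {x y} → x ≈ y → val x ≡ val y
    val-∞          : ∀ x → val x ≡ ⊤⁺ ⇔ x ≈ 0#
    val-*          : ∀ x y → val (x * y) ≡ val x +ℤ val y
    val-+          : ∀ x y → (val x ⊓ℤ val y) ≤ℤ val (x + y)
    val-surjective : ∀ v → ∃ λ x → val x ≡ v

  Cauchy : (ℕ → Carrier) → Set
  Cauchy u = ∀ (N : ℤ) → ∃ λ M → ∀ i j → M ℕ.≤ i → M ℕ.≤ j →
    [ N ] ≤ℤ val (u i - u j)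

  ConvergesTo : (ℕ → Carrier) → Carrier → Set
  ConvergesTo u l = ∀ (N : ℤ) → ∃ λ M → ∀ i → M ℕ.≤ i → [ N ] ≤ℤ val (u i - l)

  field
    complete : ∀ u → Cauchy u → ∃ λ l → ConvergesTo u l

------------------------------------------------------------------------

module Polynomials {c ℓ} (K : CompleteDiscreteValuationField c ℓ) where

  open CompleteDiscreteValuationField K

  -- The list a₀ ∷ a₁ ∷ … stands for a₀ + a₁X + …; trailing zeros are allowed,
  -- and equality of polynomials is _≈ₚ_.
  Poly : Set c
  Poly = List Carrier

  coeff : Poly → ℕ → Carrier
  coeff []      _       = 0#
  coeff (a ∷ p) zero    = a
  coeff (a ∷ p) (suc i) = coeff p i

  infix  4 _≈ₚ_ _∣ₚ_
  infixl 6 _+ₚ_ _-ₚ_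
  infixl 7 _*ₚ_ _·ₚ_ _div_ _mod_

  _≈ₚ_ : Poly → Poly → Set ℓ
  p ≈ₚ q = ∀ i → coeff p i ≈ coeff q i

  IsZero : Poly → Set ℓ
  IsZero p = ∀ i → coeff p i ≈ 0#

  DegreeBelow : Poly → ℕ → Set ℓ
  DegreeBelow p m = ∀ i → m ℕ.≤ i → coeff p i ≈ 0#

  HasDegree : Poly → ℕ → Set ℓ
  HasDegree p m = ¬ coeff p m ≈ 0# × DegreeBelow p (suc m)

  _+ₚ_ : Poly → Poly → Poly
  []      +ₚ q       = q
  (a ∷ p) +ₚ []      = a ∷ p
  (a ∷ p) +ₚ (b ∷ q) = (a + b) ∷ (p +ₚ q)

  _·ₚ_ : Carrier → Poly → Poly
  a ·ₚ p = map (a *_) p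

  _-ₚ_ : Poly → Poly → Poly
  p -ₚ q = p +ₚ map -_ q

  _*ₚ_ : Poly → Poly → Poly
  []      *ₚ q = []
  (a ∷ p) *ₚ q = (a ·ₚ q) +ₚ (0# ∷ (p *ₚ q))

  _∣ₚ_ : Poly → Poly → Set (c ⊔ ℓ)
  p ∣ₚ q = ∃ λ r → r *ₚ p ≈ₚ q

  ----------------------------------------------------------------------
  -- Euclidean division

  IsEuclideanDivision : (A B Q R : Poly) → Set ℓ
  IsEuclideanDivision A B Q R =
    A ≈ₚ Q *ₚ B +ₚ R × ∃ λ m → HasDegree B m × DegreeBelow R m

  open GroupProperties +-abelianGroup using (xyx⁻¹≈y)
  open RingProperties ring using (-0#≈0#)
  open SetoidReasoning setoid

  coeff-+ : ∀ p q i → coeff (p +ₚ q) i ≈ coeff p i + coeff q i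
  coeff-+ []      q       i       = sym (+-identityˡ _)
  coeff-+ (a ∷ p) []      i       = sym (+-identityʳ _)
  coeff-+ (a ∷ p) (b ∷ q) zero    = refl
  coeff-+ (a ∷ p) (b ∷ q) (suc i) = coeff-+ p q i

  coeff-· : ∀ a p i → coeff (a ·ₚ p) i ≈ a * coeff p i
  coeff-· a []      i       = sym (zeroʳ a)
  coeff-· a (b ∷ p) zero    = refl
  coeff-· a (b ∷ p) (suc i) = coeff-· a p i

  coeff-neg : ∀ p i → coeff (map -_ p) i ≈ - coeff p i
  coeff-neg []      i       = sym -0#≈0#
  coeff-neg (a ∷ p) zero    = refl
  coeff-neg (a ∷ p) (suc i) = coeff-neg p i

  coeff-sub· : ∀ p a q i →
    coeff (p -ₚ a ·ₚ q) i ≈ coeff p i - a * coeff q i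
  coeff-sub· p a q i = begin
    coeff (p -ₚ a ·ₚ q) i                ≈⟨ coeff-+ p _ i ⟩
    coeff p i + coeff (map -_ (a ·ₚ q)) i ≈⟨ +-congˡ (coeff-neg (a ·ₚ q) i) ⟩
    coeff p i - coeff (a ·ₚ q) i         ≈⟨ +-congˡ (-‿cong (coeff-· a q i)) ⟩
    coeff p i - a * coeff q i            ∎

  regroup : ∀ x y z → y + z ≈ (x + y) + (z - x)
  regroup x y z = sym (begin
    (x + y) + (z - x)   ≈⟨ +-assoc (x + y) z (- x) ⟨
    x + y + z - x       ≈⟨ +-congʳ (+-assoc x y z) ⟩
    x + (y + z) - x     ≈⟨ xyx⁻¹≈y x _ ⟩
    y + z               ∎)

  _≟0 : ∀ x → Dec (x ≈ 0#)
  x ≟0 with val x in eq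
  ... | ⊤⁺    = yes (Equivalence.to (val-∞ x) eq)
  ... | [ k ] = no λ x≈0 →
    contradiction (≡.trans (≡.sym eq) (Equivalence.from (val-∞ x) x≈0)) λ ()

  degree? : ∀ p → IsZero p ⊎ ∃ (HasDegree p)
  degree? []      = inj₁ λ _ → refl
  degree? (a ∷ p) with degree? p
  ... | inj₂ (m , lead , above) =
    inj₂ (suc m , lead , λ { (suc i) (s≤s m<i) → above i m<i })
  ... | inj₁ p≈0 with a ≟0
  ...   | yes a≈0 = inj₁ λ { zero → a≈0 ; (suc i) → p≈0 i }
  ...   | no  a≉0 = inj₂ (zero , a≉0 , λ { (suc i) _ → p≈0 i })

  divModByDegree : ∀ A B m → HasDegree B m →
    ∃₂ λ Q R → A ≈ₚ Q *ₚ B +ₚ R × DegreeBelow R m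
  divModByDegree []      B m deg = [] , [] , (λ _ → refl) , λ _ _ → refl
  divModByDegree (a ∷ A) B m deg@(lead , above)
    with Q , R , eq , small ← divModByDegree A B m deg
       | b , bm*b≈1 ← inverse (coeff B m) lead
    = l ∷ Q , S -ₚ l ·ₚ B , eq′ , small′
    where
    S = a ∷ R
    l = coeff S m * b

    eqS : ∀ i → coeff (a ∷ A) i ≈ coeff (0# ∷ (Q *ₚ B)) i + coeff S i
    eqS zero    = sym (+-identityˡ a)
    eqS (suc i) = trans (eq i) (coeff-+ (Q *ₚ B) R i)

    eq′ : (a ∷ A) ≈ₚ (l ∷ Q) *ₚ B +ₚ (S -ₚ l ·ₚ B)
    eq′ i = begin
      coeff (a ∷ A) i
        ≈⟨ eqS i ⟩
      coeff (0# ∷ (Q *ₚ B)) i + coeff S i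
        ≈⟨ regroup (l * coeff B i) _ _ ⟩
      (l * coeff B i + coeff (0# ∷ (Q *ₚ B)) i) + (coeff S i - l * coeff B i)
        ≈⟨ +-cong (+-congʳ (coeff-· l B i)) (coeff-sub· S l B i) ⟨
      (coeff (l ·ₚ B) i + coeff (0# ∷ (Q *ₚ B)) i) + coeff (S -ₚ l ·ₚ B) i
        ≈⟨ +-congʳ (coeff-+ (l ·ₚ B) _ i) ⟨
      coeff ((l ∷ Q) *ₚ B) i + coeff (S -ₚ l ·ₚ B) i
        ≈⟨ coeff-+ ((l ∷ Q) *ₚ B) _ i ⟨
      coeff ((l ∷ Q) *ₚ B +ₚ (S -ₚ l ·ₚ B)) i ∎

    S-above : ∀ i → suc m ℕ.≤ i → coeff S i ≈ 0#
    S-above (suc i) (s≤s m≤i) = small i m≤i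

    at-m : coeff S m ≈ l * coeff B m
    at-m = sym (begin
      coeff S m * b * coeff B m   ≈⟨ *-assoc _ b _ ⟩
      coeff S m * (b * coeff B m) ≈⟨ *-congˡ (*-comm b _) ⟩
      coeff S m * (coeff B m * b) ≈⟨ *-congˡ bm*b≈1 ⟩
      coeff S m * 1#              ≈⟨ *-identityʳ _ ⟩
      coeff S m                   ∎)

    small′ : DegreeBelow (S -ₚ l ·ₚ B) m
    small′ i m≤i with m≤n⇒m<n∨m≡n m≤i
    ... | inj₂ ≡.refl = begin
      coeff (S -ₚ l ·ₚ B) m       ≈⟨ coeff-sub· S l B m ⟩
      coeff S m - l * coeff B m   ≈⟨ +-congʳ at-m ⟩
      l * coeff B m - l * coeff B m ≈⟨ -‿inverseʳ _ ⟩
      0#                          ∎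
    ... | inj₁ m<i = begin
      coeff (S -ₚ l ·ₚ B) i       ≈⟨ coeff-sub· S l B i ⟩
      coeff S i - l * coeff B i   ≈⟨ +-cong (S-above i m<i) (-‿cong (*-congˡ (above i m<i))) ⟩
      0# - l * 0#                 ≈⟨ +-congˡ (-‿cong (zeroʳ l)) ⟩
      0# - 0#                     ≈⟨ -‿inverseʳ 0# ⟩
      0#                          ∎

  divMod : ∀ A B → IsZero B ⊎ ∃₂ (IsEuclideanDivision A B)
  divMod A B with degree? B
  ... | inj₁ B≈0       = inj₁ B≈0
  ... | inj₂ (m , deg) with Q , R , eq , small ← divModByDegree A B m deg
    = inj₂ (Q , R , eq , m , deg , small)

  -- Division by the zero polynomial gets the dummy values A div 0 = 0 and
  -- A mod 0 = A.
  _div_ : Poly → Poly → Poly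
  A div B with divMod A B
  ... | inj₁ _       = []
  ... | inj₂ (Q , _) = Q

  _mod_ : Poly → Poly → Poly
  A mod B with divMod A B
  ... | inj₁ _           = A
  ... | inj₂ (_ , R , _) = R

  div-mod-correct : ∀ A B → ¬ IsZero B →
    IsEuclideanDivision A B (A div B) (A mod B)
  div-mod-correct A B B≉0 with divMod A B
  ... | inj₁ B≈0             = contradiction B≈0 B≉0
  ... | inj₂ (_ , _ , division) = division

  ----------------------------------------------------------------------
  -- Newton functions

  valℚ : Carrier → ℚ ⁺
  valℚ x = Maybe.map ℤ→ℚ (val x)

  Below : Poly → ℕ → (ℚ → ℚ ⁺) → Set
  Below Q m f = ∀ i → i ℕ.≤ m → f (ℕ→ℚ i) ≤ℚ valℚ (coeff Q i)

  -- f restricted to [0,m] is NF(Q), for Q of degree m.  Abscissae and finite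
  -- ordinates are rational: NF(Q) is piecewise affine with integer breakpoints
  -- and integer values there, so it is determined by its values on ℚ, which lie
  -- in ℚ ∪ {+∞}.
  IsNewtonFunction : Poly → ℕ → (ℚ → ℚ ⁺) → Set
  IsNewtonFunction Q m f = ConvexOn m f × Below Q m f ×
    (∀ g → ConvexOn m g → Below Q m g → ∀ x → x ∈[0, m ] → g x ≤ℚ f x)

  -- Q has degree < d and NF(Q) ≥ g on [0,d-1].
  NewtonFunctionAtLeast : Poly → ℕ → (ℚ → ℚ ⁺) → Set ℓ
  NewtonFunctionAtLeast Q d g = DegreeBelow Q d ×
    (∀ j → j ℕ.< d → g (ℕ→ℚ j) ≤ℚ valℚ (coeff Q j))

  ConvergesCoefficientwise : (ℕ → Poly) → Poly → Set
  ConvergesCoefficientwise U L =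
    ∀ j → ConvergesTo (λ i → coeff (U i) j) (coeff L j)

  ----------------------------------------------------------------------
  -- The iteration (B₀ is never used)

  module Iteration (P : Poly) (d : ℕ) where

    A : ℕ → Poly
    B : ℕ → Poly
    V : ℕ → Poly

    A zero    = applyUpTo (coeff P) (suc d)
    A (suc i) = A i +ₚ ((V i *ₚ P) mod A i)

    B i = P div A i

    V zero    = 1# ∷ []
    V (suc i) =
      ((1# + 1#) ·ₚ V i -ₚ V i *ₚ V i *ₚ B (suc i)) mod A (suc i)

{-# OPTIONS --safe #-}

-- Let λ₀ be the slope of NF(P) to the left of its vertex at d; if κ is infinite,
-- replace κ by any finite κ₀ and take for λ₀ a slope at least κ₀ below the one on
-- the right, with no constraint on a side where there is none.  The polynomials Q
-- with val q_j ≥ b + λ₀ j form a filtered ring ℝ.  Subtracting from NF(P) the line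
-- of slope λ₀ through the vertex, and extending the difference w ≥ 0 by zero to
-- the right of d, gives a module 𝕄 over ℝ, defined by val q_j ≥ w(j) + b + λ₀ j.
-- Division by a polynomial A of degree d in 𝕄, with the leading coefficient of
-- A₀, preserves these bounds.  Since P − A₀ gains κ, one has
--     P = B A + S,   1 = V B + E + F A
-- with S and E gaining κ at the start.  One step of the iteration, with
-- T = V S mod A = V S − W A and U = F S + W B, gives
--     P = (B + U) (A + T) + (S E − T U),
-- and V becomes an inverse of the new quotient with error the square of an
-- element gaining as much as E.  Hence the gain doubles at each step.
--
-- For NF(A∞) = NF(P) on [0,d]: by a finite Hahn–Banach argument, every point of the
-- graph of NF(P) over [0,d] lies on a chord joining points (j , val a_j) with j ≤ d.
-- There val a_j = NF(P)(j), so A∞, which agrees with P up to an error of valuation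
-- larger than NF(P)(j), has a j-th coefficient of the same valuation.
module Submission where

open import Algebra.Bundles using (CommutativeRing; RawRing)
import Algebra.Properties.AbelianGroup as AbelianGroupProperties
import Algebra.Properties.CommutativeSemigroup as CommutativeSemigroupProperties
import Algebra.Properties.Ring as RingProperties
import Algebra.Properties.Semiring.Mult.TCOptimised as Multiples
import Algebra.Solver.Ring as RingSolver
open import Algebra.Solver.Ring.AlmostCommutativeRing using (_-Raw-AlmostCommutative⟶_; Induced-equivalence)
  renaming (fromCommutativeRing to almostCommutative)
open import Data.Bool.Base using (if_then_else_)
open import Data.Integer.Base as ℤ using (ℤ; +_)
import Data.Integer.Properties as ℤ
open import Data.List.Base using ([]; _∷_; map; applyUpTo; drop)
open import Data.Maybe.Base as Maybe using (just; nothing)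
open import Data.Nat.Base as ℕ using (ℕ; zero; suc; z≤n; s≤s)
import Data.Nat.Properties as ℕ
open import Data.Product using (∃; ∃₂; _×_; _,_; proj₁; proj₂)
open import Data.Rational.Base as ℚ using (ℚ; 0ℚ; 1ℚ; ½)
import Data.Rational.Properties as ℚ
import Data.Rational.Unnormalised.Base as ℚᵘ
import Data.Rational.Unnormalised.Properties as ℚᵘ
open import Data.Sum.Base using (_⊎_; inj₁; inj₂)
open import Defs
open import Function.Bundles using (Equivalence)
import Level
import Relation.Binary.Construct.Add.Supremum.NonStrict as NonStrict
import Relation.Binary.Construct.Add.Supremum.Strict as Strict
open import Relation.Binary.Definitions using (tri<; tri≈; tri>; WeaklyDecidable)
open import Relation.Binary.PropositionalEquality as ≡ using (_≡_; refl; cong; cong₂; sym; trans; subst; subst₂)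
import Relation.Binary.Reasoning.Setoid as SetoidReasoning
open import Relation.Nullary using (Dec; yes; no; ¬_; contradiction)
open import Relation.Nullary.Construct.Add.Supremum using (_⁺; ⊤⁺; [_]; []-injective)
open import Relation.Nullary.Decidable using (dec⇒maybe; _×-dec_; dec-true; dec-false)
open import Tactic.RingSolver using (solve)
open import Tactic.RingSolver.Core.AlmostCommutativeRing using (AlmostCommutativeRing; fromCommutativeRing)

open NonStrict ℚ._≤_ using ([_]; _≤⊤⁺; [≤]-injective; ≤⁺-trans; ≤⁺-dec; ≤⁺-reflexive-≡)
open Strict ℚ._<_ using ([_]; [_]<⊤⁺; [<]-injective)

-- A bound by NF(P) itself is not stable under products, and already V₀ = 1 violates the weighted
-- bound of gain 0 when w(0) > 0. This is why NF(P) is cut in two: a line, which is additive in the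
-- degree and hence compatible with products, and a decreasing weight, which survives multiplication
-- by elements bounded by the line alone. The line alone would give convergence too, but with an
-- error estimate weaker than NF(P) + 2^i κ on the left of d. The correction is Newton's: to first
-- order, a divisor A + T of P requires B T ≡ S modulo A, and V is an inverse of B modulo A. This
-- inverse is never exact, so its defect E + F A is carried along, F having the size of 1/A. The
-- choice of U is forced by collecting the multiples of A in P - (B + U)(A + T). Each of the two
-- terms left over is a product of two small elements, whence the doubling.

private module ℤ⁺ = NonStrict ℤ._≤_

-- Rational numbers

module Rational where
  open import Data.Rational.Base using (_+_; _*_; _-_; -_; _≤_; _<_; 1/_)

  ℚ-ring : AlmostCommutativeRing _ _
  ℚ-ring = fromCommutativeRing ℚ.+-*-commutativeRing λ x → dec⇒maybe (0ℚ ℚ.≟ x)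

  p≤q⇒0≤q-p : ∀ {p q} → p ≤ q → 0ℚ ≤ q - p
  p≤q⇒0≤q-p {p} {q} p≤q = subst (_≤ q - p) (ℚ.+-inverseʳ p) (ℚ.+-monoˡ-≤ (- p) p≤q)

  p<q⇒0<q-p : ∀ {p q} → p < q → 0ℚ < q - p
  p<q⇒0<q-p {p} {q} p<q = subst (_< q - p) (ℚ.+-inverseʳ p) (ℚ.+-monoˡ-< (- p) p<q)

  -- The form in which inequalities are certified below: r is written as a sum of products of
  -- nonnegative terms, and only a ring identity is left to the solver.
  ≤-by : ∀ {p q} r → 0ℚ ≤ r → q ≡ p + r → p ≤ q
  ≤-by {p} r 0≤r refl = subst (_≤ p + r) (ℚ.+-identityʳ p) (ℚ.+-monoʳ-≤ p 0≤r)

  <-by : ∀ {p q} r → 0ℚ < r → q ≡ p + r → p < q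
  <-by {p} r 0<r refl = subst (_< p + r) (ℚ.+-identityʳ p) (ℚ.+-monoʳ-< p 0<r)

  0≤-+ : ∀ {p q} → 0ℚ ≤ p → 0ℚ ≤ q → 0ℚ ≤ p + q
  0≤-+ = ℚ.+-mono-≤

  0≤-* : ∀ {p q} → 0ℚ ≤ p → 0ℚ ≤ q → 0ℚ ≤ p * q
  0≤-* {p} {q} 0≤p 0≤q = ℚ.nonNegative⁻¹ (p * q)
    {{ℚ.nonNeg*nonNeg⇒nonNeg p {{ℚ.nonNegative 0≤p}} q {{ℚ.nonNegative 0≤q}}}}

  0<-* : ∀ {p q} → 0ℚ < p → 0ℚ < q → 0ℚ < p * q
  0<-* {p} {q} 0<p 0<q = ℚ.positive⁻¹ (p * q)
    {{ℚ.pos*pos⇒pos p {{ℚ.positive 0<p}} q {{ℚ.positive 0<q}}}}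

  *-cancel-≤ : ∀ {r p q} → 0ℚ < r → r * p ≤ r * q → p ≤ q
  *-cancel-≤ {r} 0<r = ℚ.*-cancelˡ-≤-pos r {{ℚ.positive 0<r}}

  reciprocal : ∀ {p} → 0ℚ < p → ∃ λ r → 0ℚ < r × p * r ≡ 1ℚ
  reciprocal {p} 0<p = 1/ p , ℚ.positive⁻¹ _ {{ℚ.1/pos⇒pos p}} , ℚ.*-inverseʳ p
    where instance
    p-pos : ℚ.Positive p
    p-pos = ℚ.positive 0<p
    p≢0 : ℚ.NonZero p
    p≢0 = ℚ.pos⇒nonZero p

  -- `k / 1` is normalised by a gcd that does not compute for a variable k, so the sum is compared
  -- among unnormalised fractions.
  ℤ→ℚ-+ : ∀ k l → ℤ→ℚ (k ℤ.+ l) ≡ ℤ→ℚ k + ℤ→ℚ l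
  ℤ→ℚ-+ k l = ℚ.toℚᵘ-injective (ℚᵘ.≃-trans (fraction (k ℤ.+ l)) (ℚᵘ.≃-sym
    (ℚᵘ.≃-trans (ℚ.toℚᵘ-homo-+ (ℤ→ℚ k) (ℤ→ℚ l))
    (ℚᵘ.≃-trans (ℚᵘ.+-cong (fraction k) (fraction l))
    (ℚᵘ.≃-reflexive (cong (λ m → ℚᵘ.mkℚᵘ m 0)
      (cong₂ ℤ._+_ (ℤ.*-identityʳ k) (ℤ.*-identityʳ l))))))))
    where
    fraction : ∀ m → ℚ.toℚᵘ (ℤ→ℚ m) ℚᵘ.≃ ℚᵘ.mkℚᵘ m 0
    fraction m = ℚ.toℚᵘ-fromℚᵘ (ℚᵘ.mkℚᵘ m 0)

  ℤ→ℚ-mono : ∀ {k l} → k ℤ.≤ l → ℤ→ℚ k ≤ ℤ→ℚ l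
  ℤ→ℚ-mono {k} {l} k≤l = ℚ.toℚᵘ-cancel-≤
    (ℚᵘ.≤-respˡ-≃ (ℚᵘ.≃-sym (ℚ.toℚᵘ-fromℚᵘ (ℚᵘ.mkℚᵘ k 0)))
    (ℚᵘ.≤-respʳ-≃ (ℚᵘ.≃-sym (ℚ.toℚᵘ-fromℚᵘ (ℚᵘ.mkℚᵘ l 0)))
    (ℚᵘ.*≤* (ℤ.*-monoʳ-≤-nonNeg (+ 1) k≤l))))

  ℤ→ℚ-cancel : ∀ {k l} → ℤ→ℚ k ≤ ℤ→ℚ l → k ℤ.≤ l
  ℤ→ℚ-cancel {k} {l} k≤l = ℤ.*-cancelʳ-≤-pos k l (+ 1) (ℚᵘ.drop-*≤*
    (ℚᵘ.≤-respˡ-≃ (ℚ.toℚᵘ-fromℚᵘ (ℚᵘ.mkℚᵘ k 0))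
    (ℚᵘ.≤-respʳ-≃ (ℚ.toℚᵘ-fromℚᵘ (ℚᵘ.mkℚᵘ l 0)) (ℚ.toℚᵘ-mono-≤ k≤l))))

  ℕ→ℚ-suc : ∀ i → ℕ→ℚ (suc i) ≡ ℕ→ℚ i + 1ℚ
  ℕ→ℚ-suc i = trans (cong (λ j → ℤ→ℚ (+ j)) (ℕ.+-comm 1 i)) (ℤ→ℚ-+ (+ i) (+ 1))

  ℕ→ℚ-+ : ∀ i j → ℕ→ℚ (i ℕ.+ j) ≡ ℕ→ℚ i + ℕ→ℚ j
  ℕ→ℚ-+ i j = ℤ→ℚ-+ (+ i) (+ j)

  ℕ→ℚ-mono : ∀ {i j} → i ℕ.≤ j → ℕ→ℚ i ≤ ℕ→ℚ j
  ℕ→ℚ-mono {i} {j} i≤j = ℤ→ℚ-mono {+ i} {+ j} (ℤ.+≤+ i≤j)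

  0≤ℕ→ℚ : ∀ i → 0ℚ ≤ ℕ→ℚ i
  0≤ℕ→ℚ i = ℕ→ℚ-mono {0} {i} z≤n

  i<suc-i : ∀ i → ℕ→ℚ i < ℕ→ℚ (suc i)
  i<suc-i i = <-by 1ℚ (ℚ.positive⁻¹ 1ℚ) (ℕ→ℚ-suc i)

  ℕ→ℚ-mono-< : ∀ {i j} → i ℕ.< j → ℕ→ℚ i < ℕ→ℚ j
  ℕ→ℚ-mono-< {i} i<j = ℚ.<-≤-trans (i<suc-i i) (ℕ→ℚ-mono {suc i} {_} i<j)

  ℕ→ℚ-cancel : ∀ {i j} → ℕ→ℚ i ≤ ℕ→ℚ j → i ℕ.≤ j
  ℕ→ℚ-cancel {i} {j} i≤j = ℤ.drop‿+≤+ (ℤ→ℚ-cancel {+ i} {+ j} i≤j)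

  ℕ→ℚ-cancel-< : ∀ {i j} → ℕ→ℚ i < ℕ→ℚ j → i ℕ.< j
  ℕ→ℚ-cancel-< {i} {j} i<j = ℕ.≰⇒> λ j≤i → ℚ.<-irrefl refl (ℚ.<-≤-trans i<j (ℕ→ℚ-mono {j} {i} j≤i))

  -- A nonnegative fraction is at most its numerator, its denominator being at least 1.
  ℕ→ℚ-above : ∀ p → ∃ λ i → p ≤ ℕ→ℚ i
  ℕ→ℚ-above p@(ℚ.mkℚ (+ n) d-1 _) = n , ℚ.toℚᵘ-cancel-≤
    (ℚᵘ.≤-respʳ-≃ (ℚᵘ.≃-sym (ℚ.toℚᵘ-fromℚᵘ (ℚᵘ.mkℚᵘ (+ n) 0)))
    (ℚᵘ.*≤* (ℤ.*-monoˡ-≤-nonNeg (+ n) (ℤ.+≤+ (s≤s z≤n)))))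
  ℕ→ℚ-above p@(ℚ.mkℚ ℤ.-[1+ n ] d-1 _) = 0 , ℚ.toℚᵘ-cancel-≤ (ℚᵘ.*≤* ℤ.-≤+)

  i≤2^i : ∀ i → i ℕ.≤ 2 ℕ.^ i
  i≤2^i zero    = z≤n
  i≤2^i (suc i) = ℕ.≤-trans (ℕ.+-mono-≤ (ℕ.m^n>0 2 i) (i≤2^i i))
    (ℕ.≤-reflexive (cong (2 ℕ.^ i ℕ.+_) (sym (ℕ.+-identityʳ _))))

  pow-suc : ∀ κ i → ℕ→ℚ (2 ℕ.^ suc i) * κ ≡ ℕ→ℚ (2 ℕ.^ i) * κ + ℕ→ℚ (2 ℕ.^ i) * κ
  pow-suc κ i = trans
    (cong (_* κ) (trans (ℕ→ℚ-+ (2 ℕ.^ i) (1 ℕ.* 2 ℕ.^ i))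
      (cong (λ m → ℕ→ℚ (2 ℕ.^ i) + ℕ→ℚ m) (ℕ.+-identityʳ (2 ℕ.^ i)))))
    (ℚ.*-distribʳ-+ κ (ℕ→ℚ (2 ℕ.^ i)) (ℕ→ℚ (2 ℕ.^ i)))

  pow-mono : ∀ {κ i j} → 0ℚ ≤ κ → i ℕ.≤ j → ℕ→ℚ (2 ℕ.^ i) * κ ≤ ℕ→ℚ (2 ℕ.^ j) * κ
  pow-mono {κ} {i} {j} 0≤κ i≤j =
    ℚ.*-monoʳ-≤-nonNeg κ {{ℚ.nonNegative 0≤κ}} (ℕ→ℚ-mono {2 ℕ.^ i} {2 ℕ.^ j} (ℕ.^-monoʳ-≤ 2 i≤j))

  -- Since i ≤ 2^i, an index i above p/κ will do.
  pow-above : ∀ {κ} p → 0ℚ < κ → ∃ λ i → p ≤ ℕ→ℚ (2 ℕ.^ i) * κ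
  pow-above {κ} p 0<κ with r , _ , κr≡1 ← reciprocal 0<κ with i , pr≤i ← ℕ→ℚ-above (p * r)
    = i , ℚ.≤-trans (ℚ.≤-reflexive eq)
      (ℚ.*-monoʳ-≤-nonNeg κ {{ℚ.nonNegative (ℚ.<⇒≤ 0<κ)}}
        (ℚ.≤-trans pr≤i (ℕ→ℚ-mono {i} {2 ℕ.^ i} (i≤2^i i))))
    where
    eq : p ≡ p * r * κ
    eq = trans (sym (trans (cong (p *_) κr≡1) (ℚ.*-identityʳ p))) (solve (p ∷ κ ∷ r ∷ []) ℚ-ring)

open Rational

-- Extended rationals

module ExtendedRational where

  ≤ℚ-refl : ∀ {x} → x ≤ℚ x
  ≤ℚ-refl = ≤⁺-reflexive-≡ ℚ.≤-reflexive refl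

  ≤ℚ-reflexive : ∀ {x y} → x ≡ y → x ≤ℚ y
  ≤ℚ-reflexive refl = ≤ℚ-refl

  ≤ℚ-trans : ∀ {x y z} → x ≤ℚ y → y ≤ℚ z → x ≤ℚ z
  ≤ℚ-trans = ≤⁺-trans ℚ.≤-trans

  _≤ℚ?_ : ∀ x y → Dec (x ≤ℚ y)
  _≤ℚ?_ = ≤⁺-dec ℚ._≤?_

  ≰ℚ⇒> : ∀ {x y} → ¬ x ≤ℚ y → y <ℚ x
  ≰ℚ⇒> {⊤⁺}    {⊤⁺}    x≰y = contradiction (⊤⁺ ≤⊤⁺) x≰y
  ≰ℚ⇒> {⊤⁺}    {[ q ]} x≰y = [ q ]<⊤⁺
  ≰ℚ⇒> {[ p ]} {⊤⁺}    x≰y = contradiction ([ p ] ≤⊤⁺) x≰y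
  ≰ℚ⇒> {[ p ]} {[ q ]} x≰y = [ ℚ.≰⇒> (λ p≤q → x≰y [ p≤q ]) ]

  <ℚ⇒≱ : ∀ {x y} → x <ℚ y → ¬ y ≤ℚ x
  <ℚ⇒≱ [ p<q ] [ q≤p ] = ℚ.<-irrefl refl (ℚ.<-≤-trans p<q q≤p)

  <-≤ℚ-trans : ∀ {p q x} → p ℚ.< q → [ q ] ≤ℚ x → [ p ] <ℚ x
  <-≤ℚ-trans p<q [ q≤r ] = [ ℚ.<-≤-trans p<q q≤r ]
  <-≤ℚ-trans p<q (_ ≤⊤⁺) = [ _ ]<⊤⁺

  +ℚ-mono : ∀ {x y u v} → x ≤ℚ y → u ≤ℚ v → (x +ℚ u) ≤ℚ (y +ℚ v)
  +ℚ-mono [ p≤q ]   [ r≤s ]   = [ ℚ.+-mono-≤ p≤q r≤s ]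
  +ℚ-mono {y = [ _ ]} _ (_ ≤⊤⁺) = _ ≤⊤⁺
  +ℚ-mono (_ ≤⊤⁺)   _         = _ ≤⊤⁺

  +ℚ-identityʳ : ∀ x → x +ℚ [ 0ℚ ] ≡ x
  +ℚ-identityʳ ⊤⁺    = refl
  +ℚ-identityʳ [ p ] = cong [_] (ℚ.+-identityʳ p)

  +ℚ-identityˡ : ∀ x → [ 0ℚ ] +ℚ x ≡ x
  +ℚ-identityˡ ⊤⁺    = refl
  +ℚ-identityˡ [ p ] = cong [_] (ℚ.+-identityˡ p)

  bounded⇒finite : ∀ {x q} → x ≤ℚ [ q ] → ∃ λ p → x ≡ [ p ] × p ℚ.≤ q
  bounded⇒finite [ p≤q ] = _ , refl , p≤q

open ExtendedRational

-- Convex functions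

module Convexity where
  open import Data.Rational.Base using (_+_; _*_; _-_; -_; _≤_; _<_)

  -- Convexity with weight t = (z - y)/(z - x) and denominators cleared, which keeps later
  -- inequalities polynomial. Finite values at x and z also force a finite value in between.
  convex₃ : ∀ m f → ConvexOn m f → ∀ {x y z p r} → x ∈[0, m ] → z ∈[0, m ] → x < y → y < z →
    f x ≡ [ p ] → f z ≡ [ r ] →
    ∃ λ q → f y ≡ [ q ] × (z - x) * q ≤ (z - y) * p + (y - x) * r
  convex₃ m f conv {x} {y} {z} {p} {r} x∈ z∈ x<y y<z fx fz = weigh (reciprocal 0<z-x)
    where
    0<z-x : 0ℚ < z - x
    0<z-x = p<q⇒0<q-p (ℚ.<-trans x<y y<z)

    weigh : (∃ λ i → 0ℚ < i × (z - x) * i ≡ 1ℚ) → _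
    weigh (i , 0<i , e) = conclude (bounded⇒finite (subst₂ _≤ℚ_ (cong f at-y)
        (cong₂ (λ u v → t ·ℚ u +ℚ (1ℚ - t) ·ℚ v) fx fz)
        (conv x z t x∈ z∈ (0<-* (p<q⇒0<q-p y<z) 0<i)
          (<-by ((y - x) * i) (0<-* (p<q⇒0<q-p x<y) 0<i) (trans (sym e) weights)))))
      where
      t : ℚ
      t = (z - y) * i
      weights : (z - x) * i ≡ (z - y) * i + (y - x) * i
      weights = solve (x ∷ y ∷ z ∷ i ∷ []) ℚ-ring
      at-y : mix t x z ≡ y
      at-y = trans lemma₁ (trans (cong (λ c → z - (z - y) * c) e) lemma₂)
        where
        lemma₁ : (z - y) * i * x + (1ℚ - (z - y) * i) * z ≡ z - (z - y) * ((z - x) * i)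
        lemma₁ = solve (x ∷ y ∷ z ∷ i ∷ []) ℚ-ring
        lemma₂ : z - (z - y) * 1ℚ ≡ y
        lemma₂ = solve (y ∷ z ∷ []) ℚ-ring

      conclude : (∃ λ q → f y ≡ [ q ] × q ≤ t * p + (1ℚ - t) * r) → _
      conclude (q , fy , q≤) = q , fy ,
        ≤-by _ (0≤-* (ℚ.<⇒≤ 0<z-x) (p≤q⇒0≤q-p q≤))
          (trans lemma₁ (trans (cong (λ c → (z - y) * p * c + (z - x) * r - (z - y) * r * c) (sym e)) lemma₂))
        where
        lemma₁ : (z - y) * p + (y - x) * r ≡ (z - y) * p * 1ℚ + (z - x) * r - (z - y) * r * 1ℚ
        lemma₁ = solve (x ∷ y ∷ z ∷ p ∷ r ∷ []) ℚ-ring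
        lemma₂ : (z - y) * p * ((z - x) * i) + (z - x) * r - (z - y) * r * ((z - x) * i) ≡
          (z - x) * q + (z - x) * ((z - y) * i * p + (1ℚ - (z - y) * i) * r - q)
        lemma₂ = solve (x ∷ y ∷ z ∷ p ∷ r ∷ q ∷ i ∷ []) ℚ-ring

  affine : ℚ → ℚ → ℚ → ℚ → ℚ
  affine x₀ τ σ x = τ + σ * (x - x₀)

  affine-convex : ∀ m x₀ τ σ → ConvexOn m (λ x → [ affine x₀ τ σ x ])
  affine-convex m x₀ τ σ x y t _ _ _ _ = ≤ℚ-reflexive (cong [_] eq)
    where
    eq : τ + σ * (t * x + (1ℚ - t) * y - x₀) ≡
      t * (τ + σ * (x - x₀)) + (1ℚ - t) * (τ + σ * (y - x₀))
    eq = solve (τ ∷ σ ∷ t ∷ x ∷ y ∷ x₀ ∷ []) ℚ-ring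

  affine-antitone : ∀ {x₀ τ σ σ′ x} → x < x₀ → σ ≤ σ′ → affine x₀ τ σ′ x ≤ affine x₀ τ σ x
  affine-antitone {x₀} {τ} {σ} {σ′} {x} x<x₀ σ≤σ′ =
    ≤-by _ (0≤-* (p≤q⇒0≤q-p σ≤σ′) (ℚ.<⇒≤ (p<q⇒0<q-p x<x₀))) eq
    where
    eq : τ + σ * (x - x₀) ≡ τ + σ′ * (x - x₀) + (σ′ - σ) * (x₀ - x)
    eq = solve (τ ∷ σ ∷ σ′ ∷ x ∷ x₀ ∷ []) ℚ-ring

  affine-antitone-< : ∀ {x₀ τ σ σ′ x} → x < x₀ → σ < σ′ → affine x₀ τ σ′ x < affine x₀ τ σ x
  affine-antitone-< {x₀} {τ} {σ} {σ′} {x} x<x₀ σ<σ′ =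
    <-by _ (0<-* (p<q⇒0<q-p σ<σ′) (p<q⇒0<q-p x<x₀)) eq
    where
    eq : τ + σ * (x - x₀) ≡ τ + σ′ * (x - x₀) + (σ′ - σ) * (x₀ - x)
    eq = solve (τ ∷ σ ∷ σ′ ∷ x ∷ x₀ ∷ []) ℚ-ring

  -- Separating a point from finitely many points of the plane

  module SupportingLine (a : ℕ → ℚ ⁺) (y : ℚ) where

    Infinite : (X : ℕ → ℚ) → ℚ → ℕ → Set
    Infinite X x₀ m = ∀ i → i ℕ.< m → X i < x₀ → a i ≡ ⊤⁺

    -- To the left of x₀, a line through (x₀ , y) gets lower as its slope grows. So σ is the largest
    -- slope of a line joining (x₀ , y) to a finite point on its left, and j attains it. The
    -- abscissae are a parameter so that reflected points fit as well.
    Steepest : (X : ℕ → ℚ) → ℚ → ℕ → Set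
    Steepest X x₀ m = ∃₂ λ j σ → j ℕ.< m × X j < x₀ × a j ≡ [ affine x₀ y σ (X j) ] ×
      (∀ i → i ℕ.< m → X i < x₀ → [ affine x₀ y σ (X i) ] ≤ℚ a i)

    private
      through : ∀ {x x₀ p} → x < x₀ → ∃ λ σ → p ≡ affine x₀ y σ x
      through {x} {x₀} {p} x<x₀ with i , _ , e ← reciprocal (p<q⇒0<q-p x<x₀) =
        (y - p) * i , trans lemma₁ (trans (cong (λ c → y - (y - p) * c) (sym e)) lemma₂)
        where
        lemma₁ : p ≡ y - (y - p) * 1ℚ
        lemma₁ = solve (p ∷ y ∷ []) ℚ-ring
        lemma₂ : y - (y - p) * ((x₀ - x) * i) ≡ y + (y - p) * i * (x - x₀)
        lemma₂ = solve (p ∷ y ∷ x₀ ∷ x ∷ i ∷ []) ℚ-ring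

      below-suc : ∀ {m} (Q : ℕ → Set) → (∀ i → i ℕ.< m → Q i) → Q m → ∀ i → i ℕ.< suc m → Q i
      below-suc Q below at i i<1+m with ℕ.m<1+n⇒m<n∨m≡n i<1+m
      ... | inj₁ i<m  = below i i<m
      ... | inj₂ refl = at

    steepest : ∀ X x₀ m → Infinite X x₀ m ⊎ Steepest X x₀ m
    steepest X x₀ zero    = inj₁ λ _ ()
    steepest X x₀ (suc m) = next (steepest X x₀ m) (X m ℚ.<? x₀) (a m) refl
      where
      AllInfinite Above : (ℚ → ℕ → Set)
      AllInfinite _ i = X i < x₀ → a i ≡ ⊤⁺
      Above       σ i = X i < x₀ → [ affine x₀ y σ (X i) ] ≤ℚ a i

      keep : ∀ σ → (∃ λ j → j ℕ.< m × X j < x₀ × a j ≡ [ affine x₀ y σ (X j) ]) →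
        (∀ i → i ℕ.< m → Above σ i) → Above σ m → Steepest X x₀ (suc m)
      keep σ (j , j<m , j< , aj) low lowₘ =
        j , σ , ℕ.m<n⇒m<1+n j<m , j< , aj , below-suc (Above σ) low lowₘ

      replace : ∀ σ p → X m < x₀ → a m ≡ [ p ] → p ≡ affine x₀ y σ (X m) →
        Infinite X x₀ m ⊎ Steepest X x₀ m → Steepest X x₀ (suc m)
      replace σ p m< am p≡ prev = choose prev
        where
        am≡ : a m ≡ [ affine x₀ y σ (X m) ]
        am≡ = trans am (cong (λ q → [ q ]) p≡)
        switch : (∀ i → i ℕ.< m → Above σ i) → Steepest X x₀ (suc m)
        switch low = m , σ , ℕ.n<1+n m , m< , am≡ ,
          below-suc (Above σ) low λ _ → ≤ℚ-reflexive (sym am≡)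
        choose : Infinite X x₀ m ⊎ Steepest X x₀ m → Steepest X x₀ (suc m)
        choose (inj₁ inf) = switch λ i i<m i< → subst (_ ≤ℚ_) (sym (inf i i<m i<)) (_ ≤⊤⁺)
        choose (inj₂ (j , ρ , j<m , j< , aj , low)) with σ ℚ.≤? ρ
        ... | yes σ≤ρ = keep ρ (j , j<m , j< , aj) low
                          λ _ → ≤ℚ-trans [ affine-antitone {τ = y} m< σ≤ρ ] (≤ℚ-reflexive (sym am≡))
        ... | no  σ≰ρ = switch λ i i<m i< →
                          ≤ℚ-trans [ affine-antitone {τ = y} i< (ℚ.<⇒≤ (ℚ.≰⇒> σ≰ρ)) ] (low i i<m i<)

      next : Infinite X x₀ m ⊎ Steepest X x₀ m → Dec (X m < x₀) → ∀ v → a m ≡ v →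
        Infinite X x₀ (suc m) ⊎ Steepest X x₀ (suc m)
      next (inj₁ inf) (no m≮) _ _ =
        inj₁ (below-suc (AllInfinite y) inf λ m< → contradiction m< m≮)
      next (inj₂ (j , σ , j<m , j< , aj , low)) (no m≮) _ _ =
        inj₂ (keep σ (j , j<m , j< , aj) low λ m< → contradiction m< m≮)
      next (inj₁ inf) (yes _) ⊤⁺ am = inj₁ (below-suc (AllInfinite y) inf λ _ → am)
      next (inj₂ (j , σ , j<m , j< , aj , low)) (yes _) ⊤⁺ am =
        inj₂ (keep σ (j , j<m , j< , aj) low λ _ → subst (_ ≤ℚ_) (sym am) (_ ≤⊤⁺))
      next prev (yes m<) [ p ] am =
        let σ , p≡ = through {X m} {x₀} {p} m< in inj₂ (replace σ p m< am p≡ prev)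

    -- The minimum of finitely many positive gaps is positive; the starting value 1 is arbitrary. It
    -- lets a line lying strictly below all points be raised above (x₀ , y).
    clearance : ∀ (b : ℕ → ℚ) m → (∀ i → i ℕ.< m → [ b i ] <ℚ a i) →
      ∃ λ ε → 0ℚ < ε × (∀ i → i ℕ.< m → [ ε + b i ] ≤ℚ a i)
    clearance b zero    _   = 1ℚ , ℚ.positive⁻¹ 1ℚ , λ _ ()
    clearance b (suc m) gap
      with ε , 0<ε , fits ← clearance b m (λ i i<m → gap i (ℕ.m<n⇒m<1+n i<m))
      with a m in am | gap m (ℕ.n<1+n m)
    ... | ⊤⁺    | _ = ε , 0<ε , below-suc _ fits (subst (_ ≤ℚ_) (sym am) (_ ≤⊤⁺))
    ... | [ p ] | [ bm<p ] = δ , 0<δ , below-suc _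
        (λ i i<m → ≤ℚ-trans [ ℚ.+-monoˡ-≤ (b i) (ℚ.p⊓q≤p ε (p - b m)) ] (fits i i<m))
        (subst ([ δ + b m ] ≤ℚ_) (sym am) [ subst (δ + b m ≤_) eq (ℚ.+-monoˡ-≤ (b m) (ℚ.p⊓q≤q ε (p - b m))) ])
      where
      δ : ℚ
      δ = ε ℚ.⊓ (p - b m)
      0<δ : 0ℚ < δ
      0<δ with ℚ.⊓-sel ε (p - b m)
      ... | inj₁ e = subst (0ℚ <_) (sym e) 0<ε
      ... | inj₂ e = subst (0ℚ <_) (sym e) (p<q⇒0<q-p bm<p)
      eq : p - b m + b m ≡ p
      eq = trans (ℚ.+-assoc p (- b m) (b m)) (trans (cong (p ℚ.+_) (ℚ.+-inverseˡ (b m))) (ℚ.+-identityʳ p))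

    -- With denominators cleared: (x₀ , y) lies above some point (j , a j), or
    -- above the chord joining (j , a j) to (k , a k).
    Touches : ℚ → ℕ → Set
    Touches x₀ m =
      (∃ λ j → j ℕ.< m × ℕ→ℚ j ≡ x₀ × a j ≤ℚ [ y ]) ⊎
      (∃₂ λ j k → ∃₂ λ p r → j ℕ.< m × k ℕ.< m × ℕ→ℚ j < x₀ × x₀ < ℕ→ℚ k ×
        a j ≡ [ p ] × a k ≡ [ r ] ×
        (ℕ→ℚ k - x₀) * p + (x₀ - ℕ→ℚ j) * r ≤ (ℕ→ℚ k - ℕ→ℚ j) * y)

    Separated : ℚ → ℕ → Set
    Separated x₀ m = ∃₂ λ τ σ → y < τ × (∀ i → i ℕ.< m → [ affine x₀ τ σ (ℕ→ℚ i) ] ≤ℚ a i)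

    -- Hahn–Banach for finitely many points of the plane.  Abscissae to the
    -- right of x₀ are reflected, so that both sides are handled by `steepest`.
    touches⊎separated : ∀ x₀ m → Touches x₀ m ⊎ Separated x₀ m
    touches⊎separated x₀ m with ℕ.anyUpTo? (λ j → (ℕ→ℚ j ℚ.≟ x₀) ×-dec (a j ≤ℚ? [ y ])) m
    ... | yes found = inj₁ (inj₁ found)
    ... | no  none  = split (steepest X x₀ m) (steepest X⁻ (- x₀) m)
      where
      X X⁻ : ℕ → ℚ
      X i  = ℕ→ℚ i
      X⁻ i = - ℕ→ℚ i

      reflect : ∀ σ x → affine (- x₀) y (- σ) (- x) ≡ affine x₀ y σ x
      reflect σ x = lemma
        where
        lemma : y + - σ * (- x - - x₀) ≡ y + σ * (x - x₀)
        lemma = solve (y ∷ σ ∷ x ∷ x₀ ∷ []) ℚ-ring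

      StrictLeft StrictRight : ℚ → Set
      StrictLeft  σ = ∀ i → i ℕ.< m → X i < x₀ → [ affine x₀ y σ (X i) ] <ℚ a i
      StrictRight σ = ∀ i → i ℕ.< m → X⁻ i < - x₀ → [ affine (- x₀) y σ (X⁻ i) ] <ℚ a i

      strict-∞ : ∀ Z z σ → Infinite Z z m → ∀ i → i ℕ.< m → Z i < z → [ affine z y σ (Z i) ] <ℚ a i
      strict-∞ Z z σ inf i i<m i< = subst (_ <ℚ_) (sym (inf i i<m i<)) [ _ ]<⊤⁺

      strict-< : ∀ Z z σ σ′ → (∀ i → i ℕ.< m → Z i < z → [ affine z y σ (Z i) ] ≤ℚ a i) → σ < σ′ →
        ∀ i → i ℕ.< m → Z i < z → [ affine z y σ′ (Z i) ] <ℚ a i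
      strict-< Z z σ σ′ low σ<σ′ i i<m i< =
        <-≤ℚ-trans (affine-antitone-< {τ = y} i< σ<σ′) (low i i<m i<)

      separate : ∀ σ → StrictLeft σ → StrictRight (- σ) → Separated x₀ m
      separate σ left right = raise (clearance (λ i → affine x₀ y σ (X i)) m strict)
        where
        strict : ∀ i → i ℕ.< m → [ affine x₀ y σ (X i) ] <ℚ a i
        strict i i<m with ℚ.<-cmp (X i) x₀
        ... | tri< i< _ _ = left i i<m i<
        ... | tri> _ _ i> = subst (λ p → [ p ] <ℚ a i) (reflect σ (X i)) (right i i<m (ℚ.neg-antimono-< i>))
        ... | tri≈ _ i≡ _ = subst (λ p → [ p ] <ℚ a i) (sym (trans (cong (affine x₀ y σ) i≡) lemma))
                              (≰ℚ⇒> λ ai≤y → none (i , i<m , i≡ , ai≤y))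
          where
          lemma : y + σ * (x₀ - x₀) ≡ y
          lemma = solve (y ∷ σ ∷ x₀ ∷ []) ℚ-ring
        raise : (∃ λ ε → 0ℚ < ε × (∀ i → i ℕ.< m → [ ε + affine x₀ y σ (X i) ] ≤ℚ a i)) → Separated x₀ m
        raise (ε , 0<ε , fits) = ε + y , σ , <-by ε 0<ε (ℚ.+-comm ε y) ,
          λ i i<m → subst (λ p → [ p ] ≤ℚ a i) (sym (ℚ.+-assoc ε y _)) (fits i i<m)

      p<p+1 : ∀ p → p < p + 1ℚ
      p<p+1 p = <-by 1ℚ (ℚ.positive⁻¹ 1ℚ) refl

      p≡--p : ∀ p → p ≡ - - p
      p≡--p p = solve (p ∷ []) ℚ-ring

      -- The points on the left ask for a slope above σ, those on the right for one below - ρ. If σ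
      -- < - ρ, any slope in between separates; otherwise the two extreme points span a chord that
      -- passes through or below (x₀ , y). A side without finite points sets no condition, and a
      -- slope at distance 1 from the other bound will do.
      split : Infinite X x₀ m ⊎ Steepest X x₀ m → Infinite X⁻ (- x₀) m ⊎ Steepest X⁻ (- x₀) m →
        Touches x₀ m ⊎ Separated x₀ m
      split (inj₁ inf) (inj₁ inf⁻) = inj₂ (separate 0ℚ (strict-∞ X x₀ 0ℚ inf) (strict-∞ X⁻ (- x₀) (- 0ℚ) inf⁻))
      split (inj₂ (_ , σ , _ , _ , _ , low)) (inj₁ inf⁻) =
        inj₂ (separate (σ + 1ℚ) (strict-< X x₀ σ (σ + 1ℚ) low (p<p+1 σ)) (strict-∞ X⁻ (- x₀) (- (σ + 1ℚ)) inf⁻))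
      split (inj₁ inf) (inj₂ (_ , ρ , _ , _ , _ , low⁻)) =
        inj₂ (separate (- (ρ + 1ℚ)) (strict-∞ X x₀ (- (ρ + 1ℚ)) inf)
          (strict-< X⁻ (- x₀) ρ (- - (ρ + 1ℚ)) low⁻ (subst (ρ <_) (p≡--p (ρ + 1ℚ)) (p<p+1 ρ))))
      split (inj₂ (j , σ , j<m , j< , aj , low)) (inj₂ (k , ρ , k<m , k< , ak , low⁻))
        = decide (σ ℚ.<? - ρ)
        where
        x₀<k : x₀ < X k
        x₀<k = subst₂ _<_ (sym (p≡--p x₀)) (sym (p≡--p (X k))) (ℚ.neg-antimono-< k<)
        eq : ∀ j k → (k - j) * y ≡
          (k - x₀) * (y + σ * (j - x₀)) + (x₀ - j) * (y + ρ * (- k - - x₀)) +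
          (k - x₀) * (x₀ - j) * (σ - - ρ)
        eq j k = solve (j ∷ k ∷ x₀ ∷ y ∷ σ ∷ ρ ∷ []) ℚ-ring
        decide : Dec (σ < - ρ) → Touches x₀ m ⊎ Separated x₀ m
        decide (yes σ<-ρ) = let μ , σ<μ , μ<-ρ = ℚ.<-dense σ<-ρ in
          inj₂ (separate μ (strict-< X x₀ σ μ low σ<μ)
            (strict-< X⁻ (- x₀) ρ (- μ) low⁻ (subst (_< - μ) (sym (p≡--p ρ)) (ℚ.neg-antimono-< μ<-ρ))))
        decide (no σ≮-ρ) = inj₁ (inj₂ (j , k , _ , _ , j<m , k<m , j< , x₀<k , aj , ak ,
          ≤-by _ (0≤-* (0≤-* (ℚ.<⇒≤ (p<q⇒0<q-p x₀<k)) (ℚ.<⇒≤ (p<q⇒0<q-p j<))) (p≤q⇒0≤q-p (ℚ.≮⇒≥ σ≮-ρ)))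
            (eq (X j) (X k))))

open Convexity

ℕ∈[0,] : ∀ {i m} → i ℕ.≤ m → ℕ→ℚ i ∈[0, m ]
ℕ∈[0,] {i} {m} i≤m = 0≤ℕ→ℚ i , ℕ→ℚ-mono {i} {m} i≤m

-- Lower convex hulls of finitely many points, and their restriction to an initial interval

module NewtonFunction {a : ℕ → ℚ ⁺} {n : ℕ} {f : ℚ → ℚ ⁺}
  (convex : ConvexOn n f)
  (below : ∀ i → i ℕ.≤ n → f (ℕ→ℚ i) ≤ℚ a i)
  (greatest : ∀ g → ConvexOn n g → (∀ i → i ℕ.≤ n → g (ℕ→ℚ i) ≤ℚ a i) →
    ∀ x → x ∈[0, n ] → g x ≤ℚ f x)
  where
  open import Data.Rational.Base using (_+_; _*_; _-_; -_; _≤_; _<_)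
  open SupportingLine a using (Touches; Separated; touches⊎separated)

  -- A separating line would be a convex minorant of the points exceeding f at x₀, against the
  -- maximality of f.
  touches : ∀ {x₀ y} → x₀ ∈[0, n ] → f x₀ ≡ [ y ] → Touches y x₀ (suc n)
  touches {x₀} {y} x₀∈ fx₀ = exclude (touches⊎separated y x₀ (suc n))
    where
    exclude : Touches y x₀ (suc n) ⊎ Separated y x₀ (suc n) → Touches y x₀ (suc n)
    exclude (inj₁ t)                    = t
    exclude (inj₂ (τ , σ , y<τ , under)) = contradiction
      (≤ℚ-trans (≤ℚ-reflexive (cong (λ q → [ q ]) (sym at-x₀)))
        (≤ℚ-trans (greatest (λ x → [ affine x₀ τ σ x ]) (affine-convex n x₀ τ σ)
            (λ i i≤n → under i (s≤s i≤n)) x₀ x₀∈)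
          (≤ℚ-reflexive fx₀)))
      (<ℚ⇒≱ [ y<τ ])
      where
      at-x₀ : τ + σ * (x₀ - x₀) ≡ τ
      at-x₀ = solve (τ ∷ σ ∷ x₀ ∷ []) ℚ-ring

  -- At x₀, convexity puts f below the chord through its own values at j and k, which is below the
  -- chord through a j and a k, which is at most f x₀. Equality holds throughout, and since both
  -- weights are positive it holds at each end.
  chord-ends : ∀ {j k x₀ y p r} → k ℕ.≤ n → ℕ→ℚ j < x₀ → x₀ < ℕ→ℚ k →
    f x₀ ≡ [ y ] → a j ≡ [ p ] → a k ≡ [ r ] →
    (ℕ→ℚ k - x₀) * p + (x₀ - ℕ→ℚ j) * r ≤ (ℕ→ℚ k - ℕ→ℚ j) * y →
    a j ≤ℚ f (ℕ→ℚ j) × a k ≤ℚ f (ℕ→ℚ k)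
  chord-ends {j} {k} {x₀} {y} {p} {r} k≤n j<x₀ x₀<k fx₀ aj ak chord =
    meet (finite j≤n aj) (finite k≤n ak)
    where
    j≤n : j ℕ.≤ n
    j≤n = ℕ.≤-trans (ℕ.<⇒≤ (ℕ→ℚ-cancel-< {j} {k} (ℚ.<-trans j<x₀ x₀<k))) k≤n
    finite : ∀ {i q} → i ℕ.≤ n → a i ≡ [ q ] → ∃ λ q′ → f (ℕ→ℚ i) ≡ [ q′ ] × q′ ≤ q
    finite {i} i≤n ai = bounded⇒finite (≤ℚ-trans (below i i≤n) (≤ℚ-reflexive ai))
    meet : (∃ λ p′ → f (ℕ→ℚ j) ≡ [ p′ ] × p′ ≤ p) → (∃ λ r′ → f (ℕ→ℚ k) ≡ [ r′ ] × r′ ≤ r) →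
      a j ≤ℚ f (ℕ→ℚ j) × a k ≤ℚ f (ℕ→ℚ k)
    meet (p′ , fj , p′≤p) (r′ , fk , r′≤r) =
      compare (convex₃ n f convex (ℕ∈[0,] j≤n) (ℕ∈[0,] k≤n) j<x₀ x₀<k fj fk)
      where
      open ℚ.≤-Reasoning
      X Y : ℚ
      X = ℕ→ℚ k - x₀
      Y = x₀ - ℕ→ℚ j
      0<X : 0ℚ < X
      0<X = p<q⇒0<q-p x₀<k
      0<Y : 0ℚ < Y
      0<Y = p<q⇒0<q-p j<x₀
      compare : (∃ λ y′ → f x₀ ≡ [ y′ ] × (ℕ→ℚ k - ℕ→ℚ j) * y′ ≤ X * p′ + Y * r′) →
        a j ≤ℚ f (ℕ→ℚ j) × a k ≤ℚ f (ℕ→ℚ k)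
      compare (y′ , fx₀′ , above) =
        subst₂ _≤ℚ_ (sym aj) (sym fj) [ *-cancel-≤ 0<X (cancel (X * p) (X * p′) (Y * r) (Y * r′)
          sum (ℚ.*-monoˡ-≤-nonNeg Y {{ℚ.nonNegative (ℚ.<⇒≤ 0<Y)}} r′≤r)) ] ,
        subst₂ _≤ℚ_ (sym ak) (sym fk) [ *-cancel-≤ 0<Y (cancel (Y * r) (Y * r′) (X * p) (X * p′)
          (subst₂ _≤_ (ℚ.+-comm (X * p) (Y * r)) (ℚ.+-comm (X * p′) (Y * r′)) sum)
          (ℚ.*-monoˡ-≤-nonNeg X {{ℚ.nonNegative (ℚ.<⇒≤ 0<X)}} p′≤p)) ]
        where
        y≡y′ : y ≡ y′
        y≡y′ = []-injective (trans (sym fx₀) fx₀′)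
        sum : X * p + Y * r ≤ X * p′ + Y * r′
        sum = ℚ.≤-trans chord (subst (λ z → (ℕ→ℚ k - ℕ→ℚ j) * z ≤ X * p′ + Y * r′) (sym y≡y′) above)
        cancel : ∀ s s′ t t′ → s + t ≤ s′ + t′ → t′ ≤ t → s ≤ s′
        cancel s s′ t t′ s+t≤ t′≤t =
          ≤-by _ (0≤-+ (p≤q⇒0≤q-p s+t≤) (p≤q⇒0≤q-p t′≤t)) eq
          where
          eq : s′ ≡ s + (s′ + t′ - (s + t) + (t - t′))
          eq = solve (s ∷ s′ ∷ t ∷ t′ ∷ []) ℚ-ring

  -- By convexity (d , f d) lies on or below the chord from j to k, so the chord from j to d lies
  -- below the longer one on [j , d]. This brings chords that cross d back into [0 , d].
  shorten-chord : ∀ {j d k x₀ y p v r} → k ℕ.≤ n → ℕ→ℚ j < x₀ → x₀ < ℕ→ℚ d → ℕ→ℚ d < ℕ→ℚ k →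
    f (ℕ→ℚ d) ≡ [ v ] → a j ≡ [ p ] → a k ≡ [ r ] →
    (ℕ→ℚ k - x₀) * p + (x₀ - ℕ→ℚ j) * r ≤ (ℕ→ℚ k - ℕ→ℚ j) * y →
    (ℕ→ℚ d - x₀) * p + (x₀ - ℕ→ℚ j) * v ≤ (ℕ→ℚ d - ℕ→ℚ j) * y
  shorten-chord {j} {d} {k} {x₀} {y} {p} {v} {r} k≤n j<x₀ x₀<d d<k fd aj ak chord =
    via (finite j≤n aj) (finite k≤n ak)
    where
    j<d : ℕ→ℚ j < ℕ→ℚ d
    j<d = ℚ.<-trans j<x₀ x₀<d
    j<k : ℕ→ℚ j < ℕ→ℚ k
    j<k = ℚ.<-trans j<d d<k
    j≤n : j ℕ.≤ n
    j≤n = ℕ.≤-trans (ℕ.<⇒≤ (ℕ→ℚ-cancel-< {j} {k} j<k)) k≤n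
    finite : ∀ {i q} → i ℕ.≤ n → a i ≡ [ q ] → ∃ λ q′ → f (ℕ→ℚ i) ≡ [ q′ ] × q′ ≤ q
    finite {i} i≤n ai = bounded⇒finite (≤ℚ-trans (below i i≤n) (≤ℚ-reflexive ai))
    combine : ∀ J D K p′ r′ → J < x₀ → x₀ < D → D < K → p′ ≤ p → r′ ≤ r →
      (K - J) * v ≤ (K - D) * p′ + (D - J) * r′ →
      (K - x₀) * p + (x₀ - J) * r ≤ (K - J) * y →
      (D - x₀) * p + (x₀ - J) * v ≤ (D - J) * y
    combine J D K p′ r′ J<x₀ x₀<D D<K p′≤p r′≤r above lower =
      *-cancel-≤ {K - J} (p<q⇒0<q-p (ℚ.<-trans J<x₀ (ℚ.<-trans x₀<D D<K)))
        (≤-by _ (0≤-+ (0≤-* 0≤x₀-J (p≤q⇒0≤q-p above))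
          (0≤-+ (0≤-* 0≤x₀-J (0≤-+ (0≤-* (ℚ.<⇒≤ (p<q⇒0<q-p D<K)) (p≤q⇒0≤q-p p′≤p))
                                   (0≤-* 0≤D-J (p≤q⇒0≤q-p r′≤r))))
                (0≤-* 0≤D-J (p≤q⇒0≤q-p lower)))) eq)
      where
      0≤x₀-J : 0ℚ ≤ x₀ - J
      0≤x₀-J = ℚ.<⇒≤ (p<q⇒0<q-p J<x₀)
      0≤D-J : 0ℚ ≤ D - J
      0≤D-J = ℚ.<⇒≤ (p<q⇒0<q-p (ℚ.<-trans J<x₀ x₀<D))
      eq : (K - J) * ((D - J) * y) ≡ (K - J) * ((D - x₀) * p + (x₀ - J) * v) +
        ((x₀ - J) * ((K - D) * p′ + (D - J) * r′ - (K - J) * v) +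
         ((x₀ - J) * ((K - D) * (p - p′) + (D - J) * (r - r′)) +
          (D - J) * ((K - J) * y - ((K - x₀) * p + (x₀ - J) * r))))
      eq = solve (K ∷ J ∷ D ∷ y ∷ x₀ ∷ p ∷ v ∷ p′ ∷ r′ ∷ r ∷ []) ℚ-ring
    via : (∃ λ p′ → f (ℕ→ℚ j) ≡ [ p′ ] × p′ ≤ p) → (∃ λ r′ → f (ℕ→ℚ k) ≡ [ r′ ] × r′ ≤ r) →
      (ℕ→ℚ d - x₀) * p + (x₀ - ℕ→ℚ j) * v ≤ (ℕ→ℚ d - ℕ→ℚ j) * y
    via (p′ , fj , p′≤p) (r′ , fk , r′≤r) =
      let v′ , fd′ , above = convex₃ n f convex (ℕ∈[0,] j≤n) (ℕ∈[0,] k≤n) j<d d<k fj fk in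
      combine (ℕ→ℚ j) (ℕ→ℚ d) (ℕ→ℚ k) p′ r′ j<x₀ x₀<d d<k p′≤p r′≤r
        (subst (λ u → (ℕ→ℚ k - ℕ→ℚ j) * u ≤ (ℕ→ℚ k - ℕ→ℚ d) * p′ + (ℕ→ℚ d - ℕ→ℚ j) * r′)
          ([]-injective (trans (sym fd′) fd)) above)
        chord

  ∈-restrict : ∀ {d x} → d ℕ.≤ n → x ∈[0, d ] → x ∈[0, n ]
  ∈-restrict {d} d≤n (0≤x , x≤d) = 0≤x , ℚ.≤-trans x≤d (ℕ→ℚ-mono {d} {n} d≤n)

  convex-restrict : ∀ {d} → d ℕ.≤ n → ConvexOn d f
  convex-restrict d≤n x y t x∈ y∈ = convex x y t (∈-restrict d≤n x∈) (∈-restrict d≤n y∈)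

  -- Every finite point of the graph over [0 , d] is, or lies on or above a chord between, points (j
  -- , a j) on the graph with j ≤ d, after shortening at d. At those j one has g ≤ a′ ≤ a, and
  -- convexity of g does the rest. Hence a′ has to be compared with a only at points of the graph.
  greatest-restrict : ∀ {d v} {a′ : ℕ → ℚ ⁺} → d ℕ.≤ n → f (ℕ→ℚ d) ≡ [ v ] → a d ≤ℚ f (ℕ→ℚ d) →
    (∀ j → j ℕ.≤ d → a j ≤ℚ f (ℕ→ℚ j) → a′ j ≤ℚ a j) →
    ∀ g → ConvexOn d g → (∀ j → j ℕ.≤ d → g (ℕ→ℚ j) ≤ℚ a′ j) → ∀ x → x ∈[0, d ] → g x ≤ℚ f x
  greatest-restrict {d} {v} {a′} d≤n fd ad keeps g g-convex g-below x x∈ = cases (f x) refl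
    where
    g≤a : ∀ {j} → j ℕ.≤ d → a j ≤ℚ f (ℕ→ℚ j) → g (ℕ→ℚ j) ≤ℚ a j
    g≤a {j} j≤d aj≤ = ≤ℚ-trans (g-below j j≤d) (keeps j j≤d aj≤)

    below-chord : ∀ {j k p r y} → k ℕ.≤ d → ℕ→ℚ j < x → x < ℕ→ℚ k →
      g (ℕ→ℚ j) ≤ℚ [ p ] → g (ℕ→ℚ k) ≤ℚ [ r ] →
      (ℕ→ℚ k - x) * p + (x - ℕ→ℚ j) * r ≤ (ℕ→ℚ k - ℕ→ℚ j) * y → g x ≤ℚ [ y ]
    below-chord {j} {k} {p} {r} {y} k≤d j<x x<k gj gk chord =
      let p′ , gj≡ , p′≤p = bounded⇒finite gj
          r′ , gk≡ , r′≤r = bounded⇒finite gk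
          q , gx≡ , q≤ = convex₃ d g g-convex (ℕ∈[0,] j≤d) (ℕ∈[0,] k≤d) j<x x<k gj≡ gk≡
      in subst (_≤ℚ [ y ]) (sym gx≡) [ *-cancel-≤ (p<q⇒0<q-p j<k)
           (ℚ.≤-trans q≤ (ℚ.≤-trans (ℚ.+-mono-≤
             (ℚ.*-monoˡ-≤-nonNeg (ℕ→ℚ k - x) {{ℚ.nonNegative (ℚ.<⇒≤ (p<q⇒0<q-p x<k))}} p′≤p)
             (ℚ.*-monoˡ-≤-nonNeg (x - ℕ→ℚ j) {{ℚ.nonNegative (ℚ.<⇒≤ (p<q⇒0<q-p j<x))}} r′≤r)) chord)) ]
      where
      j<k : ℕ→ℚ j < ℕ→ℚ k
      j<k = ℚ.<-trans j<x x<k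
      j≤d : j ℕ.≤ d
      j≤d = ℕ.≤-trans (ℕ.<⇒≤ (ℕ→ℚ-cancel-< {j} {k} j<k)) k≤d

    at-vertex : ∀ {j y} → ℕ→ℚ j ≡ x → f x ≡ [ y ] → a j ≤ℚ [ y ] → g x ≤ℚ [ y ]
    at-vertex {j} {y} refl fx aj = ≤ℚ-trans
      (g≤a (ℕ→ℚ-cancel {j} {d} (proj₂ x∈)) (≤ℚ-trans aj (≤ℚ-reflexive (sym fx)))) aj

    on-chord : ∀ {y} → f x ≡ [ y ] → SupportingLine.Touches a y x (suc n) → g x ≤ℚ [ y ]
    on-chord fx (inj₁ (j , _ , j≡x , aj)) = at-vertex {j} j≡x fx aj
    on-chord {y} fx (inj₂ (j , k , p , r , _ , k<1+n , j<x , x<k , aj , ak , chord)) =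
      choose (k ℕ.≤? d) (ℚ.<-cmp x (ℕ→ℚ d))
      where
      k≤n : k ℕ.≤ n
      k≤n = ℕ.s≤s⁻¹ k<1+n
      ends : a j ≤ℚ f (ℕ→ℚ j) × a k ≤ℚ f (ℕ→ℚ k)
      ends = chord-ends {j} {k} k≤n j<x x<k fx aj ak chord
      gj : g (ℕ→ℚ j) ≤ℚ [ p ]
      gj = ≤ℚ-trans (g≤a (ℕ→ℚ-cancel {j} {d} (ℚ.≤-trans (ℚ.<⇒≤ j<x) (proj₂ x∈))) (proj₁ ends))
             (≤ℚ-reflexive aj)
      choose : Dec (k ℕ.≤ d) → _ → g x ≤ℚ [ y ]
      choose (yes k≤d) _ = below-chord {j} {k} k≤d j<x x<k gj
        (≤ℚ-trans (g≤a k≤d (proj₂ ends)) (≤ℚ-reflexive ak)) chord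
      choose (no k≰d) (tri< x<d _ _) = below-chord {j} {d} ℕ.≤-refl j<x x<d gj
        (≤ℚ-trans (g≤a ℕ.≤-refl ad) (≤ℚ-trans ad (≤ℚ-reflexive fd)))
        (shorten-chord {j} {d} {k} k≤n j<x x<d (ℕ→ℚ-mono-< {d} {k} (ℕ.≰⇒> k≰d)) fd aj ak chord)
      choose (no _) (tri≈ _ x≡d _) =
        at-vertex {d} (sym x≡d) fx (≤ℚ-trans ad (≤ℚ-reflexive (trans (cong f (sym x≡d)) fx)))
      choose (no _) (tri> _ _ d<x) = contradiction (ℚ.<-≤-trans d<x (proj₂ x∈)) (ℚ.<-irrefl refl)

    cases : ∀ w → f x ≡ w → g x ≤ℚ f x
    cases ⊤⁺    fx = subst (g x ≤ℚ_) (sym fx) (_ ≤⊤⁺)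
    cases [ y ] fx = subst (g x ≤ℚ_) (sym fx) (on-chord fx (touches (∈-restrict d≤n x∈) fx))

-- Slopes of a convex function around an extremal point

module Slopes {n : ℕ} {f : ℚ → ℚ ⁺} (convex : ConvexOn n f) where
  open import Data.Rational.Base using (_+_; _*_; _-_; -_; _≤_; _<_)

  -- With u = f x ≤ v, the point (x , v) is the midpoint of (x , u) and (x , 2v - u), both in the
  -- epigraph; extremality gives u = v.
  value-at-extremal : ∀ {x v} → IsExtremalPoint (Epigraph n f) (x , v) → f x ≡ [ v ]
  value-at-extremal {x} {v} ((x∈ , fx≤v) , extremal) =
    let u , fx , u≤v = bounded⇒finite fx≤v
        ends = extremal x u x (v + v - u) ½
          (x∈ , ≤ℚ-reflexive fx)
          (x∈ , subst (_≤ℚ [ v + v - u ]) (sym fx) [ ≤-by _ (0≤-+ (p≤q⇒0≤q-p u≤v) (p≤q⇒0≤q-p u≤v)) (eq u) ])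
          (ℚ.positive⁻¹ ½) (<-by ½ (ℚ.positive⁻¹ ½) refl)
          (same x) (opposite u)
    in trans fx (cong (λ p → [ proj₂ p ]) (proj₁ ends))
    where
    eq : ∀ u → v + v - u ≡ u + (v - u + (v - u))
    eq u = solve (u ∷ v ∷ []) ℚ-ring
    same : ∀ x → ½ * x + (1ℚ - ½) * x ≡ x
    same x = solve (x ∷ []) ℚ-ring
    opposite : ∀ u → ½ * u + (1ℚ - ½) * (v + v - u) ≡ v
    opposite u = solve (u ∷ v ∷ []) ℚ-ring

  -- Convexity gives the weak inequality; equality would make the vertex the midpoint of its two
  -- neighbours on the graph.
  extremal⇒strict : ∀ {d v p q} → suc (suc d) ℕ.≤ n →
    IsExtremalPoint (Epigraph n f) (ℕ→ℚ (suc d) , v) →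
    f (ℕ→ℚ d) ≡ [ p ] → f (ℕ→ℚ (suc (suc d))) ≡ [ q ] → v + v < q + p
  extremal⇒strict {d} {v} {p} {q} 2+d≤n ext@(_ , extremal) fd f2+d =
    decide (ℚ.<-cmp (v + v) (q + p))
    where
    D : ℚ
    D = ℕ→ℚ d
    D₁≡ : ℕ→ℚ (suc d) ≡ D + 1ℚ
    D₁≡ = ℕ→ℚ-suc d
    D₂≡ : ℕ→ℚ (suc (suc d)) ≡ D + 1ℚ + 1ℚ
    D₂≡ = trans (ℕ→ℚ-suc (suc d)) (cong (_+ 1ℚ) D₁≡)
    d∈ : D ∈[0, n ]
    d∈ = ℕ∈[0,] {d} {n} (ℕ.≤-trans (ℕ.n≤1+n d) (ℕ.≤-trans (ℕ.n≤1+n (suc d)) 2+d≤n))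
    2+d∈ : ℕ→ℚ (suc (suc d)) ∈[0, n ]
    2+d∈ = ℕ∈[0,] {suc (suc d)} {n} 2+d≤n
    midpoint : ½ * D + (1ℚ - ½) * ℕ→ℚ (suc (suc d)) ≡ ℕ→ℚ (suc d)
    midpoint = trans (cong (λ z → ½ * D + (1ℚ - ½) * z) D₂≡) (trans (mid D) (sym D₁≡))
      where
      mid : ∀ D → ½ * D + (1ℚ - ½) * (D + 1ℚ + 1ℚ) ≡ D + 1ℚ
      mid D = solve (D ∷ []) ℚ-ring
    halves : ∀ p q → ½ * p + (1ℚ - ½) * q ≡ ½ * (q + p)
    halves p q = solve (p ∷ q ∷ []) ℚ-ring
    doubles : ∀ v → ½ * (v + v) ≡ v
    doubles v = solve (v ∷ []) ℚ-ring
    v≤ : v ≤ ½ * (q + p)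
    v≤ = bound (subst₂ _≤ℚ_ (trans (cong f midpoint) (value-at-extremal ext))
        (cong₂ (λ a b → ½ ·ℚ a +ℚ (1ℚ - ½) ·ℚ b) fd f2+d)
        (convex D (ℕ→ℚ (suc (suc d))) ½ d∈ 2+d∈ (ℚ.positive⁻¹ ½) (<-by ½ (ℚ.positive⁻¹ ½) refl)))
      where
      bound : [ v ] ≤ℚ [ ½ * p + (1ℚ - ½) * q ] → v ≤ ½ * (q + p)
      bound [ le ] = subst (v ≤_) (halves p q) le
    decide : _ → v + v < q + p
    decide (tri< lt _ _) = lt
    decide (tri≈ _ e _) = contradiction
      (cong proj₁ (proj₁ (extremal D p (ℕ→ℚ (suc (suc d))) q ½
        (d∈ , ≤ℚ-reflexive fd) (2+d∈ , ≤ℚ-reflexive f2+d)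
        (ℚ.positive⁻¹ ½) (<-by ½ (ℚ.positive⁻¹ ½) refl) midpoint
        (trans (halves p q) (trans (cong (½ *_) (sym e)) (doubles v))))))
      (ℚ.<⇒≢ (i<suc-i d))
    decide (tri> _ _ gt) = contradiction (ℚ.≤-<-trans v≤
        (subst (½ * (q + p) <_) (doubles v) (ℚ.*-monoʳ-<-pos ½ gt))) (ℚ.<-irrefl refl)

  -- The increment after i is at most the mean slope from i to e + 1, by convexity at i + 1, and
  -- this mean is at most the last increment, by convexity at e.
  slopes-left : ∀ {e v λ₀} → suc e ℕ.≤ n → f (ℕ→ℚ (suc e)) ≡ [ v ] →
    [ v ] ≤ℚ (f (ℕ→ℚ e) +ℚ [ λ₀ ]) →
    ∀ i → i ℕ.≤ e → f (ℕ→ℚ (suc i)) ≤ℚ (f (ℕ→ℚ i) +ℚ [ λ₀ ])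
  slopes-left {e} {v} {λ₀} 1+e≤n fd last i i≤e with ℕ.m≤n⇒m<n∨m≡n i≤e
  ... | inj₂ refl = subst (_≤ℚ (f (ℕ→ℚ e) +ℚ [ λ₀ ])) (sym fd) last
  ... | inj₁ i<e  = cases (f (ℕ→ℚ i)) refl
    where
    D : ℚ
    D = ℕ→ℚ (suc e)
    i∈ : ℕ→ℚ i ∈[0, n ]
    i∈ = ℕ∈[0,] {i} {n} (ℕ.≤-trans i≤e (ℕ.≤-trans (ℕ.n≤1+n e) 1+e≤n))
    d∈ : D ∈[0, n ]
    d∈ = ℕ∈[0,] {suc e} {n} 1+e≤n
    arith : ∀ I D E q p q₁ → D ≡ E + 1ℚ → 0ℚ < D - I →
      (D - I) * q₁ ≤ (D - (I + 1ℚ)) * q + (I + 1ℚ - I) * v →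
      (D - I) * p ≤ (D - E) * q + (E - I) * v →
      v ≤ p + λ₀ → q₁ ≤ q + λ₀
    arith I D E q p q₁ refl 0<D-I le₁ le₂ le₃ = *-cancel-≤ 0<D-I
      (≤-by _ (0≤-+ (p≤q⇒0≤q-p le₁) (0≤-+ (p≤q⇒0≤q-p le₂) (0≤-* (ℚ.<⇒≤ 0<D-I) (p≤q⇒0≤q-p le₃)))) eq)
      where
      eq : (E + 1ℚ - I) * (q + λ₀) ≡ (E + 1ℚ - I) * q₁ +
        ((E + 1ℚ - (I + 1ℚ)) * q + (I + 1ℚ - I) * v - (E + 1ℚ - I) * q₁ +
         ((E + 1ℚ - E) * q + (E - I) * v - (E + 1ℚ - I) * p +
          (E + 1ℚ - I) * (p + λ₀ - v)))
      eq = solve (E ∷ I ∷ q ∷ λ₀ ∷ q₁ ∷ v ∷ p ∷ []) ℚ-ring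
    cases : ∀ w → f (ℕ→ℚ i) ≡ w → f (ℕ→ℚ (suc i)) ≤ℚ (f (ℕ→ℚ i) +ℚ [ λ₀ ])
    cases ⊤⁺    fi = subst (λ w → f (ℕ→ℚ (suc i)) ≤ℚ (w +ℚ [ λ₀ ])) (sym fi) (_ ≤⊤⁺)
    cases [ q ] fi =
      let i<d = ℕ→ℚ-mono-< {i} {suc e} (ℕ.<-trans i<e (ℕ.n<1+n e))
          q₁ , f1+i , le₁ = convex₃ n f convex i∈ d∈ (i<suc-i i) (ℕ→ℚ-mono-< {suc i} {suc e} (s≤s i<e)) fi fd
          p , fe , le₂ = convex₃ n f convex i∈ d∈ (ℕ→ℚ-mono-< {i} {e} i<e) (i<suc-i e) fi fd
      in subst₂ (λ w w′ → w ≤ℚ (w′ +ℚ [ λ₀ ])) (sym f1+i) (sym fi)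
        [ arith (ℕ→ℚ i) D (ℕ→ℚ e) q p q₁ (ℕ→ℚ-suc e) (p<q⇒0<q-p i<d)
            (subst (λ I → (D - ℕ→ℚ i) * q₁ ≤ (D - I) * q + (I - ℕ→ℚ i) * v) (ℕ→ℚ-suc i) le₁)
            le₂ ([≤]-injective (subst (λ w → [ v ] ≤ℚ (w +ℚ [ λ₀ ])) fe last)) ]

  -- By convexity at d + 1, the mean slope from d onwards is at least the first slope. For j = 0 the
  -- two abscissae coincide, so this case is separate.
  slopes-right : ∀ {d v μ} → f (ℕ→ℚ d) ≡ [ v ] → [ v + μ ] ≤ℚ f (ℕ→ℚ (suc d)) →
    ∀ j → suc (d ℕ.+ j) ℕ.≤ n → [ v + (ℕ→ℚ j + 1ℚ) * μ ] ≤ℚ f (ℕ→ℚ (suc (d ℕ.+ j)))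
  slopes-right {d} {v} {μ} fd first zero _ =
    subst₂ (λ w i → [ w ] ≤ℚ f (ℕ→ℚ (suc i))) (first-slope v μ) (sym (ℕ.+-identityʳ d)) first
    where
    first-slope : ∀ v μ → v + μ ≡ v + (0ℚ + 1ℚ) * μ
    first-slope v μ = solve (v ∷ μ ∷ []) ℚ-ring
  slopes-right {d} {v} {μ} fd first (suc j) k≤n = cases (f (ℕ→ℚ k)) refl
    where
    k : ℕ
    k = suc (d ℕ.+ suc j)
    J : ℚ
    J = ℕ→ℚ (suc j)
    k≡ : ℕ→ℚ k ≡ ℕ→ℚ d + J + 1ℚ
    k≡ = trans (ℕ→ℚ-suc (d ℕ.+ suc j)) (cong (_+ 1ℚ) (ℕ→ℚ-+ d (suc j)))
    d<k : d ℕ.< k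
    d<k = s≤s (ℕ.m≤m+n d (suc j))
    arith : ∀ D J r q₁ → v + μ ≤ q₁ → 0ℚ ≤ J →
      (D + J + 1ℚ - D) * q₁ ≤ (D + J + 1ℚ - (D + 1ℚ)) * v + (D + 1ℚ - D) * r →
      v + (J + 1ℚ) * μ ≤ r
    arith D J r q₁ le₁ 0≤J le₂ = ≤-by _
      (0≤-+ (p≤q⇒0≤q-p le₂) (0≤-* (0≤-+ 0≤J (ℚ.nonNegative⁻¹ 1ℚ)) (p≤q⇒0≤q-p le₁))) eq
      where
      eq : r ≡ v + (J + 1ℚ) * μ +
        ((D + J + 1ℚ - (D + 1ℚ)) * v + (D + 1ℚ - D) * r - (D + J + 1ℚ - D) * q₁ +
         (J + 1ℚ) * (q₁ - (v + μ)))
      eq = solve (r ∷ v ∷ J ∷ μ ∷ D ∷ q₁ ∷ []) ℚ-ring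
    cases : ∀ w → f (ℕ→ℚ k) ≡ w → [ v + (J + 1ℚ) * μ ] ≤ℚ f (ℕ→ℚ k)
    cases ⊤⁺    fk = subst ([ v + (J + 1ℚ) * μ ] ≤ℚ_) (sym fk) (_ ≤⊤⁺)
    cases [ r ] fk =
      let q₁ , f1+d , le = convex₃ n f convex
            (ℕ∈[0,] {d} {n} (ℕ.≤-trans (ℕ.<⇒≤ d<k) k≤n)) (ℕ∈[0,] {k} {n} k≤n)
            (i<suc-i d) (ℕ→ℚ-mono-< {suc d} {k} (s≤s (ℕ.m<m+n d (s≤s z≤n)))) fd fk
      in subst ([ v + (J + 1ℚ) * μ ] ≤ℚ_) (sym fk)
        [ arith (ℕ→ℚ d) J r q₁ ([≤]-injective (subst ([ v + μ ] ≤ℚ_) f1+d first)) (0≤ℕ→ℚ (suc j))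
            (subst₂ (λ K D₁ → (K - ℕ→ℚ d) * q₁ ≤ (K - D₁) * v + (D₁ - ℕ→ℚ d) * r) k≡ (ℕ→ℚ-suc d) le) ]

-- Commutative rings

module RingIdentities {c ℓ} (R : CommutativeRing c ℓ) where
  open CommutativeRing R hiding (zero)
  open RingProperties ring using (-0#≈0#; -‿distribˡ-*; -‿distribʳ-*; -‿involutive)
  open AbelianGroupProperties +-abelianGroup using (⁻¹-∙-comm; x∙y⁻¹≈ε⇒x≈y; x≈y⇒x∙y⁻¹≈ε)
  open CommutativeSemigroupProperties +-commutativeSemigroup using (interchange)
  open Multiples semiring using (×1-homo-*; ×-homo-+) renaming (_×_ to _⊗_)
  open SetoidReasoning setoid

  private
    ι : ℕ → Carrier
    ι m = m ⊗ 1#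

    -- The pair (m , n) is the integer m − n; the case n = 0 makes 1 evaluate to 1#.
    ⟦_⟧ : ℕ × ℕ → Carrier
    ⟦ m , zero ⟧  = ι m
    ⟦ m , suc n ⟧ = ι m - ι (suc n)

    ⟦⟧≈ : ∀ m n → ⟦ m , n ⟧ ≈ ι m - ι n
    ⟦⟧≈ m zero    = CommutativeRing.sym R (CommutativeRing.trans R (+-congˡ -0#≈0#) (+-identityʳ (ι m)))
    ⟦⟧≈ m (suc n) = CommutativeRing.refl R

    ≈-trans = CommutativeRing.trans R
    ≈-sym = CommutativeRing.sym R
    ≈-refl = CommutativeRing.refl R

    sub-+ : ∀ a b c d → (a + c) - (b + d) ≈ (a - b) + (c - d)
    sub-+ a b c d = begin
      (a + c) - (b + d)       ≈⟨ +-congˡ (⁻¹-∙-comm b d) ⟨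
      (a + c) + (- b + - d)   ≈⟨ interchange a c (- b) (- d) ⟩
      (a - b) + (c - d)       ∎

    sub-* : ∀ a b c d → (a * c + b * d) - (a * d + b * c) ≈ (a - b) * (c - d)
    sub-* a b c d = begin
      (a * c + b * d) - (a * d + b * c)        ≈⟨ sub-+ (a * c) (a * d) (b * d) (b * c) ⟩
      (a * c - a * d) + (b * d - b * c)        ≈⟨ +-cong (+-congˡ (-‿distribʳ-* a d)) lemma ⟩
      (a * c + a * - d) + - b * (c - d)        ≈⟨ +-congʳ (distribˡ a c (- d)) ⟨
      a * (c - d) + - b * (c - d)              ≈⟨ distribʳ (c - d) a (- b) ⟨
      (a - b) * (c - d)                        ∎
      where
      lemma : b * d - b * c ≈ - b * (c - d)
      lemma = begin
        b * d - b * c             ≈⟨ +-comm _ _ ⟩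
        - (b * c) + b * d         ≈⟨ +-cong (-‿distribˡ-* b c) (≈-sym (-‿involutive _)) ⟩
        - b * c + - (- (b * d))   ≈⟨ +-congˡ (-‿cong (-‿distribˡ-* b d)) ⟩
        - b * c + - (- b * d)     ≈⟨ +-congˡ (-‿distribʳ-* (- b) d) ⟩
        - b * c + - b * - d       ≈⟨ distribˡ (- b) c (- d) ⟨
        - b * (c - d)             ∎

    -- Normalisation needs coefficients that can be compared, which elements of an arbitrary ring
    -- cannot be. Formal differences of naturals serve as integers; `_≟_` identifies the pairs that
    -- represent the same one.
    coefficients : RawRing _ _
    coefficients = record
      { Carrier = ℕ × ℕ
      ; _≈_     = _≡_
      ; _+_     = λ { (m , n) (m′ , n′) → m ℕ.+ m′ , n ℕ.+ n′ }
      ; _*_     = λ { (m , n) (m′ , n′) → m ℕ.* m′ ℕ.+ n ℕ.* n′ , m ℕ.* n′ ℕ.+ n ℕ.* m′ }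
      ; -_      = λ { (m , n) → n , m }
      ; 0#      = 0 , 0
      ; 1#      = 1 , 0
      }

    evaluation : coefficients -Raw-AlmostCommutative⟶ almostCommutative R
    evaluation = record
      { ⟦_⟧    = ⟦_⟧
      ; +-homo = λ { (m , n) (m′ , n′) → begin
          ⟦ m ℕ.+ m′ , n ℕ.+ n′ ⟧         ≈⟨ ⟦⟧≈ (m ℕ.+ m′) (n ℕ.+ n′) ⟩
          ι (m ℕ.+ m′) - ι (n ℕ.+ n′)     ≈⟨ +-cong (×-homo-+ 1# m m′) (-‿cong (×-homo-+ 1# n n′)) ⟩
          (ι m + ι m′) - (ι n + ι n′)     ≈⟨ sub-+ (ι m) (ι n) (ι m′) (ι n′) ⟩
          (ι m - ι n) + (ι m′ - ι n′)     ≈⟨ +-cong (⟦⟧≈ m n) (⟦⟧≈ m′ n′) ⟨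
          ⟦ m , n ⟧ + ⟦ m′ , n′ ⟧         ∎ }
      ; *-homo = λ { (m , n) (m′ , n′) → begin
          ⟦ m ℕ.* m′ ℕ.+ n ℕ.* n′ , m ℕ.* n′ ℕ.+ n ℕ.* m′ ⟧
            ≈⟨ ⟦⟧≈ (m ℕ.* m′ ℕ.+ n ℕ.* n′) (m ℕ.* n′ ℕ.+ n ℕ.* m′) ⟩
          ι (m ℕ.* m′ ℕ.+ n ℕ.* n′) - ι (m ℕ.* n′ ℕ.+ n ℕ.* m′)
            ≈⟨ +-cong (ι-sum m m′ n n′) (-‿cong (ι-sum m n′ n m′)) ⟩
          (ι m * ι m′ + ι n * ι n′) - (ι m * ι n′ + ι n * ι m′)
            ≈⟨ sub-* (ι m) (ι n) (ι m′) (ι n′) ⟩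
          (ι m - ι n) * (ι m′ - ι n′)
            ≈⟨ *-cong (⟦⟧≈ m n) (⟦⟧≈ m′ n′) ⟨
          ⟦ m , n ⟧ * ⟦ m′ , n′ ⟧ ∎ }
      ; -‿homo = λ { (m , n) → begin
          ⟦ n , m ⟧           ≈⟨ ⟦⟧≈ n m ⟩
          ι n - ι m           ≈⟨ +-comm _ _ ⟩
          - ι m + ι n         ≈⟨ +-congˡ (-‿involutive (ι n)) ⟨
          - ι m + - - ι n     ≈⟨ ⁻¹-∙-comm (ι m) (- ι n) ⟩
          - (ι m - ι n)       ≈⟨ -‿cong (⟦⟧≈ m n) ⟨
          - ⟦ m , n ⟧         ∎ }
      ; 0-homo = ≈-refl
      ; 1-homo = ≈-refl
      }
      where
      ι-sum : ∀ m m′ n n′ → ι (m ℕ.* m′ ℕ.+ n ℕ.* n′) ≈ ι m * ι m′ + ι n * ι n′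
      ι-sum m m′ n n′ = ≈-trans (×-homo-+ 1# (m ℕ.* m′) (n ℕ.* n′)) (+-cong (×1-homo-* m m′) (×1-homo-* n n′))

    _≟_ : WeaklyDecidable (Induced-equivalence evaluation)
    (m , n) ≟ (m′ , n′) with m ℕ.+ n′ ℕ.≟ m′ ℕ.+ n
    ... | no  _  = nothing
    ... | yes eq = just (x∙y⁻¹≈ε⇒x≈y _ _ (begin
      ⟦ m , n ⟧ - ⟦ m′ , n′ ⟧         ≈⟨ +-cong (⟦⟧≈ m n) (-‿cong (⟦⟧≈ m′ n′)) ⟩
      (ι m - ι n) - (ι m′ - ι n′)     ≈⟨ +-congˡ (⁻¹-∙-comm (ι m′) (- ι n′)) ⟨
      (ι m - ι n) + (- ι m′ + - - ι n′) ≈⟨ +-congˡ (+-congˡ (-‿involutive (ι n′))) ⟩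
      (ι m - ι n) + (- ι m′ + ι n′)   ≈⟨ +-congˡ (+-comm _ _) ⟩
      (ι m - ι n) + (ι n′ - ι m′)     ≈⟨ sub-+ (ι m) (ι n) (ι n′) (ι m′) ⟨
      (ι m + ι n′) - (ι n + ι m′)     ≈⟨ +-cong (×-homo-+ 1# m n′) (-‿cong (×-homo-+ 1# n m′)) ⟨
      ι (m ℕ.+ n′) - ι (n ℕ.+ m′)     ≡⟨ cong (λ k → ι k - ι (n ℕ.+ m′)) (≡.trans eq (ℕ.+-comm m′ n)) ⟩
      ι (n ℕ.+ m′) - ι (n ℕ.+ m′)     ≈⟨ -‿inverseʳ _ ⟩
      0#                              ∎))

  open RingSolver coefficients (almostCommutative R) evaluation _≟_ using (con; _:=_; _:+_; _:*_; _:-_; :-_)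
    renaming (solve to prove)

  -- Consequences of equations are proved by certificates: a multiplier k for each hypothesis l ≈ r
  -- turns the claim into an unconditional identity for the solver.
  modulo₁ : ∀ {x y k l r} → l ≈ r → x ≈ y + k * (l - r) → x ≈ y
  modulo₁ {x} {y} {k} {l} {r} l≈r x≈ = begin
    x                 ≈⟨ x≈ ⟩
    y + k * (l - r)   ≈⟨ +-congˡ (*-congˡ (x≈y⇒x∙y⁻¹≈ε l≈r)) ⟩
    y + k * 0#        ≈⟨ +-congˡ (zeroʳ k) ⟩
    y + 0#            ≈⟨ +-identityʳ y ⟩
    y                 ∎

  modulo₂ : ∀ {x y k l r k′ l′ r′} → l ≈ r → l′ ≈ r′ → x ≈ (y + k * (l - r)) + k′ * (l′ - r′) → x ≈ y
  modulo₂ l≈r l′≈r′ x≈ = modulo₁ l≈r (modulo₁ l′≈r′ x≈)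

  modulo₃ : ∀ {x y k l r k′ l′ r′ k″ l″ r″} → l ≈ r → l′ ≈ r′ → l″ ≈ r″ →
    x ≈ ((y + k * (l - r)) + k′ * (l′ - r′)) + k″ * (l″ - r″) → x ≈ y
  modulo₃ l≈r l′≈r′ l″≈r″ x≈ = modulo₂ l≈r l′≈r′ (modulo₁ l″≈r″ x≈)

  -- V P and V S differ by the multiple V B A of A, so T is a remainder of both. It is V S that
  -- carries the gain.
  correction-division : ∀ {P A B S V Q T} → P ≈ B * A + S → V * P ≈ Q * A + T →
    V * S ≈ (Q - V * B) * A + T
  correction-division {P} {A} {B} {S} {V} {Q} {T} P≈ VP≈ = modulo₂ VP≈ P≈
    (prove 7 (λ P A B S V Q T → V :* S :=
       (Q :- V :* B) :* A :+ T :+ con (1 , 0) :* (V :* P :- (Q :* A :+ T))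
         :+ (:- V) :* (P :- (B :* A :+ S)))
      ≈-refl P A B S V Q T)

  -- From B T = B V S - W B A and 1 - V B = E + F A one gets S - B T = S E + U A with U = F S + W B.
  -- Adding U to the quotient absorbs the multiple of A.
  corrected-factorization : ∀ {P A B S V W T E F} → P ≈ B * A + S → 1# ≈ V * B + E + F * A →
    V * S ≈ W * A + T →
    P ≈ (B + (F * S + W * B)) * (A + T) + (S * E - T * (F * S + W * B))
  corrected-factorization {P} {A} {B} {S} {V} {W} {T} {E} {F} P≈ 1≈ VS≈ = modulo₃ P≈ 1≈ VS≈
    (prove 9 (λ P A B S V W T E F → P :=
       (B :+ (F :* S :+ W :* B)) :* (A :+ T) :+ (S :* E :- T :* (F :* S :+ W :* B))
         :+ con (1 , 0) :* (P :- (B :* A :+ S))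
         :+ S :* (con (1 , 0) :- (V :* B :+ E :+ F :* A))
         :+ B :* (V :* S :- (W :* A :+ T)))
      ≈-refl P A B S V W T E F)

  -- Passes bounds to true remainders. S is of controlled size but perhaps of large degree, S′ is
  -- reduced; the identity is a division of S, so both B′ - B and S′ inherit the bounds of S.
  division-difference : ∀ {P A B S B′ S′} → P ≈ B * A + S → P ≈ B′ * A + S′ →
    S ≈ (B′ - B) * A + S′
  division-difference {P} {A} {B} {S} {B′} {S′} P≈ P≈′ = modulo₂ P≈ P≈′
    (prove 6 (λ P A B S B′ S′ → S :=
       (B′ :- B) :* A :+ S′ :+ (:- con (1 , 0)) :* (P :- (B :* A :+ S))
         :+ con (1 , 0) :* (P :- (B′ :* A :+ S′)))
      ≈-refl P A B S B′ S′)

  -- With D = B′ - (B + U), passing to B′ and A + T changes V B + F A by V U + V D + F T, which is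
  -- moved into the error while V and F stay.
  inverse-transfer : ∀ {A B V E F T U B′} → 1# ≈ V * B + E + F * A →
    1# ≈ V * B′ + (E - V * U - V * (B′ - (B + U)) - F * T) + F * (A + T)
  inverse-transfer {A} {B} {V} {E} {F} {T} {U} {B′} 1≈ = modulo₁ 1≈
    (prove 8 (λ A B V E F T U B′ → con (1 , 0) :=
       V :* B′ :+ (E :- V :* U :- V :* (B′ :- (B :+ U)) :- F :* T) :+ F :* (A :+ T)
         :+ con (1 , 0) :* (con (1 , 0) :- (V :* B :+ E :+ F :* A)))
      ≈-refl A B V E F T U B′)

  -- 1 - (2V - V²B) B = (1 - V B)² = (E + F A)², and reducing 2V - V²B modulo A costs G B A. The
  -- first multiplier comes from factoring the difference of the squares of 1 - V B and E + F A.
  inverse-square : ∀ {A B V E F G V′} → 1# ≈ V * B + E + F * A →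
    (V + V) - V * V * B ≈ G * A + V′ →
    1# ≈ V′ * B + E * E + (E * F + E * F + F * F * A + G * B) * A
  inverse-square {A} {B} {V} {E} {F} {G} {V′} 1≈ X≈ = modulo₂ 1≈ X≈
    (prove 7 (λ A B V E F G V′ → con (1 , 0) :=
       V′ :* B :+ E :* E :+ (E :* F :+ E :* F :+ F :* F :* A :+ G :* B) :* A
         :+ (con (1 , 0) :- V :* B :+ E :+ F :* A) :* (con (1 , 0) :- (V :* B :+ E :+ F :* A))
         :+ B :* (((V :+ V) :- V :* V :* B) :- (G :* A :+ V′)))
      ≈-refl A B V E F G V′)

  initial-factorization : ∀ P A → P ≈ 1# * A + (P - A)
  initial-factorization P A = prove 2 (λ P A → P := con (1 , 0) :* A :+ (P :- A)) ≈-refl P A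

  initial-inverse : ∀ A B → 1# ≈ 1# * B + - (B - 1#) + 0# * A
  initial-inverse A B = prove 2 (λ A B → con (1 , 0) :=
    con (1 , 0) :* B :+ (:- (B :- con (1 , 0))) :+ con (0 , 0) :* A) ≈-refl A B

  difference-add : ∀ x y → x ≈ (x - y) + y
  difference-add x y = prove 2 (λ x y → x := (x :- y) :+ y) ≈-refl x y

  difference-remainder : ∀ {x y z} → x ≈ y + z → z ≈ x - y
  difference-remainder {x} {y} {z} x≈ = modulo₁ x≈ (prove 3 (λ x y z →
    z := (x :- y) :+ (:- con (1 , 0)) :* (x :- (y :+ z))) ≈-refl x y z)

  perturbed-division : ∀ {P A B S} A′ → P ≈ B * A + S → P ≈ B * A′ + (S - B * (A′ - A))
  perturbed-division {P} {A} {B} {S} A′ P≈ = modulo₁ P≈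
    (prove 5 (λ P A B S A′ → P := B :* A′ :+ (S :- B :* (A′ :- A))
      :+ con (1 , 0) :* (P :- (B :* A :+ S))) ≈-refl P A B S A′)

  chain : ∀ x y z → x - z ≈ (y - z) + (x - y)
  chain x y z = prove 3 (λ x y z → x :- z := (y :- z) :+ (x :- y)) ≈-refl x y z

  through : ∀ x y z → (x - z) - (y - z) ≈ x - y
  through x y z = prove 3 (λ x y z → (x :- z) :- (y :- z) := x :- y) ≈-refl x y z

  advance : ∀ x y t → (x - y) + t ≈ (x + t) - y
  advance x y t = prove 3 (λ x y t → (x :- y) :+ t := (x :+ t) :- y) ≈-refl x y t

-- The ring of polynomials

module PolynomialRing {c ℓ} (K : CompleteDiscreteValuationField c ℓ) where
  open CompleteDiscreteValuationField K hiding (_≉_)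
  open Polynomials K
  open CommutativeSemigroupProperties +-commutativeSemigroup using (interchange)
  private module ≈ = SetoidReasoning setoid

  infix 4 _≋_

  -- A record, because `_≈ₚ_` unfolds to a function type from which p and q cannot be recovered by
  -- unification.
  record _≋_ (p q : Poly) : Set ℓ where
    constructor coeffwise
    field at : p ≈ₚ q

  open _≋_ public

  ≋-refl : ∀ {p} → p ≋ p
  ≋-refl = coeffwise λ _ → CompleteDiscreteValuationField.refl K

  ≋-sym : ∀ {p q} → p ≋ q → q ≋ p
  ≋-sym p≋q = coeffwise λ i → CompleteDiscreteValuationField.sym K (at p≋q i)

  ≋-trans : ∀ {p q r} → p ≋ q → q ≋ r → p ≋ r
  ≋-trans p≋q q≋r = coeffwise λ i → CompleteDiscreteValuationField.trans K (at p≋q i) (at q≋r i)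

  private
    ≈-refl = λ {x} → CompleteDiscreteValuationField.refl K {x}
    ≈-sym = λ {x y} → CompleteDiscreteValuationField.sym K {x} {y}
    ≈-trans = λ {x y z} → CompleteDiscreteValuationField.trans K {x} {y} {z}

  ∷-cong : ∀ {a b p q} → a ≈ b → p ≋ q → (a ∷ p) ≋ (b ∷ q)
  ∷-cong a≈b p≋q = coeffwise λ { zero → a≈b ; (suc i) → at p≋q i }

  +ₚ-cong : ∀ {p p′ q q′} → p ≋ p′ → q ≋ q′ → p +ₚ q ≋ p′ +ₚ q′
  +ₚ-cong {p} {p′} {q} {q′} p≋ q≋ = coeffwise λ i →
    ≈-trans (coeff-+ p q i) (≈-trans (+-cong (at p≋ i) (at q≋ i)) (≈-sym (coeff-+ p′ q′ i)))

  neg-cong : ∀ {p q} → p ≋ q → map -_ p ≋ map -_ q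
  neg-cong {p} {q} p≋q = coeffwise λ i →
    ≈-trans (coeff-neg p i) (≈-trans (-‿cong (at p≋q i)) (≈-sym (coeff-neg q i)))

  ·-cong : ∀ {a b p q} → a ≈ b → p ≋ q → a ·ₚ p ≋ b ·ₚ q
  ·-cong {a} {b} {p} {q} a≈b p≋q = coeffwise λ i →
    ≈-trans (coeff-· a p i) (≈-trans (*-cong a≈b (at p≋q i)) (≈-sym (coeff-· b q i)))

  +ₚ-assoc : ∀ p q r → p +ₚ q +ₚ r ≋ p +ₚ (q +ₚ r)
  +ₚ-assoc p q r = coeffwise λ i → ≈.begin
    coeff (p +ₚ q +ₚ r) i               ≈.≈⟨ coeff-+ (p +ₚ q) r i ⟩
    coeff (p +ₚ q) i + coeff r i        ≈.≈⟨ +-congʳ (coeff-+ p q i) ⟩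
    coeff p i + coeff q i + coeff r i   ≈.≈⟨ +-assoc _ _ _ ⟩
    coeff p i + (coeff q i + coeff r i) ≈.≈⟨ +-congˡ (coeff-+ q r i) ⟨
    coeff p i + coeff (q +ₚ r) i        ≈.≈⟨ coeff-+ p (q +ₚ r) i ⟨
    coeff (p +ₚ (q +ₚ r)) i             ≈.∎

  +ₚ-comm : ∀ p q → p +ₚ q ≋ q +ₚ p
  +ₚ-comm p q = coeffwise λ i →
    ≈-trans (coeff-+ p q i) (≈-trans (+-comm _ _) (≈-sym (coeff-+ q p i)))

  +ₚ-identityʳ : ∀ p → p +ₚ [] ≋ p
  +ₚ-identityʳ p = coeffwise λ i → ≈-trans (coeff-+ p [] i) (+-identityʳ _)

  +ₚ-inverseʳ : ∀ p → p -ₚ p ≋ []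
  +ₚ-inverseʳ p = coeffwise λ i →
    ≈-trans (coeff-+ p _ i) (≈-trans (+-congˡ (coeff-neg p i)) (-‿inverseʳ _))

  +ₚ-interchange : ∀ p q r s → (p +ₚ q) +ₚ (r +ₚ s) ≋ (p +ₚ r) +ₚ (q +ₚ s)
  +ₚ-interchange p q r s = coeffwise λ i → ≈.begin
    coeff ((p +ₚ q) +ₚ (r +ₚ s)) i  ≈.≈⟨ coeff-+ (p +ₚ q) (r +ₚ s) i ⟩
    coeff (p +ₚ q) i + coeff (r +ₚ s) i ≈.≈⟨ +-cong (coeff-+ p q i) (coeff-+ r s i) ⟩
    (coeff p i + coeff q i) + (coeff r i + coeff s i) ≈.≈⟨ interchange _ _ _ _ ⟩
    (coeff p i + coeff r i) + (coeff q i + coeff s i) ≈.≈⟨ +-cong (coeff-+ p r i) (coeff-+ q s i) ⟨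
    coeff (p +ₚ r) i + coeff (q +ₚ s) i ≈.≈⟨ coeff-+ (p +ₚ r) (q +ₚ s) i ⟨
    coeff ((p +ₚ r) +ₚ (q +ₚ s)) i  ≈.∎

  ·-distribˡ : ∀ a p q → a ·ₚ (p +ₚ q) ≋ a ·ₚ p +ₚ a ·ₚ q
  ·-distribˡ a p q = coeffwise λ i → ≈.begin
    coeff (a ·ₚ (p +ₚ q)) i              ≈.≈⟨ coeff-· a (p +ₚ q) i ⟩
    a * coeff (p +ₚ q) i                 ≈.≈⟨ *-congˡ (coeff-+ p q i) ⟩
    a * (coeff p i + coeff q i)          ≈.≈⟨ distribˡ a _ _ ⟩
    a * coeff p i + a * coeff q i        ≈.≈⟨ +-cong (coeff-· a p i) (coeff-· a q i) ⟨
    coeff (a ·ₚ p) i + coeff (a ·ₚ q) i  ≈.≈⟨ coeff-+ (a ·ₚ p) (a ·ₚ q) i ⟨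
    coeff (a ·ₚ p +ₚ a ·ₚ q) i           ≈.∎

  ·-distribʳ : ∀ a b p → (a + b) ·ₚ p ≋ a ·ₚ p +ₚ b ·ₚ p
  ·-distribʳ a b p = coeffwise λ i → ≈.begin
    coeff ((a + b) ·ₚ p) i               ≈.≈⟨ coeff-· (a + b) p i ⟩
    (a + b) * coeff p i                  ≈.≈⟨ distribʳ _ a b ⟩
    a * coeff p i + b * coeff p i        ≈.≈⟨ +-cong (coeff-· a p i) (coeff-· b p i) ⟨
    coeff (a ·ₚ p) i + coeff (b ·ₚ p) i  ≈.≈⟨ coeff-+ (a ·ₚ p) (b ·ₚ p) i ⟨
    coeff (a ·ₚ p +ₚ b ·ₚ p) i           ≈.∎

  ·-assoc : ∀ a b p → (a * b) ·ₚ p ≋ a ·ₚ (b ·ₚ p)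
  ·-assoc a b p = coeffwise λ i → ≈.begin
    coeff ((a * b) ·ₚ p) i   ≈.≈⟨ coeff-· (a * b) p i ⟩
    a * b * coeff p i        ≈.≈⟨ *-assoc a b _ ⟩
    a * (b * coeff p i)      ≈.≈⟨ *-congˡ (coeff-· b p i) ⟨
    a * coeff (b ·ₚ p) i     ≈.≈⟨ coeff-· a (b ·ₚ p) i ⟨
    coeff (a ·ₚ (b ·ₚ p)) i  ≈.∎

  ·-identity : ∀ p → 1# ·ₚ p ≋ p
  ·-identity p = coeffwise λ i → ≈-trans (coeff-· 1# p i) (*-identityˡ _)

  ·-zero : ∀ p → 0# ·ₚ p ≋ []
  ·-zero p = coeffwise λ i → ≈-trans (coeff-· 0# p i) (zeroˡ _)

  0∷[] : (0# ∷ []) ≋ []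
  0∷[] = coeffwise λ { zero → ≈-refl ; (suc i) → ≈-refl }

  *ₚ-zeroʳ : ∀ p → p *ₚ [] ≋ []
  *ₚ-zeroʳ []      = ≋-refl
  *ₚ-zeroʳ (a ∷ p) = ≋-trans (∷-cong ≈-refl (*ₚ-zeroʳ p)) 0∷[]

  *ₚ-congˡ : ∀ p {q q′} → q ≋ q′ → p *ₚ q ≋ p *ₚ q′
  *ₚ-congˡ []      q≋ = ≋-refl
  *ₚ-congˡ (a ∷ p) q≋ = +ₚ-cong (·-cong ≈-refl q≋) (∷-cong ≈-refl (*ₚ-congˡ p q≋))

  -- The recursion of `_*ₚ_` transferred to the right factor, which is what commutativity needs.
  *ₚ-∷ : ∀ q a p → q *ₚ (a ∷ p) ≋ a ·ₚ q +ₚ (0# ∷ q *ₚ p)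
  *ₚ-∷ []      a p = ≋-sym 0∷[]
  *ₚ-∷ (b ∷ q) a p = ∷-cong (+-congʳ (*-comm b a))
    (≋-trans (+ₚ-cong (≋-refl {b ·ₚ p}) (*ₚ-∷ q a p))
    (≋-trans (≋-sym (+ₚ-assoc (b ·ₚ p) (a ·ₚ q) _))
    (≋-trans (+ₚ-cong (+ₚ-comm (b ·ₚ p) (a ·ₚ q)) ≋-refl)
             (+ₚ-assoc (a ·ₚ q) (b ·ₚ p) _))))

  *ₚ-comm : ∀ p q → p *ₚ q ≋ q *ₚ p
  *ₚ-comm []      q = ≋-sym (*ₚ-zeroʳ q)
  *ₚ-comm (a ∷ p) q = ≋-trans
    (+ₚ-cong (≋-refl {a ·ₚ q}) (∷-cong ≈-refl (*ₚ-comm p q))) (≋-sym (*ₚ-∷ q a p))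

  *ₚ-cong : ∀ {p p′ q q′} → p ≋ p′ → q ≋ q′ → p *ₚ q ≋ p′ *ₚ q′
  *ₚ-cong {p} {p′} {q} {q′} p≋ q≋ = ≋-trans (*ₚ-congˡ p q≋)
    (≋-trans (*ₚ-comm p q′) (≋-trans (*ₚ-congˡ q′ p≋) (*ₚ-comm q′ p′)))

  *ₚ-distribʳ : ∀ r p q → (p +ₚ q) *ₚ r ≋ p *ₚ r +ₚ q *ₚ r
  *ₚ-distribʳ r []      q       = ≋-refl
  *ₚ-distribʳ r (a ∷ p) []      = ≋-sym (+ₚ-identityʳ _)
  *ₚ-distribʳ r (a ∷ p) (b ∷ q) = ≋-trans
    (+ₚ-cong (·-distribʳ a b r) (∷-cong (≈-sym (+-identityʳ 0#)) (*ₚ-distribʳ r p q)))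
    (+ₚ-interchange (a ·ₚ r) (b ·ₚ r) (0# ∷ p *ₚ r) (0# ∷ q *ₚ r))

  ·-*ₚ : ∀ a q r → (a ·ₚ q) *ₚ r ≋ a ·ₚ (q *ₚ r)
  ·-*ₚ a []      r = ≋-refl
  ·-*ₚ a (b ∷ q) r = ≋-trans
    (+ₚ-cong (·-assoc a b r) (∷-cong (≈-sym (zeroʳ a)) (·-*ₚ a q r)))
    (≋-sym (·-distribˡ a (b ·ₚ r) (0# ∷ q *ₚ r)))

  0∷-*ₚ : ∀ q r → (0# ∷ q) *ₚ r ≋ (0# ∷ q *ₚ r)
  0∷-*ₚ q r = +ₚ-cong (·-zero r) ≋-refl

  *ₚ-assoc : ∀ p q r → p *ₚ q *ₚ r ≋ p *ₚ (q *ₚ r)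
  *ₚ-assoc []      q r = ≋-refl
  *ₚ-assoc (a ∷ p) q r = ≋-trans (*ₚ-distribʳ r (a ·ₚ q) (0# ∷ p *ₚ q))
    (+ₚ-cong (·-*ₚ a q r) (≋-trans (0∷-*ₚ (p *ₚ q) r) (∷-cong ≈-refl (*ₚ-assoc p q r))))

  *ₚ-identityˡ : ∀ p → (1# ∷ []) *ₚ p ≋ p
  *ₚ-identityˡ p = ≋-trans (+ₚ-cong (·-identity p) 0∷[]) (+ₚ-identityʳ p)

  *ₚ-distribˡ : ∀ p q r → p *ₚ (q +ₚ r) ≋ p *ₚ q +ₚ p *ₚ r
  *ₚ-distribˡ p q r = ≋-trans (*ₚ-comm p (q +ₚ r)) (≋-trans (*ₚ-distribʳ p q r)
    (+ₚ-cong (*ₚ-comm q p) (*ₚ-comm r p)))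

  polynomialRing : CommutativeRing c ℓ
  polynomialRing = record
    { Carrier = Poly
    ; _≈_     = _≋_
    ; _+_     = _+ₚ_
    ; _*_     = _*ₚ_
    ; -_      = λ p → map -_ p
    ; 0#      = []
    ; 1#      = 1# ∷ []
    ; isCommutativeRing = record
      { isRing = record
        { +-isAbelianGroup = record
          { isGroup = record
            { isMonoid = record
              { isSemigroup = record
                { isMagma = record
                  { isEquivalence = record { refl = ≋-refl ; sym = ≋-sym ; trans = ≋-trans }
                  ; ∙-cong        = +ₚ-cong
                  }
                ; assoc = +ₚ-assoc
                }
              ; identity = (λ _ → ≋-refl) , +ₚ-identityʳ
              }
            ; inverse = (λ p → ≋-trans (+ₚ-comm (map -_ p) p) (+ₚ-inverseʳ p)) , +ₚ-inverseʳ
            ; ⁻¹-cong = neg-cong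
            }
          ; comm = +ₚ-comm
          }
        ; *-cong     = *ₚ-cong
        ; *-assoc    = *ₚ-assoc
        ; *-identity = *ₚ-identityˡ , λ p → ≋-trans (*ₚ-comm p _) (*ₚ-identityˡ p)
        ; distrib    = *ₚ-distribˡ , *ₚ-distribʳ
        }
      ; *-comm = *ₚ-comm
      }
    }

-- Valuations and coefficientwise bounds

module Valuation {c ℓ} (K : CompleteDiscreteValuationField c ℓ) where
  open CompleteDiscreteValuationField K hiding (refl; sym; trans)
  open Polynomials K
  open RingProperties ring using (-1*x≈-x; -‿involutive)
  private
    module ≈ = CommutativeRing commutativeRing

  valℚ-cong : ∀ {x y} → x ≈ y → valℚ x ≡ valℚ y
  valℚ-cong x≈y = cong (Maybe.map ℤ→ℚ) (val-cong x≈y)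

  valℚ-∞ : ∀ {x} → valℚ x ≡ ⊤⁺ → x ≈ 0#
  valℚ-∞ {x} eq = Equivalence.to (val-∞ x) (unmap (val x) eq)
    where
    unmap : ∀ v → Maybe.map ℤ→ℚ v ≡ ⊤⁺ → v ≡ ⊤⁺
    unmap ⊤⁺ _ = refl

  valℚ-0 : ∀ {x} → x ≈ 0# → valℚ x ≡ ⊤⁺
  valℚ-0 {x} x≈0 = cong (Maybe.map ℤ→ℚ) (Equivalence.from (val-∞ x) x≈0)

  ≤valℚ-0 : ∀ {b x} → x ≈ 0# → b ≤ℚ valℚ x
  ≤valℚ-0 {b} x≈0 = subst (b ≤ℚ_) (sym (valℚ-0 x≈0)) (b ≤⊤⁺)

  valℚ-* : ∀ x y → valℚ (x * y) ≡ valℚ x +ℚ valℚ y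
  valℚ-* x y = trans (cong (Maybe.map ℤ→ℚ) (val-* x y)) (map-+ (val x) (val y))
    where
    map-+ : ∀ k l → Maybe.map ℤ→ℚ (k +ℤ l) ≡ Maybe.map ℤ→ℚ k +ℚ Maybe.map ℤ→ℚ l
    map-+ ⊤⁺    _     = refl
    map-+ [ k ] ⊤⁺    = refl
    map-+ [ k ] [ l ] = cong (λ q → [ q ]) (ℤ→ℚ-+ k l)

  map-mono : ∀ {k l} → k ≤ℤ l → Maybe.map ℤ→ℚ k ≤ℚ Maybe.map ℤ→ℚ l
  map-mono ℤ⁺.[ k≤l ]  = [ ℤ→ℚ-mono k≤l ]
  map-mono (k ℤ⁺.≤⊤⁺) = _ ≤⊤⁺

  map-cancel : ∀ k l → Maybe.map ℤ→ℚ k ≤ℚ Maybe.map ℤ→ℚ l → k ≤ℤ l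
  map-cancel k     ⊤⁺    _ = k ℤ⁺.≤⊤⁺
  map-cancel [ k ] [ l ] k≤l = ℤ⁺.[ ℤ→ℚ-cancel {k} {l} ([≤]-injective k≤l) ]

  -- The ultrametric inequality as an alternative, according to which argument attains the minimum;
  -- this avoids a minimum on ℚ ∪ {+∞}.
  valℚ-+ : ∀ x y → valℚ x ≤ℚ valℚ (x + y) ⊎ valℚ y ≤ℚ valℚ (x + y)
  valℚ-+ x y = attained (val x) (val y) (val-+ x y)
    where
    attained : ∀ k l → (k ⊓ℤ l) ≤ℤ val (x + y) →
      Maybe.map ℤ→ℚ k ≤ℚ valℚ (x + y) ⊎ Maybe.map ℤ→ℚ l ≤ℚ valℚ (x + y)
    attained ⊤⁺    l     le = inj₂ (map-mono le)
    attained [ k ] ⊤⁺    le = inj₁ (map-mono le)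
    attained [ k ] [ l ] le with ℤ.⊓-sel k l
    ... | inj₁ eq = inj₁ (map-mono (subst (λ m → [ m ] ≤ℤ val (x + y)) eq le))
    ... | inj₂ eq = inj₂ (map-mono (subst (λ m → [ m ] ≤ℤ val (x + y)) eq le))

  ≤valℚ-+ : ∀ {b x y} → b ≤ℚ valℚ x → b ≤ℚ valℚ y → b ≤ℚ valℚ (x + y)
  ≤valℚ-+ {b} {x} {y} b≤x b≤y with valℚ-+ x y
  ... | inj₁ x≤ = ≤ℚ-trans b≤x x≤
  ... | inj₂ y≤ = ≤ℚ-trans b≤y y≤

  valℚ-1 : valℚ 1# ≡ [ 0ℚ ]
  valℚ-1 = finite (valℚ 1#) refl (trans (sym (valℚ-* 1# 1#)) (valℚ-cong (*-identityˡ 1#)))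
    where
    finite : ∀ v → valℚ 1# ≡ v → valℚ 1# +ℚ valℚ 1# ≡ valℚ 1# → valℚ 1# ≡ [ 0ℚ ]
    finite ⊤⁺    eq _   = contradiction (valℚ-∞ eq) 1≉0
    finite [ p ] eq sum = trans eq (cong (λ q → [ q ]) (zero-of p
      ([]-injective (subst (λ v → v +ℚ v ≡ v) eq sum))))
      where
      cancelled : ∀ p → p ≡ (p ℚ.+ p) ℚ.- p
      cancelled p = solve (p ∷ []) ℚ-ring
      zero-of : ∀ p → p ℚ.+ p ≡ p → p ≡ 0ℚ
      zero-of p e = trans (cancelled p) (trans (cong (ℚ._- p) e) (ℚ.+-inverseʳ p))

  valℚ--1 : valℚ (- 1#) ≡ [ 0ℚ ]
  valℚ--1 = halve (valℚ (- 1#)) (trans (sym (valℚ-* (- 1#) (- 1#)))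
    (trans (valℚ-cong (≈.trans (-1*x≈-x (- 1#)) (-‿involutive 1#))) valℚ-1))
    where
    halve : ∀ v → v +ℚ v ≡ [ 0ℚ ] → v ≡ [ 0ℚ ]
    halve [ p ] e = cong (λ q → [ q ]) (trans (doubled p) (cong (½ ℚ.*_) ([]-injective e)))
      where
      doubled : ∀ p → p ≡ ½ ℚ.* (p ℚ.+ p)
      doubled p = solve (p ∷ []) ℚ-ring

  valℚ-neg : ∀ x → valℚ (- x) ≡ valℚ x
  valℚ-neg x = trans (valℚ-cong (≈.sym (-1*x≈-x x)))
    (trans (valℚ-* (- 1#) x) (trans (cong (_+ℚ valℚ x) valℚ--1) (+ℚ-identityˡ (valℚ x))))

  ≤valℚ-sub : ∀ {b x y} → b ≤ℚ valℚ x → b ≤ℚ valℚ y → b ≤ℚ valℚ (x - y)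
  ≤valℚ-sub {b} {x} {y} b≤x b≤y = ≤valℚ-+ b≤x (subst (b ≤ℚ_) (sym (valℚ-neg y)) b≤y)

  -- x = (x + y) − y, so x + y cannot have larger valuation than x when y has.
  dominated : ∀ {x y} → valℚ x <ℚ valℚ y → valℚ (x + y) ≤ℚ valℚ x
  dominated {x} {y} x<y with valℚ-+ (x + y) (- y)
  ... | inj₁ le = ≤ℚ-trans le (≤ℚ-reflexive (valℚ-cong cancel))
    where
    cancel : x + y - y ≈ x
    cancel = ≈.trans (+-assoc x y (- y)) (≈.trans (+-congˡ (-‿inverseʳ y)) (+-identityʳ x))
  ... | inj₂ le = contradiction
    (subst₂ _≤ℚ_ (valℚ-neg y) (valℚ-cong cancel) le) (<ℚ⇒≱ x<y)
    where
    cancel : x + y - y ≈ x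
    cancel = ≈.trans (+-assoc x y (- y)) (≈.trans (+-congˡ (-‿inverseʳ y)) (+-identityʳ x))

-- Bounds by a line and a weight, and Euclidean division under such bounds

module Filtration {c ℓ} (K : CompleteDiscreteValuationField c ℓ) (λ₀ : ℚ) where
  open CompleteDiscreteValuationField K hiding (refl; sym; trans)
  open Polynomials K
  open PolynomialRing K
  open Valuation K
  open RingIdentities polynomialRing using (difference-remainder)
  private
    module ≈ = CommutativeRing commutativeRing

  line : ℚ → ℕ → ℚ
  line b j = b ℚ.+ λ₀ ℚ.* ℕ→ℚ j

  line-mono : ∀ {a b} j → a ℚ.≤ b → line a j ℚ.≤ line b j
  line-mono j a≤b = ℚ.+-monoˡ-≤ (λ₀ ℚ.* ℕ→ℚ j) a≤b

  line-+ : ∀ a b j → line (a ℚ.+ b) j ≡ a ℚ.+ line b j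
  line-+ a b j = ℚ.+-assoc a b (λ₀ ℚ.* ℕ→ℚ j)

  line-zero : ∀ b → line b 0 ≡ b
  line-zero b = trans (cong (b ℚ.+_) (ℚ.*-zeroʳ λ₀)) (ℚ.+-identityʳ b)

  line-suc : ∀ b j → line b (suc j) ≡ line (b ℚ.+ λ₀) j
  line-suc b j = trans (cong (λ J → b ℚ.+ λ₀ ℚ.* J) (ℕ→ℚ-suc j)) (shift b λ₀ (ℕ→ℚ j))
    where
    shift : ∀ b l J → b ℚ.+ l ℚ.* (J ℚ.+ 1ℚ) ≡ b ℚ.+ l ℚ.+ l ℚ.* J
    shift b l J = solve (b ∷ l ∷ J ∷ []) ℚ-ring

  Weight : Set
  Weight = ℕ → ℚ ⁺

  𝟘 : Weight
  𝟘 _ = [ 0ℚ ]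

  -- What multiplication requires: a term p_i q_(j-i) of a product brings the weight w (j - i),
  -- which must be at least w j.
  Antitone : Weight → Set
  Antitone w = ∀ j → w (suc j) ≤ℚ w j

  𝟘-antitone : Antitone 𝟘
  𝟘-antitone _ = ≤ℚ-refl

  record Bounded (w : Weight) (b : ℚ) (p : Poly) : Set where
    constructor bounded
    field bound : ∀ j → (w j +ℚ [ line b j ]) ≤ℚ valℚ (coeff p j)

  open Bounded public

  Bounded-cong : ∀ {w b p q} → p ≋ q → Bounded w b p → Bounded w b q
  Bounded-cong p≋q bp = bounded λ j → ≤ℚ-trans (bound bp j) (≤ℚ-reflexive (valℚ-cong (at p≋q j)))

  Bounded-weaken : ∀ {w a b p} → a ℚ.≤ b → Bounded w b p → Bounded w a p
  Bounded-weaken a≤b bp = bounded λ j →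
    ≤ℚ-trans (+ℚ-mono ≤ℚ-refl [ line-mono j a≤b ]) (bound bp j)

  Bounded-cast : ∀ {w a b p} → b ≡ a → Bounded w b p → Bounded w a p
  Bounded-cast refl bp = bp

  Bounded-forget : ∀ {w b p} → (∀ j → [ 0ℚ ] ≤ℚ w j) → Bounded w b p → Bounded 𝟘 b p
  Bounded-forget 0≤w bp = bounded λ j → ≤ℚ-trans (+ℚ-mono (0≤w j) ≤ℚ-refl) (bound bp j)

  Bounded-[] : ∀ {w b} → Bounded w b []
  Bounded-[] = bounded λ _ → ≤valℚ-0 ≈.refl

  Bounded-+ : ∀ {w b p q} → Bounded w b p → Bounded w b q → Bounded w b (p +ₚ q)
  Bounded-+ {p = p} {q} bp bq = bounded λ j → ≤ℚ-trans (≤valℚ-+ (bound bp j) (bound bq j))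
    (≤ℚ-reflexive (valℚ-cong (≈.sym (coeff-+ p q j))))

  Bounded-neg : ∀ {w b p} → Bounded w b p → Bounded w b (map -_ p)
  Bounded-neg {p = p} bp = bounded λ j → ≤ℚ-trans (bound bp j)
    (≤ℚ-reflexive (sym (trans (valℚ-cong (coeff-neg p j)) (valℚ-neg (coeff p j)))))

  Bounded-sub : ∀ {w b p q} → Bounded w b p → Bounded w b q → Bounded w b (p -ₚ q)
  Bounded-sub bp bq = Bounded-+ bp (Bounded-neg bq)

  Bounded-· : ∀ {w a b x p} → [ a ] ≤ℚ valℚ x → Bounded w b p → Bounded w (a ℚ.+ b) (x ·ₚ p)
  Bounded-· {w} {a} {b} {x} {p} a≤x bp = bounded λ j → ≤ℚ-trans (≤ℚ-reflexive (split (w j) j))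
    (≤ℚ-trans (+ℚ-mono a≤x (bound bp j))
      (≤ℚ-reflexive (sym (trans (valℚ-cong (coeff-· x p j)) (valℚ-* x (coeff p j))))))
    where
    split : ∀ v j → v +ℚ [ line (a ℚ.+ b) j ] ≡ [ a ] +ℚ (v +ℚ [ line b j ])
    split ⊤⁺    j = refl
    split [ q ] j = cong (λ r → [ r ]) (trans (cong (q ℚ.+_) (line-+ a b j)) (swap q a (line b j)))
      where
      swap : ∀ q a l → q ℚ.+ (a ℚ.+ l) ≡ a ℚ.+ (q ℚ.+ l)
      swap q a l = solve (q ∷ a ∷ l ∷ []) ℚ-ring

  Bounded-0∷ : ∀ {w b p} → Antitone w → Bounded w (b ℚ.+ λ₀) p → Bounded w b (0# ∷ p)
  Bounded-0∷ {w} {b} anti bp = bounded λ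
    { zero    → ≤valℚ-0 ≈.refl
    ; (suc j) → ≤ℚ-trans (+ℚ-mono (anti j) (≤ℚ-reflexive (cong (λ q → [ q ]) (line-suc b j)))) (bound bp j)
    }

  Bounded-∷ : ∀ {b x p} → [ b ] ≤ℚ valℚ x → Bounded 𝟘 (b ℚ.+ λ₀) p → Bounded 𝟘 b (x ∷ p)
  Bounded-∷ {b} b≤x bp = bounded λ
    { zero    → ≤ℚ-trans (≤ℚ-reflexive (cong (λ q → [ q ]) (trans (ℚ.+-identityˡ _) (line-zero b)))) b≤x
    ; (suc j) → ≤ℚ-trans (≤ℚ-reflexive (cong (λ q → [ 0ℚ ℚ.+ q ]) (line-suc b j))) (bound bp j)
    }

  Bounded-head : ∀ {b x p} → Bounded 𝟘 b (x ∷ p) → [ b ] ≤ℚ valℚ x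
  Bounded-head {b} bp = ≤ℚ-trans
    (≤ℚ-reflexive (cong (λ q → [ q ]) (sym (trans (ℚ.+-identityˡ _) (line-zero b))))) (bound bp 0)

  Bounded-tail : ∀ {b} p → Bounded 𝟘 b p → Bounded 𝟘 (b ℚ.+ λ₀) (drop 1 p)
  Bounded-tail     []      bp = Bounded-[]
  Bounded-tail {b} (x ∷ p) bp = bounded λ j → ≤ℚ-trans
    (≤ℚ-reflexive (cong (λ q → [ 0ℚ ℚ.+ q ]) (sym (line-suc b j)))) (bound bp (suc j))

  Bounded-* : ∀ {w a b} p {q} → Antitone w → Bounded 𝟘 a p → Bounded w b q →
    Bounded w (a ℚ.+ b) (p *ₚ q)
  Bounded-* []      anti bp bq = Bounded-[]
  Bounded-* {w} {a} {b} (x ∷ p) anti bp bq = Bounded-+ (Bounded-· (Bounded-head bp) bq)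
    (Bounded-0∷ anti (Bounded-cast (swap a b λ₀) (Bounded-* p anti (Bounded-tail (x ∷ p) bp) bq)))
    where
    swap : ∀ a b l → a ℚ.+ l ℚ.+ b ≡ a ℚ.+ b ℚ.+ l
    swap a b l = solve (a ∷ b ∷ l ∷ []) ℚ-ring

  Bounded-*ʳ : ∀ {w a b} p {q} → Antitone w → Bounded w a p → Bounded 𝟘 b q →
    Bounded w (a ℚ.+ b) (p *ₚ q)
  Bounded-*ʳ {w} {a} {b} p {q} anti bp bq =
    Bounded-cong (*ₚ-comm q p) (Bounded-cast (ℚ.+-comm b a) (Bounded-* q anti bq bp))

  Bounded-1 : Bounded 𝟘 0ℚ (1# ∷ [])
  Bounded-1 = Bounded-∷ (≤ℚ-reflexive (sym valℚ-1)) Bounded-[]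

  module Division {A : Poly} {d : ℕ} {e : ℚ}
    (A-bounded : Bounded 𝟘 e A) (A-degree : DegreeBelow A (suc d))
    (A-leading : valℚ (coeff A d) ≡ [ line e d ])
    where

    coeff-drop : ∀ p i → coeff (drop 1 p) i ≡ coeff p (suc i)
    coeff-drop []      i = refl
    coeff-drop (x ∷ p) i = refl

    -- Dropping constant terms leaves a division by A with the shorter quotient Q. The term
    -- `q ·ₚ drop 1 A` can join the remainder, since A has degree d and its tail therefore has
    -- degree below d.
    division-tail : ∀ {Z q Q R} → Z ≋ (q ∷ Q) *ₚ A +ₚ R →
      drop 1 Z ≋ Q *ₚ A +ₚ (q ·ₚ drop 1 A +ₚ drop 1 R)
    division-tail {Z} {q} {Q} {R} Z≋ = coeffwise λ i → begin
      coeff (drop 1 Z) i                                       ≡⟨ coeff-drop Z i ⟩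
      coeff Z (suc i)                                          ≈⟨ at Z≋ (suc i) ⟩
      coeff ((q ∷ Q) *ₚ A +ₚ R) (suc i)                        ≈⟨ coeff-+ ((q ∷ Q) *ₚ A) R (suc i) ⟩
      coeff (q ·ₚ A +ₚ (0# ∷ Q *ₚ A)) (suc i) + coeff R (suc i)
        ≈⟨ +-congʳ (coeff-+ (q ·ₚ A) (0# ∷ Q *ₚ A) (suc i)) ⟩
      coeff (q ·ₚ A) (suc i) + coeff (Q *ₚ A) i + coeff R (suc i)
        ≈⟨ +-cong (+-congʳ (coeff-· q A (suc i))) ≈.refl ⟩
      q * coeff A (suc i) + coeff (Q *ₚ A) i + coeff R (suc i) ≈⟨ +-congʳ (+-comm _ _) ⟩
      coeff (Q *ₚ A) i + q * coeff A (suc i) + coeff R (suc i) ≈⟨ +-assoc _ _ _ ⟩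
      coeff (Q *ₚ A) i + (q * coeff A (suc i) + coeff R (suc i))
        ≡⟨ cong₂ (λ a r → coeff (Q *ₚ A) i + (q * a + r)) (coeff-drop A i) (coeff-drop R i) ⟨
      coeff (Q *ₚ A) i + (q * coeff (drop 1 A) i + coeff (drop 1 R) i)
        ≈⟨ +-congˡ (+-congʳ (coeff-· q (drop 1 A) i)) ⟨
      coeff (Q *ₚ A) i + (coeff (q ·ₚ drop 1 A) i + coeff (drop 1 R) i)
        ≈⟨ +-congˡ (coeff-+ (q ·ₚ drop 1 A) (drop 1 R) i) ⟨
      coeff (Q *ₚ A) i + coeff (q ·ₚ drop 1 A +ₚ drop 1 R) i   ≈⟨ coeff-+ (Q *ₚ A) _ i ⟨
      coeff (Q *ₚ A +ₚ (q ·ₚ drop 1 A +ₚ drop 1 R)) i          ∎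
      where open SetoidReasoning setoid

    tail-degree : ∀ {q R} → DegreeBelow R d → DegreeBelow (q ·ₚ drop 1 A +ₚ drop 1 R) d
    tail-degree {q} {R} R-degree i d≤i = begin
      coeff (q ·ₚ drop 1 A +ₚ drop 1 R) i                ≈⟨ coeff-+ (q ·ₚ drop 1 A) (drop 1 R) i ⟩
      coeff (q ·ₚ drop 1 A) i + coeff (drop 1 R) i       ≈⟨ +-congʳ (coeff-· q (drop 1 A) i) ⟩
      q * coeff (drop 1 A) i + coeff (drop 1 R) i
        ≡⟨ cong₂ (λ a r → q * a + r) (coeff-drop A i) (coeff-drop R i) ⟩
      q * coeff A (suc i) + coeff R (suc i)
        ≈⟨ +-cong (*-congˡ (A-degree (suc i) (s≤s d≤i))) (R-degree (suc i) (ℕ.m≤n⇒m≤1+n d≤i)) ⟩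
      q * 0# + 0#                                        ≈⟨ +-cong (zeroʳ q) ≈.refl ⟩
      0# + 0#                                            ≈⟨ +-identityʳ 0# ⟩
      0#                                                 ∎
      where open SetoidReasoning setoid

    cancel-leading : ∀ {b q} → [ line (e ℚ.+ b) d ] ≤ℚ valℚ (q * coeff A d) → [ b ] ≤ℚ valℚ q
    cancel-leading {b} {q} le = cancel (valℚ q) (subst ([ line (e ℚ.+ b) d ] ≤ℚ_)
      (trans (valℚ-* q (coeff A d)) (cong (valℚ q +ℚ_) A-leading)) le)
      where
      eq : ∀ e b x l → x ≡ b ℚ.+ (x ℚ.+ (e ℚ.+ l) ℚ.- (e ℚ.+ b ℚ.+ l))
      eq e b x l = solve (e ∷ b ∷ x ∷ l ∷ []) ℚ-ring
      cancel : ∀ v → [ line (e ℚ.+ b) d ] ≤ℚ (v +ℚ [ line e d ]) → [ b ] ≤ℚ v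
      cancel ⊤⁺    _     = _ ≤⊤⁺
      cancel [ x ] [ le ] = [ ≤-by _ (p≤q⇒0≤q-p le) (eq e b x (λ₀ ℚ.* ℕ→ℚ d)) ]

    -- The quotient is bounded from its top coefficient down. Once Q is bounded, look at degree d,
    -- where R vanishes: q times the leading coefficient of A is the coefficient of Z minus that of
    -- X Q A. As this leading coefficient lies exactly on the line bounding A, dividing by it loses
    -- nothing.
    quotient-bounded : ∀ {b} Q {Z R} → Z ≋ Q *ₚ A +ₚ R → DegreeBelow R d →
      Bounded 𝟘 (e ℚ.+ b) Z → Bounded 𝟘 b Q
    quotient-bounded []      Z≋ R-degree bZ = Bounded-[]
    quotient-bounded {b} (q ∷ Q) {Z} {R} Z≋ R-degree bZ =
      Bounded-∷ (cancel-leading (≤ℚ-trans at-d (≤ℚ-reflexive (valℚ-cong extract)))) bQ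
      where
      bQ : Bounded 𝟘 (b ℚ.+ λ₀) Q
      bQ = quotient-bounded Q (division-tail {Z} {q} {Q} {R} Z≋) (tail-degree {q} {R} R-degree)
        (Bounded-cast (ℚ.+-assoc e b λ₀) (Bounded-tail Z bZ))
      b0∷QA : Bounded 𝟘 (e ℚ.+ b) (0# ∷ Q *ₚ A)
      b0∷QA = Bounded-0∷ 𝟘-antitone (Bounded-cast (swap e b λ₀) (Bounded-* Q 𝟘-antitone bQ A-bounded))
        where
        swap : ∀ e b l → b ℚ.+ l ℚ.+ e ≡ e ℚ.+ b ℚ.+ l
        swap e b l = solve (e ∷ b ∷ l ∷ []) ℚ-ring
      at-d : [ line (e ℚ.+ b) d ] ≤ℚ valℚ (coeff Z d - coeff (0# ∷ Q *ₚ A) d)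
      at-d = ≤valℚ-sub (≤ℚ-trans (≤ℚ-reflexive (cong (λ q → [ q ]) (sym (ℚ.+-identityˡ _)))) (bound bZ d))
        (≤ℚ-trans (≤ℚ-reflexive (cong (λ q → [ q ]) (sym (ℚ.+-identityˡ _)))) (bound b0∷QA d))
      extract : coeff Z d - coeff (0# ∷ Q *ₚ A) d ≈ q * coeff A d
      extract = begin
        coeff Z d - X                                  ≈⟨ +-congʳ (at Z≋ d) ⟩
        coeff ((q ∷ Q) *ₚ A +ₚ R) d - X                ≈⟨ +-congʳ (coeff-+ ((q ∷ Q) *ₚ A) R d) ⟩
        coeff ((q ∷ Q) *ₚ A) d + coeff R d - X         ≈⟨ +-congʳ (+-cong (coeff-+ (q ·ₚ A) _ d) (R-degree d ℕ.≤-refl)) ⟩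
        coeff (q ·ₚ A) d + X + 0# - X                  ≈⟨ +-congʳ (+-identityʳ _) ⟩
        coeff (q ·ₚ A) d + X - X                       ≈⟨ +-assoc _ _ _ ⟩
        coeff (q ·ₚ A) d + (X - X)                     ≈⟨ +-cong (coeff-· q A d) (-‿inverseʳ X) ⟩
        q * coeff A d + 0#                             ≈⟨ +-identityʳ _ ⟩
        q * coeff A d                                  ∎
        where
        open SetoidReasoning setoid
        X = coeff (0# ∷ Q *ₚ A) d

    -- The unweighted bound on Q suffices: the weight of Q A comes from A alone.
    remainder-bounded : ∀ {w b} Q {Z R} → Antitone w → Bounded w e A → Z ≋ Q *ₚ A +ₚ R →
      Bounded 𝟘 b Q → Bounded w (e ℚ.+ b) Z → Bounded w (e ℚ.+ b) R
    remainder-bounded {w} {b} Q {Z} {R} anti bA Z≋ bQ bZ = Bounded-cong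
      (≋-sym (difference-remainder {Z} {Q *ₚ A} {R} Z≋))
      (Bounded-sub bZ (Bounded-cast (ℚ.+-comm b e) (Bounded-* Q anti bQ bA)))

-- The iteration

module Euclid {c ℓ} (K : CompleteDiscreteValuationField c ℓ) where
  open CompleteDiscreteValuationField K hiding (refl; sym; trans)
  open Polynomials K
  open PolynomialRing K
  private
    module ≈ = CommutativeRing commutativeRing

  degree-unique : ∀ {p m n} → HasDegree p m → HasDegree p n → m ≡ n
  degree-unique {p} {m} {n} (lead-m , above-m) (lead-n , above-n) with ℕ.<-cmp m n
  ... | tri< m<n _ _ = contradiction (above-m n m<n) lead-n
  ... | tri≈ _ m≡n _ = m≡n
  ... | tri> _ _ n<m = contradiction (above-n m n<m) lead-m

  euclidean-division : ∀ X A {d} → HasDegree A d →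
    X ≋ (X div A) *ₚ A +ₚ (X mod A) × DegreeBelow (X mod A) d
  euclidean-division X A {d} A-degree =
    let X≈ , m , A-degree′ , small = div-mod-correct X A (λ A≈0 → proj₁ A-degree (A≈0 d))
    in coeffwise X≈ , subst (DegreeBelow (X mod A)) (degree-unique {A} A-degree′ A-degree) small

  coeff-applyUpTo : ∀ f n j → j ℕ.< n → coeff (applyUpTo f n) j ≡ f j
  coeff-applyUpTo f (suc n) zero    _         = refl
  coeff-applyUpTo f (suc n) (suc j) (s≤s j<n) = coeff-applyUpTo (λ i → f (suc i)) n j j<n

  coeff-applyUpTo-above : ∀ f n j → n ℕ.≤ j → coeff (applyUpTo f n) j ≡ 0#
  coeff-applyUpTo-above f zero    j       _         = refl
  coeff-applyUpTo-above f (suc n) (suc j) (s≤s n≤j) = coeff-applyUpTo-above (λ i → f (suc i)) n j n≤j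

  module _ (P : Poly) (d : ℕ) (a_d≉0 : ¬ coeff P d ≈ 0#) where
    open Iteration P d

    -- The correction is a remainder modulo `A i`, so its degree is below d and the leading
    -- coefficient is untouched. In particular no division ever falls back on the dummy values.
    iterate-degree : ∀ i → HasDegree (A i) d × coeff (A i) d ≈ coeff P d
    iterate-degree zero = (
        (λ A₀≈0 → a_d≉0 (≈.trans (≈.sym lead) A₀≈0)) ,
        λ j d<j → ≈.reflexive (coeff-applyUpTo-above (coeff P) (suc d) j d<j)) ,
      lead
      where
      lead : coeff (A 0) d ≈ coeff P d
      lead = ≈.reflexive (coeff-applyUpTo (coeff P) (suc d) d (ℕ.n<1+n d))
    iterate-degree (suc i) = ((λ A≈0 → a_d≉0 (≈.trans (≈.sym lead) A≈0)) , above) , lead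
      where
      T : Poly
      T = (V i *ₚ P) mod A i
      T-degree : DegreeBelow T d
      T-degree = proj₂ (euclidean-division (V i *ₚ P) (A i) (proj₁ (iterate-degree i)))
      lead : coeff (A i +ₚ T) d ≈ coeff P d
      lead = ≈.trans (coeff-+ (A i) T d) (≈.trans
        (+-cong (proj₂ (iterate-degree i)) (T-degree d ℕ.≤-refl)) (+-identityʳ _))
      above : DegreeBelow (A i +ₚ T) (suc d)
      above j d<j = ≈.trans (coeff-+ (A i) T j) (≈.trans
        (+-cong (proj₂ (proj₁ (iterate-degree i)) j d<j) (T-degree j (ℕ.<⇒≤ d<j))) (+-identityʳ _))

-- Bounds with weight w refine those with weight 𝟘; polynomials of the second
-- kind form a filtered ring, and those of the first a filtered module over it.
module NewtonStep {c ℓ} (K : CompleteDiscreteValuationField c ℓ) (λ₀ : ℚ)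
  (w : Filtration.Weight K λ₀) (w-antitone : Filtration.Antitone K λ₀ w) (0≤w : ∀ j → [ 0ℚ ] ≤ℚ w j)
  (P : Polynomials.Poly K) (d : ℕ) (e : ℚ)
  (leading : Polynomials.valℚ K (Polynomials.coeff K P d) ≡ [ Filtration.line K λ₀ e d ])
  where
  open Polynomials K
  open Filtration K λ₀
  open CompleteDiscreteValuationField K hiding (refl; sym; trans)
  open PolynomialRing K
  open Valuation K
  open Euclid K
  open Iteration P d
  open RingIdentities polynomialRing
  private
    module ≈ = CommutativeRing commutativeRing

  a_d≉0 : ¬ coeff P d ≈ 0#
  a_d≉0 a_d≈0 = contradiction (trans (sym leading) (valℚ-0 a_d≈0)) λ ()

  degree : ∀ i → HasDegree (A i) d
  degree i = proj₁ (iterate-degree P d a_d≉0 i)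

  leading-A : ∀ i → valℚ (coeff (A i) d) ≡ [ line e d ]
  leading-A i = trans (valℚ-cong (proj₂ (iterate-degree P d a_d≉0 i))) leading

  -- The shift by e makes b the gain over the bound satisfied by the `A i`, which lie in 𝕄 0.
  𝕄 ℝ : ℚ → Poly → Set
  𝕄 b p = Bounded w (e ℚ.+ b) p
  ℝ = Bounded 𝟘

  𝕄⇒ℝ : ∀ {b p} → 𝕄 b p → ℝ (e ℚ.+ b) p
  𝕄⇒ℝ = Bounded-forget 0≤w

  ℝ-* : ∀ {a b p q} → ℝ a p → ℝ b q → ℝ (a ℚ.+ b) (p *ₚ q)
  ℝ-* {p = p} = Bounded-* p 𝟘-antitone

  quotient-ℝ : ∀ {i b Q Z R} → 𝕄 0ℚ (A i) → Z ≋ Q *ₚ A i +ₚ R → DegreeBelow R d →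
    ℝ (e ℚ.+ b) Z → ℝ b Q
  quotient-ℝ {i} {b} {Q} {Z} {R} bA = Division.quotient-bounded
    (Bounded-cast (ℚ.+-identityʳ e) (𝕄⇒ℝ bA)) (proj₂ (degree i)) (leading-A i) Q {Z} {R}

  remainder-𝕄 : ∀ {i b Q Z R} → 𝕄 0ℚ (A i) → Z ≋ Q *ₚ A i +ₚ R → ℝ b Q → 𝕄 b Z → 𝕄 b R
  remainder-𝕄 {i} {b} {Q} {Z} {R} bA = Division.remainder-bounded
    (Bounded-cast (ℚ.+-identityʳ e) (𝕄⇒ℝ bA)) (proj₂ (degree i)) (leading-A i) Q {Z} {R}
    w-antitone (Bounded-cast (ℚ.+-identityʳ e) bA)

  -- Only E and the remainder of P carry the gain b; A, B and V merely keep their bounds. The bound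
  -- - e on F is the one that puts F A in ℝ 0.
  record Invariant (b : ℚ) (i : ℕ) : Set (c Level.⊔ ℓ) where
    field
      E F         : Poly
      inversion   : (1# ∷ []) ≋ V i *ₚ B i +ₚ E +ₚ F *ₚ A i
      A-bounded   : 𝕄 0ℚ (A i)
      B-bounded   : ℝ 0ℚ (B i)
      V-bounded   : ℝ 0ℚ (V i)
      E-bounded   : ℝ b E
      F-bounded   : ℝ (ℚ.- e) F
      mod-bounded : 𝕄 b (P mod A i)

  correction : ℕ → Poly
  correction i = (V i *ₚ P) mod A i

  private
    e+-e : e ℚ.+ ℚ.- e ≡ 0ℚ
    e+-e = ℚ.+-inverseʳ e
    -e+e+ : ∀ b → ℚ.- e ℚ.+ (e ℚ.+ b) ≡ b
    -e+e+ b = solve (e ∷ b ∷ []) ℚ-ring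

  step : ∀ {b i} → 0ℚ ℚ.≤ b → Invariant b i → Invariant (b ℚ.+ b) (suc i) × 𝕄 b (correction i)
  step {b} {i} 0≤b inv = record
      { E = E₁ *ₚ E₁
      ; F = E₁ *ₚ F +ₚ E₁ *ₚ F +ₚ F *ₚ F *ₚ A′ +ₚ G *ₚ B′
      ; inversion   = inverse-square {A′} {B′} {V i} {E₁} {F} {G} {V′} inversion₁ X≋
      ; A-bounded   = bA′
      ; B-bounded   = bB′
      ; V-bounded   = bV′
      ; E-bounded   = ℝ-* bE₁ bE₁
      ; F-bounded   = Bounded-+ (Bounded-+ (Bounded-+ bE₁F bE₁F)
          (Bounded-cast (cube e) (ℝ-* (ℝ-* F-bounded F-bounded) (𝕄⇒ℝ bA′))))
          (Bounded-cast (ℚ.+-identityʳ (ℚ.- e)) (ℝ-* bG bB′))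
      ; mod-bounded = bS′
      } , bT
    where
    open Invariant inv
    A′ B′ V′ S S′ T U W D Z E₁ X G : Poly
    A′ = A (suc i)
    B′ = B (suc i)
    V′ = V (suc i)
    S  = P mod A i
    S′ = P mod A′
    T  = correction i
    W  = (V i *ₚ P) div A i -ₚ V i *ₚ B i
    U  = F *ₚ S +ₚ W *ₚ B i
    -- `B i +ₚ U` is the quotient predicted by the corrected factorization, and Z its error, not yet
    -- reduced modulo A′. D is the quotient of Z by A′, so it is as small as Z.
    D  = B′ -ₚ (B i +ₚ U)
    Z  = S *ₚ E -ₚ T *ₚ U
    E₁ = E -ₚ V i *ₚ U -ₚ V i *ₚ D -ₚ F *ₚ T
    X  = (1# + 1#) ·ₚ V i -ₚ V i *ₚ V i *ₚ B′
    G  = X div A′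

    cube : ∀ e → ℚ.- e ℚ.+ ℚ.- e ℚ.+ (e ℚ.+ 0ℚ) ≡ ℚ.- e
    cube e = solve (e ∷ []) ℚ-ring

    b≤b+b : b ℚ.≤ b ℚ.+ b
    b≤b+b = ≤-by b 0≤b refl
    0≤b+b : 0ℚ ℚ.≤ b ℚ.+ b
    0≤b+b = ℚ.≤-trans 0≤b b≤b+b

    P≋ : P ≋ B i *ₚ A i +ₚ S
    P≋ = proj₁ (euclidean-division P (A i) (degree i))
    P≋′ : P ≋ B′ *ₚ A′ +ₚ S′
    P≋′ = proj₁ (euclidean-division P A′ (degree (suc i)))
    VS≋ : V i *ₚ S ≋ W *ₚ A i +ₚ T
    VS≋ = correction-division {P} {A i} {B i} {S} {V i} {(V i *ₚ P) div A i} {T} P≋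
      (proj₁ (euclidean-division (V i *ₚ P) (A i) (degree i)))

    bVS : 𝕄 b (V i *ₚ S)
    bVS = Bounded-cast (ℚ.+-identityˡ (e ℚ.+ b)) (Bounded-* (V i) w-antitone V-bounded mod-bounded)
    bW : ℝ b W
    bW = quotient-ℝ {i} {b} {W} {V i *ₚ S} {T} A-bounded VS≋
      (proj₂ (euclidean-division (V i *ₚ P) (A i) (degree i))) (𝕄⇒ℝ bVS)
    bT : 𝕄 b T
    bT = remainder-𝕄 {i} {b} {W} {V i *ₚ S} {T} A-bounded VS≋ bW bVS
    bU : ℝ b U
    bU = Bounded-+ (Bounded-cast (-e+e+ b) (ℝ-* F-bounded (𝕄⇒ℝ mod-bounded)))
                   (Bounded-cast (ℚ.+-identityʳ b) (ℝ-* bW B-bounded))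
    bA′ : 𝕄 0ℚ A′
    bA′ = Bounded-+ A-bounded (Bounded-weaken (ℚ.+-monoʳ-≤ e 0≤b) bT)
    -- The doubling: in S E and in T U, a factor of gain b in 𝕄 meets a factor of gain b in ℝ.
    bZ : 𝕄 (b ℚ.+ b) Z
    bZ = Bounded-cast (ℚ.+-assoc e b b) (Bounded-sub
      (Bounded-*ʳ S w-antitone mod-bounded E-bounded) (Bounded-*ʳ T w-antitone bT bU))
    Z≋ : Z ≋ D *ₚ A′ +ₚ S′
    Z≋ = division-difference {P} {A′} {B i +ₚ U} {Z} {B′} {S′}
      (corrected-factorization {P} {A i} {B i} {S} {V i} {W} {T} {E} {F} P≋ inversion VS≋) P≋′
    bD : ℝ (b ℚ.+ b) D
    bD = quotient-ℝ {suc i} {b ℚ.+ b} {D} {Z} {S′} bA′ Z≋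
      (proj₂ (euclidean-division P A′ (degree (suc i)))) (𝕄⇒ℝ bZ)
    bS′ : 𝕄 (b ℚ.+ b) S′
    bS′ = remainder-𝕄 {suc i} {b ℚ.+ b} {D} {Z} {S′} bA′ Z≋ bD bZ
    bB′ : ℝ 0ℚ B′
    bB′ = Bounded-cong (≋-sym (difference-add B′ (B i +ₚ U)))
      (Bounded-+ (Bounded-weaken 0≤b+b bD) (Bounded-+ B-bounded (Bounded-weaken 0≤b bU)))

    inversion₁ : (1# ∷ []) ≋ V i *ₚ B′ +ₚ E₁ +ₚ F *ₚ A′
    inversion₁ = inverse-transfer {A i} {B i} {V i} {E} {F} {T} {U} {B′} inversion
    -- For the old V and the new quotient the error still gains only b; `inverse-square` then
    -- replaces it by its square.
    bE₁ : ℝ b E₁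
    bE₁ = Bounded-sub (Bounded-sub (Bounded-sub E-bounded
      (Bounded-cast (ℚ.+-identityˡ b) (ℝ-* V-bounded bU)))
      (Bounded-weaken b≤b+b (Bounded-cast (ℚ.+-identityˡ (b ℚ.+ b)) (ℝ-* V-bounded bD))))
      (Bounded-cast (-e+e+ b) (ℝ-* F-bounded (𝕄⇒ℝ bT)))
    bE₁F : ℝ (ℚ.- e) (E₁ *ₚ F)
    bE₁F = Bounded-weaken (≤-by b 0≤b (ℚ.+-comm b (ℚ.- e))) (ℝ-* bE₁ F-bounded)

    doubled : (1# + 1#) ·ₚ V i ≋ V i +ₚ V i
    doubled = ≋-trans (·-distribʳ 1# 1# (V i)) (+ₚ-cong (·-identity (V i)) (·-identity (V i)))
    X≋ : (V i +ₚ V i) -ₚ V i *ₚ V i *ₚ B′ ≋ G *ₚ A′ +ₚ V′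
    X≋ = ≋-trans (+ₚ-cong (≋-sym doubled) ≋-refl) (proj₁ (euclidean-division X A′ (degree (suc i))))
    bX : ℝ 0ℚ X
    bX = Bounded-sub (Bounded-cong (≋-sym doubled) (Bounded-+ V-bounded V-bounded))
      (ℝ-* (ℝ-* V-bounded V-bounded) bB′)
    bG : ℝ (ℚ.- e) G
    bG = quotient-ℝ {suc i} {ℚ.- e} {G} {X} {V′} bA′ (proj₁ (euclidean-division X A′ (degree (suc i))))
      (proj₂ (euclidean-division X A′ (degree (suc i)))) (Bounded-cast (sym e+-e) bX)
    bV′ : ℝ 0ℚ V′
    bV′ = Bounded-cong (≋-sym (difference-remainder {X} {G *ₚ A′} {V′}
        (proj₁ (euclidean-division X A′ (degree (suc i))))))
      (Bounded-sub bX (Bounded-cast (cancel e) (ℝ-* bG (𝕄⇒ℝ bA′))))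
      where
      cancel : ∀ e → ℚ.- e ℚ.+ (e ℚ.+ 0ℚ) ≡ 0ℚ
      cancel e = solve (e ∷ []) ℚ-ring

  -- P = 1 · A₀ + (P - A₀) is a division up to reduction, so B₀ - 1 gains κ like P - A₀. Hence V₀ =
  -- 1 inverts B₀ with error 1 - B₀ and F = 0.
  initial : ∀ {κ} → 0ℚ ℚ.≤ κ → 𝕄 0ℚ (A 0) → 𝕄 κ (P -ₚ A 0) → Invariant κ 0
  initial {κ} 0≤κ bA bZ = record
    { E = map -_ D
    ; F = []
    ; inversion   = initial-inverse (A 0) (B 0)
    ; A-bounded   = bA
    ; B-bounded   = Bounded-cong (≋-sym (difference-add (B 0) (1# ∷ [])))
                      (Bounded-+ (Bounded-weaken 0≤κ bD) Bounded-1)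
    ; V-bounded   = Bounded-1
    ; E-bounded   = Bounded-neg bD
    ; F-bounded   = Bounded-[]
    ; mod-bounded = remainder-𝕄 {0} {κ} {D} {P -ₚ A 0} {P mod A 0} bA Z≋ bD bZ
    }
    where
    D : Poly
    D = B 0 -ₚ (1# ∷ [])
    Z≋ : P -ₚ A 0 ≋ D *ₚ A 0 +ₚ P mod A 0
    Z≋ = division-difference {P} {A 0} {1# ∷ []} {P -ₚ A 0} {B 0} {P mod A 0}
      (initial-factorization P (A 0)) (proj₁ (euclidean-division P (A 0) (degree 0)))
    bD : ℝ κ D
    bD = quotient-ℝ {0} {κ} {D} {P -ₚ A 0} {P mod A 0} bA Z≋
      (proj₂ (euclidean-division P (A 0) (degree 0))) (𝕄⇒ℝ bZ)

-- Limits

module Limits {c ℓ} (K : CompleteDiscreteValuationField c ℓ) where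
  open CompleteDiscreteValuationField K hiding (refl; sym; trans)
  open Polynomials K
  open Valuation K
  open RingIdentities commutativeRing using (chain; through)
  private
    module ≈ = CommutativeRing commutativeRing

  unbounded⇒0 : ∀ {x} → (∀ q → [ q ] ≤ℚ valℚ x) → x ≈ 0#
  unbounded⇒0 {x} unbounded = valℚ-∞ (infinite (valℚ x) refl)
    where
    infinite : ∀ v → valℚ x ≡ v → valℚ x ≡ ⊤⁺
    infinite ⊤⁺    eq = eq
    infinite [ p ] eq = contradiction (subst ([ p ℚ.+ 1ℚ ] ≤ℚ_) eq (unbounded (p ℚ.+ 1ℚ)))
      (<ℚ⇒≱ [ <-by 1ℚ (ℚ.positive⁻¹ 1ℚ) refl ])

  module _ {u : ℕ → Carrier} {b : ℕ → ℚ ⁺}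
    (close : ∀ i k → b i ≤ℚ valℚ (u (k ℕ.+ i) - u i)) where

    close-≤ : ∀ {i k} → i ℕ.≤ k → b i ≤ℚ valℚ (u k - u i)
    close-≤ {i} {k} i≤k = subst (λ m → b i ≤ℚ valℚ (u m - u i)) (ℕ.m∸n+n≡m i≤k) (close i (k ℕ.∸ i))

    cauchy : (∀ q → ∃ λ i → [ q ] ≤ℚ b i) → Cauchy u
    cauchy unbounded N = let M , N≤b = unbounded (ℤ→ℚ N) in
      M , λ i j M≤i M≤j → map-cancel [ N ] (val (u i - u j)) (≤ℚ-trans N≤b
        (≤ℚ-trans (≤valℚ-sub (close-≤ M≤i) (close-≤ M≤j))
          (≤ℚ-reflexive (valℚ-cong (through (u i) (u j) (u M))))))

    limit-close : ∀ {l} → ConvergesTo u l → ∀ i → b i ≤ℚ valℚ (l - u i)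
    limit-close {l} u→l i = finite (val (l - u i)) refl
      where
      finite : ∀ v → val (l - u i) ≡ v → b i ≤ℚ valℚ (l - u i)
      finite ⊤⁺    eq = subst (λ v → b i ≤ℚ Maybe.map ℤ→ℚ v) (sym eq) (b i ≤⊤⁺)
      finite [ m ] eq =
        let M , near = u→l (m ℤ.+ + 1)
            k = M ℕ.+ i
        in ≤ℚ-trans (close i M) (≤ℚ-trans (≤ℚ-reflexive (valℚ-cong (chain (u k) l (u i))))
          (dominated {l - u i} {u k - l} (strictly (cong (Maybe.map ℤ→ℚ) eq) (map-mono (near k (ℕ.m≤m+n M i))))))
        where
        strictly : ∀ {v w} → v ≡ [ ℤ→ℚ m ] → [ ℤ→ℚ (m ℤ.+ + 1) ] ≤ℚ w → v <ℚ w
        strictly refl le = <-≤ℚ-trans (<-by 1ℚ (ℚ.positive⁻¹ 1ℚ) (ℤ→ℚ-+ m (+ 1))) le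

-- Convergence of the iteration and divisibility of P by the limit

module NewtonLimit {c ℓ} (K : CompleteDiscreteValuationField c ℓ) (λ₀ : ℚ)
  (w : Filtration.Weight K λ₀) (w-antitone : Filtration.Antitone K λ₀ w) (0≤w : ∀ j → [ 0ℚ ] ≤ℚ w j)
  (P : Polynomials.Poly K) (d : ℕ) (e : ℚ)
  (leading : Polynomials.valℚ K (Polynomials.coeff K P d) ≡ [ Filtration.line K λ₀ e d ])
  (κ : ℚ) (0<κ : 0ℚ ℚ.< κ)
  (A₀-bounded : NewtonStep.𝕄 K λ₀ w w-antitone 0≤w P d e leading 0ℚ (Polynomials.Iteration.A K P d 0))
  (tail-bounded : NewtonStep.𝕄 K λ₀ w w-antitone 0≤w P d e leading κ
    (Polynomials._-ₚ_ K P (Polynomials.Iteration.A K P d 0)))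
  where
  open Polynomials K
  open Filtration K λ₀
  open NewtonStep K λ₀ w w-antitone 0≤w P d e leading
  open Iteration P d
  open CompleteDiscreteValuationField K hiding (refl; sym; trans)
  open PolynomialRing K
  open Valuation K
  open Euclid K
  open Limits K
  open RingIdentities polynomialRing using (perturbed-division; division-difference; difference-add)
  open RingIdentities commutativeRing using (advance)
  open AbelianGroupProperties +-abelianGroup using (x∙y⁻¹≈ε⇒x≈y)
  private
    module ≈ = CommutativeRing commutativeRing

  gain : ℕ → ℚ
  gain i = ℕ→ℚ (2 ℕ.^ i) ℚ.* κ

  0≤gain : ∀ i → 0ℚ ℚ.≤ gain i
  0≤gain i = 0≤-* (0≤ℕ→ℚ (2 ℕ.^ i)) (ℚ.<⇒≤ 0<κ)

  invariant : ∀ i → Invariant (gain i) i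
  invariant zero    = subst (λ b → Invariant b 0) (sym (ℚ.*-identityˡ κ))
    (initial (ℚ.<⇒≤ 0<κ) A₀-bounded tail-bounded)
  invariant (suc i) = subst (λ b → Invariant b (suc i)) (sym (pow-suc κ i))
    (proj₁ (step (0≤gain i) (invariant i)))

  correction-bounded : ∀ i → 𝕄 (gain i) (correction i)
  correction-bounded i = proj₂ (step (0≤gain i) (invariant i))

  β : ℕ → ℕ → ℚ ⁺
  β j i = w j +ℚ [ line (e ℚ.+ gain i) j ]

  β-mono : ∀ j {i k} → i ℕ.≤ k → β j i ≤ℚ β j k
  β-mono j {i} {k} i≤k = +ℚ-mono ≤ℚ-refl
    [ line-mono j (ℚ.+-monoʳ-≤ e (pow-mono {κ} {i} {k} (ℚ.<⇒≤ 0<κ) i≤k)) ]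

  β-unbounded : ∀ j q → ∃ λ i → [ q ] ≤ℚ β j i
  β-unbounded j q = let i , le = pow-above (q ℚ.- (e ℚ.+ λ₀ ℚ.* ℕ→ℚ j)) 0<κ in
    i , ≤ℚ-trans (≤ℚ-reflexive (sym (+ℚ-identityˡ [ q ])))
      (+ℚ-mono {[ 0ℚ ]} {w j} {[ q ]} (0≤w j) [ ≤-by _ (p≤q⇒0≤q-p le) (eq e (λ₀ ℚ.* ℕ→ℚ j) (gain i)) ])
    where
    eq : ∀ e l g → e ℚ.+ g ℚ.+ l ≡ q ℚ.+ (g ℚ.- (q ℚ.- (e ℚ.+ l)))
    eq e l g = solve (e ∷ l ∷ g ∷ q ∷ []) ℚ-ring

  close : ∀ j i k → β j i ≤ℚ valℚ (coeff (A (k ℕ.+ i)) j - coeff (A i) j)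
  close j i zero    = ≤valℚ-0 (-‿inverseʳ _)
  close j i (suc k) = ≤ℚ-trans (≤valℚ-+ (close j i k) (≤ℚ-trans (β-mono j (ℕ.m≤n+m i k)) (bound (correction-bounded m) j)))
    (≤ℚ-reflexive (valℚ-cong (≈.trans (advance (coeff (A m) j) (coeff (A i) j) (coeff (correction m) j))
      (+-congʳ (≈.sym (coeff-+ (A m) (correction m) j))))))
    where
    m : ℕ
    m = k ℕ.+ i

  module _ {L : Poly} (L-degree : HasDegree L d) (L-leading : coeff L d ≈ coeff P d)
    (L-close : ∀ i → 𝕄 (gain i) (L -ₚ A i)) where

    private
      Q R : Poly
      Q = P div L
      R = P mod L

      P≋ : P ≋ Q *ₚ L +ₚ R
      P≋ = proj₁ (euclidean-division P L L-degree)

      R-degree : DegreeBelow R d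
      R-degree = proj₂ (euclidean-division P L L-degree)

      L-bounded : Bounded w e L
      L-bounded = Bounded-cong (≋-sym (difference-add L (A 0)))
        (Bounded-+ (Bounded-weaken (≤-by (gain 0) (0≤gain 0) refl) (L-close 0))
                   (Bounded-cast (ℚ.+-identityʳ e) A₀-bounded))

      open Division {L} {d} {e} (Bounded-forget 0≤w L-bounded) (proj₂ L-degree)
        (trans (valℚ-cong L-leading) leading)

      R-bounded : ∀ i → 𝕄 (gain i) R
      R-bounded i = remainder-bounded D {Z} {R} w-antitone L-bounded Z≋
        (quotient-bounded D {Z} {R} Z≋ R-degree (𝕄⇒ℝ bZ)) bZ
        where
        open Invariant (invariant i)
        D Z : Poly
        D = Q -ₚ B i
        -- Replacing `A i` by L in the division of P costs `B i` times the error L - `A i`, which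
        -- gains as much as the remainder.
        Z = P mod A i -ₚ B i *ₚ (L -ₚ A i)
        Z≋ : Z ≋ D *ₚ L +ₚ R
        Z≋ = division-difference {P} {L} {B i} {Z} {Q} {R}
          (perturbed-division {P} {A i} {B i} {P mod A i} L
            (proj₁ (euclidean-division P (A i) (degree i)))) P≋
        bZ : 𝕄 (gain i) Z
        bZ = Bounded-sub mod-bounded (Bounded-cast (ℚ.+-identityˡ (e ℚ.+ gain i))
          (Bounded-* (B i) w-antitone B-bounded (L-close i)))

      R≈0 : ∀ j → coeff R j ≈ 0#
      R≈0 j = unbounded⇒0 λ q → let i , q≤ = β-unbounded j q in ≤ℚ-trans q≤ (bound (R-bounded i) j)

    -- P is congruent modulo L to an element of 𝕄 (gain i), for every i, so that
    -- its remainder vanishes.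
    limit-divides : L ∣ₚ P
    limit-divides = Q , λ j → ≈.trans (≈.sym (≈.trans (coeff-+ (Q *ₚ L) R j)
      (≈.trans (+-congˡ (R≈0 j)) (+-identityʳ _)))) (≈.sym (at P≋ j))

  -- The limits are obtained coefficient by coefficient for all j; cutting at degree d makes a list
  -- of them, and above d all the `A i` vanish anyway.
  truncation : (ℕ → Carrier) → Poly
  truncation l = applyUpTo l (suc d)

  module _ {l : ℕ → Carrier} (A→l : ∀ j → ConvergesTo (λ i → coeff (A i) j) (l j)) where

    truncation-above : DegreeBelow (truncation l) (suc d)
    truncation-above j d<j = ≈.reflexive (coeff-applyUpTo-above l (suc d) j d<j)

    truncation-limit : ConvergesCoefficientwise A (truncation l)
    truncation-limit j = cases (j ℕ.≤? d)
      where
      cases : Dec (j ℕ.≤ d) → ConvergesTo (λ i → coeff (A i) j) (coeff (truncation l) j)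
      cases (yes j≤d) = subst (ConvergesTo (λ i → coeff (A i) j))
        (sym (coeff-applyUpTo l (suc d) j (s≤s j≤d))) (A→l j)
      cases (no j≰d) N = 0 , λ i _ → map-cancel [ N ] (val (coeff (A i) j - coeff (truncation l) j)) (≤valℚ-0
        (≈.trans (+-cong (proj₂ (degree i) j (ℕ.≰⇒> j≰d)) (-‿cong (truncation-above j (ℕ.≰⇒> j≰d))))
          (-‿inverseʳ 0#)))

  module _ {L : Poly} (A→L : ConvergesCoefficientwise A L) where

    limit-bounded : ∀ i → 𝕄 (gain i) (L -ₚ A i)
    limit-bounded i = bounded λ j → ≤ℚ-trans (limit-close (close j) (A→L j) i)
      (≤ℚ-reflexive (valℚ-cong (≈.sym (≈.trans (coeff-+ L (map -_ (A i)) j) (+-congˡ (coeff-neg (A i) j))))))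

    limit-leading : coeff L d ≈ coeff P d
    limit-leading = x∙y⁻¹≈ε⇒x≈y _ _ (unbounded⇒0 λ q →
      let i , q≤ = β-unbounded d q in ≤ℚ-trans q≤ (≤ℚ-trans (limit-close (close d) (A→L d) i)
        (≤ℚ-reflexive (valℚ-cong (+-congˡ (-‿cong (proj₂ (iterate-degree P d a_d≉0 i))))))))

  limit-exists : ∃ λ L → ConvergesCoefficientwise A L × L ∣ₚ P × HasDegree L d × coeff L d ≈ coeff P d
  limit-exists = package (truncation (λ j → proj₁ (limit j))) (truncation-above (λ j → proj₂ (limit j)))
    (truncation-limit (λ j → proj₂ (limit j)))
    where
    limit : ∀ j → ∃ λ l → ConvergesTo (λ i → coeff (A i) j) l
    limit j = complete (λ i → coeff (A i) j) (cauchy (close j) (β-unbounded j))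
    package : ∀ L → DegreeBelow L (suc d) → ConvergesCoefficientwise A L →
      ∃ λ L → ConvergesCoefficientwise A L × L ∣ₚ P × HasDegree L d × coeff L d ≈ coeff P d
    package L above A→L = L , A→L , limit-divides {L} L-degree L-leading (limit-bounded {L} A→L) , L-degree , L-leading
      where
      L-leading : coeff L d ≈ coeff P d
      L-leading = limit-leading {L} A→L
      L-degree : HasDegree L d
      L-degree = (λ L≈0 → a_d≉0 (≈.trans (≈.sym L-leading) L≈0)) , above

-- The slope gap

module SlopeGap where
  open import Data.Rational.Base using (_+_; _*_; _-_; -_; _≤_; _<_)

  extend-inside : ∀ n {x} f → x ∈[0, n ] → extendBy∞ n f x ≡ f x
  extend-inside n {x} f x∈ = cong (λ b → if b then f x else ⊤⁺)
    (dec-true ((0ℚ ℚ.≤? x) ×-dec (x ℚ.≤? ℕ→ℚ n)) x∈)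

  extend-outside : ∀ n {x} f → ¬ x ∈[0, n ] → extendBy∞ n f x ≡ ⊤⁺
  extend-outside n {x} f x∉ = cong (λ b → if b then f x else ⊤⁺)
    (dec-false ((0ℚ ℚ.≤? x) ×-dec (x ℚ.≤? ℕ→ℚ n)) x∉)

  gapAt : ℚ → ℚ ⁺ → ℚ ⁺ → ℚ ⁺
  gapAt v right left = (right +ℚ left) -ℚ ℕ→ℚ 2 ·ℚ [ v ]

  double : ∀ v → ℕ→ℚ 2 * v ≡ v + v
  double v = trans (ℚ.*-distribʳ-+ v 1ℚ 1ℚ) (cong₂ _+_ (ℚ.*-identityˡ v) (ℚ.*-identityˡ v))

  -- If the left value p is finite, λ₀ is the left slope v - p. If it is infinite, which happens for
  -- d = 0 or when P has no nonzero coefficient below d, then λ₀ lies κ below the right slope; with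
  -- no right side either, 0 will do.
  split-gap : ∀ {κ v} right left → [ κ ] ≤ℚ gapAt v right left →
    ∃ λ λ₀ → [ v ] ≤ℚ (left +ℚ [ λ₀ ]) × [ v + (λ₀ + κ) ] ≤ℚ right
  split-gap {κ} {v} ⊤⁺    ⊤⁺    _ = 0ℚ , (_ ≤⊤⁺) , (_ ≤⊤⁺)
  split-gap {κ} {v} [ q ] ⊤⁺    _ = q - v - κ , (_ ≤⊤⁺) , ≤ℚ-reflexive (cong (λ r → [ r ]) eq)
    where
    eq : v + (q - v - κ + κ) ≡ q
    eq = solve (v ∷ q ∷ κ ∷ []) ℚ-ring
  split-gap {κ} {v} right [ p ] gap = v - p , ≤ℚ-reflexive (cong (λ r → [ r ]) eq) , bound right gap
    where
    eq : v ≡ p + (v - p)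
    eq = solve (v ∷ p ∷ []) ℚ-ring
    bound : ∀ right → [ κ ] ≤ℚ gapAt v right [ p ] → [ v + (v - p + κ) ] ≤ℚ right
    bound ⊤⁺    _      = _ ≤⊤⁺
    bound [ q ] [ le ] = [ ≤-by _ (p≤q⇒0≤q-p le) (trans rearrange
        (cong (λ t → v + (v - p + κ) + (q + p - t - κ)) (sym (double v)))) ]
      where
      rearrange : q ≡ v + (v - p + κ) + (q + p - (v + v) - κ)
      rearrange = solve (q ∷ v ∷ p ∷ κ ∷ []) ℚ-ring

  gap-positive : ∀ v right left → (∀ {p q} → left ≡ [ p ] → right ≡ [ q ] → v + v < q + p) →
    [ 0ℚ ] <ℚ gapAt v right left
  gap-positive v ⊤⁺    left  _ = [ 0ℚ ]<⊤⁺
  gap-positive v [ q ] ⊤⁺    _ = [ 0ℚ ]<⊤⁺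
  gap-positive v [ q ] [ p ] strict =
    [ subst (λ t → 0ℚ < q + p - t) (sym (double v)) (p<q⇒0<q-p (strict refl refl)) ]

open SlopeGap

-- From the Newton function of P to bounds on the iteration

module SlopeFactorization {c ℓ} (K : CompleteDiscreteValuationField c ℓ)
  (P : Polynomials.Poly K) (n : ℕ) (P-degree : Polynomials.HasDegree K P n)
  (NFP : ℚ → ℚ ⁺) (isNF : Polynomials.IsNewtonFunction K P n NFP)
  (d : ℕ) (d≤n : d ℕ.≤ n)
  (v : ℤ) (val-d : CompleteDiscreteValuationField.val K (Polynomials.coeff K P d) ≡ [ v ])
  (extremal : IsExtremalPoint (Epigraph n NFP) (ℕ→ℚ d , ℤ→ℚ v))
  where
  open CompleteDiscreteValuationField K hiding (refl; sym; trans)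
  open Polynomials K
  open PolynomialRing K
  open Valuation K
  open Euclid K
  open Limits K
  open Iteration P d
  private
    module ≈ = CommutativeRing commutativeRing

  convex : ConvexOn n NFP
  convex = proj₁ isNF

  below : Below P n NFP
  below = proj₁ (proj₂ isNF)

  open NewtonFunction {λ i → valℚ (coeff P i)} {n} {NFP} convex below (proj₂ (proj₂ isNF))
    using (convex-restrict; greatest-restrict)
  open Slopes {n} {NFP} convex

  φ : ℕ → ℚ ⁺
  φ j = NFP (ℕ→ℚ j)

  V₀ : ℚ
  V₀ = ℤ→ℚ v

  φ-d : φ d ≡ [ V₀ ]
  φ-d = value-at-extremal extremal

  valℚ-d : valℚ (coeff P d) ≡ [ V₀ ]
  valℚ-d = cong (Maybe.map ℤ→ℚ) val-d

  a_d≉0 : ¬ coeff P d ≈ 0#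
  a_d≉0 a_d≈0 = contradiction (trans (sym valℚ-d) (valℚ-0 a_d≈0)) λ ()

  left right : ℚ ⁺
  left  = extendBy∞ n NFP (ℕ→ℚ d ℚ.- 1ℚ)
  right = extendBy∞ n NFP (ℕ→ℚ d ℚ.+ 1ℚ)

  κ : ℚ ⁺
  κ = slopeGap n NFP d

  κ≡ : κ ≡ gapAt V₀ right left
  κ≡ = cong (λ u → (right +ℚ left) -ℚ ℕ→ℚ 2 ·ℚ u)
    (trans (extend-inside n NFP (ℕ∈[0,] {d} {n} d≤n)) φ-d)

  pred-suc : ∀ e → ℕ→ℚ (suc e) ℚ.- 1ℚ ≡ ℕ→ℚ e
  pred-suc e = trans (cong (ℚ._- 1ℚ) (ℕ→ℚ-suc e)) (cancel (ℕ→ℚ e))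
    where
    cancel : ∀ x → x ℚ.+ 1ℚ ℚ.- 1ℚ ≡ x
    cancel x = solve (x ∷ []) ℚ-ring

  left-suc : ∀ {e} → d ≡ suc e → left ≡ φ e
  left-suc {e} d≡ = trans
    (cong (extendBy∞ n NFP) (trans (cong (λ k → ℕ→ℚ k ℚ.- 1ℚ) d≡) (pred-suc e)))
    (extend-inside n NFP (ℕ∈[0,] {e} {n} (ℕ.≤-trans (ℕ.n≤1+n e) (subst (ℕ._≤ n) d≡ d≤n))))

  left-zero : d ≡ 0 → left ≡ ⊤⁺
  left-zero d≡ = extend-outside n NFP λ x∈ →
    <ℚ⇒≱ [ ℚ.negative⁻¹ (ℚ.- 1ℚ) ] [ subst (λ k → 0ℚ ℚ.≤ ℕ→ℚ k ℚ.- 1ℚ) d≡ (proj₁ x∈) ]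

  right-inside : suc d ℕ.≤ n → right ≡ φ (suc d)
  right-inside d<n = trans (cong (extendBy∞ n NFP) (sym (ℕ→ℚ-suc d)))
    (extend-inside n NFP (ℕ∈[0,] {suc d} {n} d<n))

  right-outside : ¬ suc d ℕ.≤ n → right ≡ ⊤⁺
  right-outside d≮n = extend-outside n NFP λ x∈ →
    d≮n (ℕ→ℚ-cancel {suc d} {n} (subst (ℚ._≤ ℕ→ℚ n) (sym (ℕ→ℚ-suc d)) (proj₂ x∈)))

  κ-positive : [ 0ℚ ] <ℚ κ
  κ-positive = subst ([ 0ℚ ] <ℚ_) (sym κ≡) (gap-positive V₀ right left (strict d refl (suc d ℕ.≤? n)))
    where
    strict : ∀ k → d ≡ k → Dec (suc d ℕ.≤ n) → ∀ {p q} → left ≡ [ p ] → right ≡ [ q ] →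
      V₀ ℚ.+ V₀ ℚ.< q ℚ.+ p
    strict zero    d≡ _         l r = contradiction (trans (sym l) (left-zero d≡)) λ ()
    strict (suc e) d≡ (no d≮n)  l r = contradiction (trans (sym r) (right-outside d≮n)) λ ()
    strict (suc e) d≡ (yes d<n) l r = extremal⇒strict {e}
      (subst (λ k → suc k ℕ.≤ n) d≡ d<n)
      (subst (λ k → IsExtremalPoint (Epigraph n NFP) (ℕ→ℚ k , V₀)) d≡ extremal)
      (trans (sym (left-suc d≡)) l)
      (trans (cong (λ k → φ (suc k)) (sym d≡)) (trans (sym (right-inside d<n)) r))

  -- `left-slope` makes the weight decrease, and `right-slope` gives P - A₀ its gain κ₀. Where d has
  -- no neighbour, the corresponding condition is void.
  record Slack (κ₀ : ℚ) : Set where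
    field
      λ₀          : ℚ
      left-slope  : ∀ i → i ℕ.< d → φ (suc i) ≤ℚ (φ i +ℚ [ λ₀ ])
      right-slope : suc d ℕ.≤ n → [ V₀ ℚ.+ (λ₀ ℚ.+ κ₀) ] ≤ℚ φ (suc d)

  slack : ∀ {κ₀} → [ κ₀ ] ≤ℚ κ → Slack κ₀
  slack {κ₀} le =
    let λ₀ , v≤left , ≤right = split-gap right left (subst ([ κ₀ ] ≤ℚ_) κ≡ le) in record
      { λ₀          = λ₀
      ; left-slope  = below-d λ₀ v≤left d refl
      ; right-slope = λ d<n → subst ([ V₀ ℚ.+ (λ₀ ℚ.+ κ₀) ] ≤ℚ_) (right-inside d<n) ≤right
      }
    where
    below-d : ∀ λ₀ → [ V₀ ] ≤ℚ (left +ℚ [ λ₀ ]) → ∀ k → d ≡ k → ∀ i → i ℕ.< d →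
      φ (suc i) ≤ℚ (φ i +ℚ [ λ₀ ])
    below-d λ₀ v≤ zero    d≡ i i<d = contradiction (subst (i ℕ.<_) d≡ i<d) λ ()
    below-d λ₀ v≤ (suc e) d≡ i i<d = slopes-left {e} {V₀} {λ₀} (subst (ℕ._≤ n) d≡ d≤n)
      (trans (cong φ (sym d≡)) φ-d) (subst (λ u → [ V₀ ] ≤ℚ (u +ℚ [ λ₀ ])) (left-suc d≡) v≤)
      i (ℕ.s≤s⁻¹ (subst (i ℕ.<_) d≡ i<d))

  module Approximation {κ₀ : ℚ} (0<κ₀ : 0ℚ ℚ.< κ₀) (s : Slack κ₀) where
    open Slack s
    open Filtration K λ₀

    -- The intercept for which `line e` passes through the vertex at d.
    e : ℚ
    e = V₀ ℚ.- λ₀ ℚ.* ℕ→ℚ d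

    line-d : ∀ b → line (e ℚ.+ b) d ≡ V₀ ℚ.+ b
    line-d b = cancel V₀ (λ₀ ℚ.* ℕ→ℚ d) b
      where
      cancel : ∀ v l b → v ℚ.- l ℚ.+ b ℚ.+ l ≡ v ℚ.+ b
      cancel v l b = solve (v ∷ l ∷ b ∷ []) ℚ-ring

    leading : valℚ (coeff P d) ≡ [ line e d ]
    leading = trans valℚ-d (cong (λ q → [ q ]) (sym (cancel V₀ (λ₀ ℚ.* ℕ→ℚ d))))
      where
      cancel : ∀ v l → v ℚ.- l ℚ.+ l ≡ v
      cancel v l = solve (v ∷ l ∷ []) ℚ-ring

    -- NF(P) minus the line of slope λ₀ through its vertex at d, extended by zero
    -- to the right of d.
    weight : ∀ j → Dec (j ℕ.< d) → ℚ ⁺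
    weight j (yes _) = φ j +ℚ [ ℚ.- line e j ]
    weight j (no _)  = [ 0ℚ ]

    w : Weight
    w j = weight j (j ℕ.<? d)

    weight-line : ∀ x b j → (x +ℚ [ ℚ.- line e j ]) +ℚ [ line (e ℚ.+ b) j ] ≡ x +ℚ [ b ]
    weight-line ⊤⁺    b j = refl
    weight-line [ x ] b j = cong (λ q → [ q ]) (cancel e x b (λ₀ ℚ.* ℕ→ℚ j))
      where
      cancel : ∀ e x b l → x ℚ.+ ℚ.- (e ℚ.+ l) ℚ.+ (e ℚ.+ b ℚ.+ l) ≡ x ℚ.+ b
      cancel e x b l = solve (e ∷ x ∷ b ∷ l ∷ []) ℚ-ring

    weight-below : ∀ {j} b → j ℕ.< d → w j +ℚ [ line (e ℚ.+ b) j ] ≡ φ j +ℚ [ b ]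
    weight-below {j} b j<d = cases (j ℕ.<? d)
      where
      cases : ∀ dec → weight j dec +ℚ [ line (e ℚ.+ b) j ] ≡ φ j +ℚ [ b ]
      cases (yes _)   = weight-line (φ j) b j
      cases (no j≮d) = contradiction j<d j≮d

    weight-above : ∀ {j} → ¬ j ℕ.< d → w j ≡ [ 0ℚ ]
    weight-above {j} j≮d = cases (j ℕ.<? d)
      where
      cases : ∀ dec → weight j dec ≡ [ 0ℚ ]
      cases (yes j<d) = contradiction j<d j≮d
      cases (no _)    = refl

    w-antitone : Antitone w
    w-antitone j = cases (suc j ℕ.<? d) (j ℕ.<? d)
      where
      step-line : ℚ.- line e (suc j) ≡ ℚ.- λ₀ ℚ.+ ℚ.- line e j
      step-line = trans (cong ℚ.-_ (line-suc e j)) (negate e (λ₀ ℚ.* ℕ→ℚ j) λ₀)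
        where
        negate : ∀ e l m → ℚ.- (e ℚ.+ m ℚ.+ l) ≡ ℚ.- m ℚ.+ ℚ.- (e ℚ.+ l)
        negate e l m = solve (e ∷ l ∷ m ∷ []) ℚ-ring
      descend : ∀ {x y} → x ≤ℚ (y +ℚ [ λ₀ ]) →
        (x +ℚ [ ℚ.- line e (suc j) ]) ≤ℚ (y +ℚ [ ℚ.- line e j ])
      descend {x} {y} le = ≤ℚ-trans (+ℚ-mono le ≤ℚ-refl) (≤ℚ-reflexive (absorb y))
        where
        absorb : ∀ y → (y +ℚ [ λ₀ ]) +ℚ [ ℚ.- line e (suc j) ] ≡ y +ℚ [ ℚ.- line e j ]
        absorb ⊤⁺    = refl
        absorb [ y ] = cong (λ q → [ q ]) (trans (cong (y ℚ.+ λ₀ ℚ.+_) step-line) (cancel y λ₀ (line e j)))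
          where
          cancel : ∀ y m l → y ℚ.+ m ℚ.+ (ℚ.- m ℚ.+ ℚ.- l) ≡ y ℚ.+ ℚ.- l
          cancel y m l = solve (y ∷ m ∷ l ∷ []) ℚ-ring
      cases : ∀ dec dec′ → weight (suc j) dec ≤ℚ weight j dec′
      cases (yes _)     (yes j<d) = descend (left-slope j j<d)
      cases (yes 1+j<d) (no j≮d)  = contradiction (ℕ.<-trans (ℕ.n<1+n j) 1+j<d) j≮d
      -- At the junction j + 1 = d, the formula used below d gives 0 as well, because `line e` meets
      -- φ there.
      cases (no 1+j≮d)  (yes j<d) = ≤ℚ-trans (≤ℚ-reflexive vanish) (descend (left-slope j j<d))
        where
        1+j≡d : suc j ≡ d
        1+j≡d = ℕ.≤-antisym j<d (ℕ.≮⇒≥ 1+j≮d)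
        vanish : [ 0ℚ ] ≡ φ (suc j) +ℚ [ ℚ.- line e (suc j) ]
        vanish = trans (cong (λ q → [ q ]) (cancel V₀ (λ₀ ℚ.* ℕ→ℚ d)))
          (trans (cong (_+ℚ [ ℚ.- line e d ]) (sym φ-d)) (cong (λ k → φ k +ℚ [ ℚ.- line e k ]) (sym 1+j≡d)))
          where
          cancel : ∀ v l → 0ℚ ≡ v ℚ.+ ℚ.- (v ℚ.- l ℚ.+ l)
          cancel v l = solve (v ∷ l ∷ []) ℚ-ring
      cases (no _)      (no _)    = ≤ℚ-refl

    -- A decreasing weight that vanishes from d on: w j ≥ w (d + j) = 0.
    0≤w : ∀ j → [ 0ℚ ] ≤ℚ w j
    0≤w j = ≤ℚ-trans (≤ℚ-reflexive (sym (weight-above (ℕ.≤⇒≯ (ℕ.m≤m+n d j))))) (descend d)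
      where
      descend : ∀ k → w (k ℕ.+ j) ≤ℚ w j
      descend zero    = ≤ℚ-refl
      descend (suc k) = ≤ℚ-trans (w-antitone (k ℕ.+ j)) (descend k)

    open NewtonStep K λ₀ w w-antitone 0≤w P d e leading using (𝕄)

    A₀-bounded : 𝕄 0ℚ (A 0)
    A₀-bounded = bounded λ j → cases j (ℕ.<-cmp j d)
      where
      cases : ∀ j → _ → (w j +ℚ [ line (e ℚ.+ 0ℚ) j ]) ≤ℚ valℚ (coeff (A 0) j)
      cases j (tri< j<d _ _) = ≤ℚ-trans
        (≤ℚ-reflexive (trans (weight-below 0ℚ j<d) (+ℚ-identityʳ (φ j))))
        (≤ℚ-trans (below j (ℕ.≤-trans (ℕ.<⇒≤ j<d) d≤n))
          (≤ℚ-reflexive (valℚ-cong (≈.reflexive (sym (coeff-applyUpTo (coeff P) (suc d) j (ℕ.m<n⇒m<1+n j<d)))))))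
      cases j (tri≈ _ refl _) = ≤ℚ-reflexive (trans
        (cong (_+ℚ [ line (e ℚ.+ 0ℚ) d ]) (weight-above (ℕ.<-irrefl refl)))
        (trans (cong (λ q → [ q ]) (trans (ℚ.+-identityˡ _) (trans (line-d 0ℚ) (ℚ.+-identityʳ V₀))))
          (trans (sym valℚ-d) (valℚ-cong (≈.sym (proj₂ (iterate-degree P d a_d≉0 0)))))))
      cases j (tri> _ _ d<j) = ≤valℚ-0 (proj₂ (proj₁ (iterate-degree P d a_d≉0 0)) j d<j)

    tail-bounded : 𝕄 κ₀ (P -ₚ A 0)
    tail-bounded = bounded λ j → cases j (j ℕ.≤? d)
      where
      coeff-tail : ∀ j → coeff (P -ₚ A 0) j ≈ coeff P j - coeff (A 0) j
      coeff-tail j = ≈.trans (coeff-+ P (map -_ (A 0)) j) (+-congˡ (coeff-neg (A 0) j))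
      beyond : ∀ i → suc (d ℕ.+ i) ℕ.≤ n →
        [ line (e ℚ.+ κ₀) (suc (d ℕ.+ i)) ] ≤ℚ valℚ (coeff P (suc (d ℕ.+ i)))
      -- Each step beyond d gains κ₀ over the line. After i + 1 steps only one κ₀ is needed, and i
      -- κ₀ is left over.
      beyond i k≤n = ≤ℚ-trans [ ≤-by _ (0≤-* (0≤ℕ→ℚ i) (ℚ.<⇒≤ 0<κ₀)) eq ]
        (≤ℚ-trans (slopes-right {d} {V₀} {λ₀ ℚ.+ κ₀} φ-d
            (right-slope (ℕ.≤-trans (s≤s (ℕ.m≤m+n d i)) k≤n)) i k≤n)
          (below (suc (d ℕ.+ i)) k≤n))
        where
        expand : ∀ v l k D I → v ℚ.+ (I ℚ.+ 1ℚ) ℚ.* (l ℚ.+ k) ≡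
          v ℚ.- l ℚ.* D ℚ.+ k ℚ.+ l ℚ.* (D ℚ.+ I ℚ.+ 1ℚ) ℚ.+ I ℚ.* k
        expand v l k D I = solve (v ∷ l ∷ k ∷ D ∷ I ∷ []) ℚ-ring
        eq : V₀ ℚ.+ (ℕ→ℚ i ℚ.+ 1ℚ) ℚ.* (λ₀ ℚ.+ κ₀) ≡ line (e ℚ.+ κ₀) (suc (d ℕ.+ i)) ℚ.+ ℕ→ℚ i ℚ.* κ₀
        eq = trans (expand V₀ λ₀ κ₀ (ℕ→ℚ d) (ℕ→ℚ i))
          (cong (λ D → e ℚ.+ κ₀ ℚ.+ λ₀ ℚ.* D ℚ.+ ℕ→ℚ i ℚ.* κ₀)
            (sym (trans (ℕ→ℚ-suc (d ℕ.+ i)) (cong (ℚ._+ 1ℚ) (ℕ→ℚ-+ d i)))))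
      above : ∀ i → Dec (suc (d ℕ.+ i) ℕ.≤ n) →
        [ line (e ℚ.+ κ₀) (suc (d ℕ.+ i)) ] ≤ℚ valℚ (coeff P (suc (d ℕ.+ i)))
      above i (yes k≤n) = beyond i k≤n
      above i (no k≰n)  = ≤valℚ-0 (proj₂ P-degree _ (ℕ.≰⇒> k≰n))
      cases : ∀ j → Dec (j ℕ.≤ d) → (w j +ℚ [ line (e ℚ.+ κ₀) j ]) ≤ℚ valℚ (coeff (P -ₚ A 0) j)
      cases j (yes j≤d) = ≤valℚ-0 (≈.trans (coeff-tail j) (≈.trans
        (+-congˡ (-‿cong (≈.reflexive (coeff-applyUpTo (coeff P) (suc d) j (s≤s j≤d)))))
        (-‿inverseʳ (coeff P j))))
      cases j (no j≰d) = ≤ℚ-trans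
        (≤ℚ-reflexive (trans (cong (_+ℚ [ line (e ℚ.+ κ₀) j ]) (weight-above λ j<d → j≰d (ℕ.<⇒≤ j<d)))
          (cong (λ q → [ q ]) (ℚ.+-identityˡ _))))
        (≤ℚ-trans (subst (λ k → [ line (e ℚ.+ κ₀) k ] ≤ℚ valℚ (coeff P k)) (ℕ.m+[n∸m]≡n (ℕ.≰⇒> j≰d))
            (above (j ℕ.∸ suc d) (suc (d ℕ.+ (j ℕ.∸ suc d)) ℕ.≤? n)))
          (≤ℚ-reflexive (valℚ-cong (≈.sym (≈.trans (coeff-tail j) (≈.trans
            (+-congˡ (≈.trans (-‿cong (proj₂ (proj₁ (iterate-degree P d a_d≉0 0)) j (ℕ.≰⇒> j≰d))) -0#≈0#))
            (+-identityʳ _)))))))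
        where open RingProperties ring using (-0#≈0#)

    open NewtonLimit K λ₀ w w-antitone 0≤w P d e leading κ₀ 0<κ₀ A₀-bounded tail-bounded public
      using (limit-exists; limit-bounded; gain)

    limit-accuracy : ∀ {L} → ConvergesCoefficientwise A L → ∀ i j → j ℕ.< d →
      (φ j +ℚ [ gain i ]) ≤ℚ valℚ (coeff (L -ₚ A i) j)
    limit-accuracy {L} A→L i j j<d = ≤ℚ-trans (≤ℚ-reflexive (sym (weight-below (gain i) j<d)))
      (bound (limit-bounded {L} A→L i) j)

  -- The limit L is arbitrary, not the one built from a given κ₀, so that the estimates for
  -- different κ₀ concern the same polynomial.
  module _ {L : Poly} (A→L : ConvergesCoefficientwise A L) (L-leading : coeff L d ≈ coeff P d) where

    limit-error : ∀ j i → coeff (L -ₚ A i) j ≈ coeff L j - coeff (A i) j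
    limit-error j i = ≈.trans (coeff-+ L (map -_ (A i)) j) (+-congˡ (coeff-neg (A i) j))

    error-degree : DegreeBelow L (suc d) → ∀ i → DegreeBelow (L -ₚ A i) d
    error-degree L-above i j d≤j = ≈.trans (limit-error j i) (vanish (ℕ.m≤n⇒m<n∨m≡n d≤j))
      where
      A-degree : HasDegree (A i) d × coeff (A i) d ≈ coeff P d
      A-degree = iterate-degree P d a_d≉0 i
      vanish : d ℕ.< j ⊎ d ≡ j → coeff L j - coeff (A i) j ≈ 0#
      vanish (inj₁ d<j)  = ≈.trans
        (+-cong (L-above j d<j) (-‿cong (proj₂ (proj₁ A-degree) j d<j))) (-‿inverseʳ 0#)
      vanish (inj₂ refl) = ≈.trans
        (+-cong L-leading (-‿cong (proj₂ A-degree))) (-‿inverseʳ _)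

    -- An infinite κ is handled by applying the estimate for every finite κ₀.
    accuracy : ∀ i j → j ℕ.< d → (φ j +ℚ ℕ→ℚ (2 ℕ.^ i) ·ℚ κ) ≤ℚ valℚ (coeff (L -ₚ A i) j)
    accuracy i j j<d = cases κ refl
      where
      estimate : ∀ {κ₀} → 0ℚ ℚ.< κ₀ → [ κ₀ ] ≤ℚ κ →
        (φ j +ℚ [ ℕ→ℚ (2 ℕ.^ i) ℚ.* κ₀ ]) ≤ℚ valℚ (coeff (L -ₚ A i) j)
      estimate 0<κ₀ le = Approximation.limit-accuracy 0<κ₀ (slack le) {L} A→L i j j<d
      -- If φ j is infinite, the estimate for κ₀ = 1 already has an infinite left side. If φ j is
      -- finite, the estimates for growing κ₀ exceed every rational, so the coefficient is zero.
      infinite : κ ≡ ⊤⁺ → ∀ x → φ j ≡ x → (x +ℚ ⊤⁺) ≤ℚ valℚ (coeff (L -ₚ A i) j)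
      infinite κ≡⊤ ⊤⁺    φj = subst (λ x → (x +ℚ [ ℕ→ℚ (2 ℕ.^ i) ℚ.* 1ℚ ]) ≤ℚ valℚ (coeff (L -ₚ A i) j)) φj
        (estimate (ℚ.positive⁻¹ 1ℚ) (subst ([ 1ℚ ] ≤ℚ_) (sym κ≡⊤) (_ ≤⊤⁺)))
      infinite κ≡⊤ [ x ] φj = ≤valℚ-0 (unbounded⇒0 λ q →
        let m , q-x≤m = ℕ→ℚ-above (q ℚ.- x)
            -- The successor keeps κ₀ positive when m = 0.
            m′ = ℕ→ℚ (suc m)
        in ≤ℚ-trans
          [ reach q m′ (0≤ℕ→ℚ (suc m)) (ℚ.≤-trans q-x≤m (ℚ.<⇒≤ (i<suc-i m))) ]
          (subst (λ y → (y +ℚ [ ℕ→ℚ (2 ℕ.^ i) ℚ.* m′ ]) ≤ℚ valℚ (coeff (L -ₚ A i) j)) φj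
            (estimate (ℚ.≤-<-trans (0≤ℕ→ℚ m) (i<suc-i m)) (subst ([ m′ ] ≤ℚ_) (sym κ≡⊤) (_ ≤⊤⁺)))))
        where
        reach : ∀ q m → 0ℚ ℚ.≤ m → q ℚ.- x ℚ.≤ m → q ℚ.≤ x ℚ.+ ℕ→ℚ (2 ℕ.^ i) ℚ.* m
        reach q m 0≤m le = ≤-by _
          (0≤-+ (p≤q⇒0≤q-p le) (0≤-* (p≤q⇒0≤q-p (ℕ→ℚ-mono {1} {2 ℕ.^ i} (ℕ.m^n>0 2 i))) 0≤m))
          (eq (ℕ→ℚ (2 ℕ.^ i)))
          where
          eq : ∀ t → x ℚ.+ t ℚ.* m ≡ q ℚ.+ (m ℚ.- (q ℚ.- x) ℚ.+ (t ℚ.- 1ℚ) ℚ.* m)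
          eq t = solve (x ∷ q ∷ t ∷ m ∷ []) ℚ-ring
      cases : ∀ k → κ ≡ k → (φ j +ℚ ℕ→ℚ (2 ℕ.^ i) ·ℚ k) ≤ℚ valℚ (coeff (L -ₚ A i) j)
      cases ⊤⁺     κ≡⊤ = infinite κ≡⊤ (φ j) refl
      cases [ κ₀ ] κ≡κ₀ = estimate ([<]-injective (subst ([ 0ℚ ] <ℚ_) κ≡κ₀ κ-positive)) (≤ℚ-reflexive (sym κ≡κ₀))

    module _ {κ₀ : ℚ} (0<κ₀ : 0ℚ ℚ.< κ₀) (s : Slack κ₀) where

      close-to-P : ∀ j → j ℕ.< d → (φ j +ℚ [ κ₀ ]) ≤ℚ valℚ (coeff L j - coeff P j)
      close-to-P j j<d = ≤ℚ-trans
        (≤ℚ-reflexive (cong (λ q → φ j +ℚ [ q ]) (sym (ℚ.*-identityˡ κ₀))))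
        (≤ℚ-trans (Approximation.limit-accuracy 0<κ₀ s {L} A→L 0 j j<d)
          (≤ℚ-reflexive (valℚ-cong (≈.trans (limit-error j 0)
            (+-congˡ (-‿cong (≈.reflexive (coeff-applyUpTo (coeff P) (suc d) j (ℕ.m<n⇒m<1+n j<d)))))))))

      split-coeff : ∀ j → coeff P j + (coeff L j - coeff P j) ≈ coeff L j
      split-coeff j = ≈.trans (+-comm _ _) (≈.sym (difference-add (coeff L j) (coeff P j)))
        where open RingIdentities commutativeRing using (difference-add)

      limit-below : Below L d NFP
      limit-below j j≤d = cases (ℕ.m≤n⇒m<n∨m≡n j≤d)
        where
        cases : j ℕ.< d ⊎ j ≡ d → φ j ≤ℚ valℚ (coeff L j)
        cases (inj₁ j<d) = ≤ℚ-trans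
          (≤valℚ-+ (below j (ℕ.≤-trans j≤d d≤n)) (≤ℚ-trans
            (≤ℚ-trans (≤ℚ-reflexive (sym (+ℚ-identityʳ (φ j)))) (+ℚ-mono ≤ℚ-refl [ ℚ.<⇒≤ 0<κ₀ ]))
            (close-to-P j j<d)))
          (≤ℚ-reflexive (valℚ-cong (split-coeff j)))
        cases (inj₂ refl) = ≤ℚ-reflexive (trans φ-d (trans (sym valℚ-d) (valℚ-cong (≈.sym L-leading))))

      vertices-kept : ∀ j → j ℕ.≤ d → valℚ (coeff P j) ≤ℚ φ j → valℚ (coeff L j) ≤ℚ valℚ (coeff P j)
      vertices-kept j j≤d vertex = cases (ℕ.m≤n⇒m<n∨m≡n j≤d) (valℚ (coeff P j)) refl
        where
        cases : j ℕ.< d ⊎ j ≡ d → ∀ x → valℚ (coeff P j) ≡ x → valℚ (coeff L j) ≤ℚ valℚ (coeff P j)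
        cases (inj₂ refl) _     _  = ≤ℚ-reflexive (valℚ-cong L-leading)
        cases (inj₁ _)    ⊤⁺    eq = subst (valℚ (coeff L j) ≤ℚ_) (sym eq) (_ ≤⊤⁺)
        cases (inj₁ j<d)  [ x ] eq = ≤ℚ-trans (≤ℚ-reflexive (sym (valℚ-cong (split-coeff j))))
          (dominated (subst (_<ℚ valℚ (coeff L j - coeff P j)) (sym eq)
            (<-≤ℚ-trans (<-by κ₀ 0<κ₀ refl) (≤ℚ-trans
              (+ℚ-mono (subst (_≤ℚ φ j) eq vertex) ≤ℚ-refl) (close-to-P j j<d)))))

      limit-newton : IsNewtonFunction L d NFP
      limit-newton = convex-restrict d≤n , limit-below ,
        greatest-restrict {d} {V₀} {λ j → valℚ (coeff L j)} d≤n φ-d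
          (≤ℚ-reflexive (trans valℚ-d (sym φ-d))) vertices-kept

  Accurate : Poly → Set ℓ
  Accurate L = ∀ i → NewtonFunctionAtLeast (L -ₚ A i) d (λ x → NFP x +ℚ ℕ→ℚ (2 ℕ.^ i) ·ℚ κ)

  accurate : ∀ {L} → ConvergesCoefficientwise A L → HasDegree L d → coeff L d ≈ coeff P d → Accurate L
  accurate {L} A→L L-degree L-leading i =
    error-degree {L} A→L L-leading (proj₂ L-degree) i , accuracy {L} A→L L-leading i

  SlopeFactor : Poly → Set _
  SlopeFactor L =
    (ConvergesCoefficientwise A L × L ∣ₚ P × HasDegree L d × coeff L d ≈ coeff P d ×
     IsNewtonFunction L d NFP) ×
    ([ 0ℚ ] <ℚ κ × Accurate L)

  slope-factor : ∃ SlopeFactor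
  slope-factor = from-gain (finite-gain κ κ-positive)
    where
    finite-gain : ∀ k → [ 0ℚ ] <ℚ k → ∃ λ κ₀ → 0ℚ ℚ.< κ₀ × [ κ₀ ] ≤ℚ k
    finite-gain ⊤⁺     _        = 1ℚ , ℚ.positive⁻¹ 1ℚ , (_ ≤⊤⁺)
    finite-gain [ κ₀ ] [ 0<κ₀ ] = κ₀ , 0<κ₀ , ≤ℚ-refl
    from-gain : (∃ λ κ₀ → 0ℚ ℚ.< κ₀ × [ κ₀ ] ≤ℚ κ) → ∃ SlopeFactor
    from-gain (κ₀ , 0<κ₀ , κ₀≤κ) = conclude (Approximation.limit-exists 0<κ₀ (slack κ₀≤κ))
      where
      conclude : (∃ λ L → ConvergesCoefficientwise A L × L ∣ₚ P × HasDegree L d × coeff L d ≈ coeff P d) →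
        ∃ SlopeFactor
      conclude (L , A→L , L∣P , L-degree , L-leading) = L ,
        (A→L , L∣P , L-degree , L-leading , limit-newton {L} A→L L-leading 0<κ₀ (slack κ₀≤κ)) ,
        (κ-positive , accurate {L} A→L L-degree L-leading)

open import Data.Nat.Base using (_≤_; _^_)

theorem4p1 :
  ∀ {c ℓ} (K : CompleteDiscreteValuationField c ℓ) →
  let open CompleteDiscreteValuationField K
      open Polynomials K in
  (P : Poly) (n : ℕ) → HasDegree P n →
  (NFP : ℚ → ℚ ⁺) → IsNewtonFunction P n NFP →
  (d : ℕ) → d ≤ n →
  (v : ℤ) → val (coeff P d) ≡ [ v ] →
  IsExtremalPoint (Epigraph n NFP) (ℕ→ℚ d , ℤ→ℚ v) →
  let open Iteration P d
      κ = slopeGap n NFP d in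
  (∀ i → HasDegree (A i) d × coeff (A i) d ≈ coeff P d) ×
  (∃ λ A∞ →
    (ConvergesCoefficientwise A A∞ ×
     A∞ ∣ₚ P ×
     HasDegree A∞ d × coeff A∞ d ≈ coeff P d ×
     IsNewtonFunction A∞ d NFP) ×
    ([ 0ℚ ] <ℚ κ ×
     (∀ i → NewtonFunctionAtLeast (A∞ -ₚ A i) d
              (λ x → NFP x +ℚ ℕ→ℚ (2 ^ i) ·ℚ κ))))
theorem4p1 K P n P-degree NFP isNF d d≤n v val-d extremal =
  iterate-degree P d a_d≉0 , slope-factor
  where
  open SlopeFactorization K P n P-degree NFP isNF d d≤n v val-d extremal using (a_d≉0; slope-factor)
  open Euclid K using (iterate-degree)
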